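{- Let $\mathcal{O}$ be an effectively given étale order, and let $\mathcal{D}$ be a given finite subset of $\mathbb{Z}$ containing $0$. Then there exist only finitely many $\alpha\in\mathcal{O}$ such that the number system $(\alpha,\mathcal{D})$ has the finiteness property, and they are effectively computable.
   Context: An order is a commutative ring with $1$ whose additive group is free abelian of finite rank. A finite étale $\mathbb{Q}$-algebra is (up to isomorphism) a finite direct product $\mathbb{K}_1\times\cdots\times\mathbb{K}_\ell$ of number fields with coordinatewise operations; an étale order is an order $\mathcal{O}$ contained in such an algebra $\Omega$ with $\mathrm{rank}\,\mathcal{O}=[\Omega:\mathbb{Q}]$. $\mathcal{O}$ is effectively given if $\Omega=\mathcal{O}\otimes_{\mathbb{Z}}\mathbb{Q}=\mathbb{K}_1\times\cdots\times\mathbb{K}_\ell$ is given with each $\mathbb{K}_i$ given explicitly (e.g. by the minimal polynomial of a primitive element) and a $\mathbb{Z}$-basis of $\mathcal{O}$ is given explicitly as elements of $\Omega$ (each coordinate a $\mathbb{Q}$-linear combination of powers of the primitive element). For $\alpha\in\mathcal{O}$, $N(\alpha)$ is the determinant of the $\mathbb{Z}$-linear map $x\mapsto\alpha x$ on $\mathcal{O}$. A number system for $\mathcal{O}$ is a pair $(\alpha,\mathcal{D})$ with $\alpha\in\mathcal{O}$ not a zero divisor and $\mathcal{D}$ a complete residue system of $\mathbb{Z}$ modulo $N(\alpha)$; it has the finiteness property if every element of $\mathcal{O}$ can be written as a finite sum $\sum_{i=0}^L d_i\alpha^i$ with all $d_i\in\mathcal{D}$. -}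

module Defs where

open import Data.Nat using (ℕ; zero; suc)
open import Data.Integer using (ℤ; _+_; _*_; -_; _-_; 0ℤ; 1ℤ)
open import Data.Integer.Divisibility using (_∣_)
open import Data.Fin using (Fin; zero; suc; punchIn)
open import Data.Vec using (Vec; lookup; tabulate; replicate)
open import Data.List using (List; foldr)
open import Data.List.Membership.Propositional using (_∈_)
open import Data.List.Relation.Unary.All using (All)
open import Data.Product using (Σ; _×_; ∃)
open import Relation.Binary.PropositionalEquality using (_≡_)

∑ : (n : ℕ) → (Fin n → ℤ) → ℤ
∑ zero    f = 0ℤ
∑ (suc n) f = f zero + ∑ n (λ i → f (suc i))

sgn : {n : ℕ} → Fin n → ℤ
sgn zero    = 1ℤ
sgn (suc i) = - sgn i

det : (n : ℕ) → (Fin n → Fin n → ℤ) → ℤ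
det zero    M = 1ℤ
det (suc n) M = ∑ (suc n) (λ j → sgn j * (M zero j * det n (λ r c → M (suc r) (punchIn j c))))

-- Elements of a rank-n order in coordinates w.r.t. a fixed ℤ-basis e_0..e_(n-1)
Elem : ℕ → Set
Elem n = Vec ℤ n

module Arith {n : ℕ} (c : Fin n → Fin n → Fin n → ℤ) where
  -- structure constants: e_i * e_j = Σ_k c i j k e_k
  zeroE : Elem n
  zeroE = replicate n 0ℤ

  _⊕_ : Elem n → Elem n → Elem n
  x ⊕ y = tabulate (λ k → lookup x k + lookup y k)

  _⊗_ : Elem n → Elem n → Elem n
  x ⊗ y = tabulate (λ k → ∑ n (λ i → ∑ n (λ j → (lookup x i * lookup y j) * c i j k)))

  _·_ : ℤ → Elem n → Elem n
  d · x = tabulate (λ k → d * lookup x k)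

  pow : Elem n → Elem n → ℕ → Elem n
  pow one x zero    = one
  pow one x (suc m) = x ⊗ pow one x m

-- An order: a commutative ring with 1 whose additive group is ℤ^n (free of rank n),
-- given by its multiplication table w.r.t. a ℤ-basis.  It is étale (i.e. O ⊗ ℚ is a
-- finite étale ℚ-algebra = a finite product of number fields) iff it is reduced.
record Order : Set where
  field
    rank   : ℕ
    table  : Fin rank → Fin rank → Fin rank → ℤ
    one    : Elem rank
  open Arith table public
  field
    comm     : ∀ x y → x ⊗ y ≡ y ⊗ x
    assoc    : ∀ x y z → (x ⊗ y) ⊗ z ≡ x ⊗ (y ⊗ z)
    identity : ∀ x → one ⊗ x ≡ x
    reduced  : ∀ x k → pow one x (suc k) ≡ zeroE → x ≡ zeroE

module _ (O : Order) where
  open Order O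

  -- N(α) = det of x ↦ α x on O (matrix entry (k,j) = k-th coordinate of α e_j)
  N : Elem rank → ℤ
  N α = det rank (λ k j → ∑ rank (λ i → lookup α i * table i j k))

  NotZeroDivisor : Elem rank → Set
  NotZeroDivisor α = ∀ x → α ⊗ x ≡ zeroE → x ≡ zeroE

  CompleteResidueSystem : ℤ → List ℤ → Set
  CompleteResidueSystem m D =
    (∀ z → Σ ℤ λ d → d ∈ D × (m ∣ (z - d))) ×
    (∀ d d′ → d ∈ D → d′ ∈ D → m ∣ (d - d′) → d ≡ d′)

  IsNumberSystem : Elem rank → List ℤ → Set
  IsNumberSystem α D = NotZeroDivisor α × CompleteResidueSystem (N α) D

  eval : Elem rank → List ℤ → Elem rank
  eval α = foldr (λ d acc → (d · one) ⊕ (α ⊗ acc)) zeroE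

  HasFiniteness : Elem rank → List ℤ → Set
  HasFiniteness α D = ∀ x → Σ (List ℤ) λ ds → All (_∈ D) ds × eval α ds ≡ x

{-# OPTIONS --safe #-}
module Submission where

-- Let M bound the digits in absolute value.  Expanding M + 1 gives α γ = m with γ ∈ O and 1 ≤ m ≤ 2M + 1, so it
-- is enough to bound γ.  Expanding a large integer z = M + M q gives an equation for 1/α = γ/m whose leading
-- coefficient dominates the others by the factor q, hence γ^k = O((m (1 + 1/q))^k) for every q.  Since O is
-- reduced, its trace form is nondegenerate, and Newton's identities turn this into ‖x‖² ≤ C ‖x²‖ with C depending
-- only on O.  Applied to the powers of γ this yields ‖γ^k‖ ≤ 2C m^k for all k, in particular a bound for γ, and
-- finitely many candidates for α remain.
--
-- To decide whether a candidate α has the finiteness property, consider α ⊗ α acting on O ⊗ O.  If it fixes some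
-- W ≠ 0, then (α^k ⊗ 1) W = (1 ⊗ α^-k) W is integral and bounded, hence α^j w = w for some w ≠ 0 and j ≥ 1, which
-- contradicts the uniqueness of expansions.  Otherwise α ⊗ α - 1 is bounded below, and telescoping the sum of
-- α^-k ⊗ α^-k shows that some α^-k is a contraction.  Division by α then drives every element into an explicit
-- finite set, on which finiteness is decided by following orbits.

open import Defs
open import Data.Empty using (⊥; ⊥-elim)
open import Data.Fin.Base using (Fin; zero; suc; toℕ; fromℕ<; punchIn; combine; remQuot; _↑ˡ_; _↑ʳ_; _<_)
import Data.Fin.Properties as Finₚ
open import Data.Integer using (ℤ; 0ℤ)
open import Data.Integer.Base as ℤ using (1ℤ; _+_; _*_; -_; _-_; ∣_∣; -[1+_]) renaming (+_ to pos)
open import Data.Integer.DivMod using (_%ℕ_; _/ℕ_; n%ℕd<d; a≡a%ℕn+[a/ℕn]*n)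
open import Data.Integer.Divisibility using (_∣_)
import Data.Integer.Divisibility.Signed as Signed
import Data.Integer.Properties as ℤₚ
open import Data.Integer.Tactic.RingSolver using (solve-∀)
open import Data.List using (List)
open import Data.List.Base as List using ([]; _∷_; length; upTo; filter; concatMap; cartesianProductWith; _++_)
open import Data.List.Membership.Propositional using (_∈_; lose; find)
open import Data.List.Membership.Propositional.Properties
  using (∈-map⁺; ∈-++⁺ˡ; ∈-++⁺ʳ; ∈-upTo⁺; ∈-cartesianProductWith⁺; ∈-filter⁺; ∈-filter⁻; ∈-concatMap⁺)
open import Data.List.Relation.Unary.All as All using (All; []; _∷_)
open import Data.List.Relation.Unary.Any as Any using (Any; here; there)
open import Data.List.Relation.Unary.Any.Properties using (lookup-index)
open import Data.Nat.Base as ℕ using (ℕ; zero; suc; _≤_; z≤n; s≤s; NonZero)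
import Data.Nat.Divisibility as ℕ∣
open import Data.Nat.Induction using (<-rec)
import Data.Nat.Properties as ℕₚ
import Data.Nat.Tactic.RingSolver as ℕ-Ring
open import Data.Product using (Σ; _×_; _,_; ∃; ∃₂; proj₁; proj₂)
open import Data.Sum using (_⊎_; inj₁; inj₂)
open import Data.Unit.Base using (⊤; tt)
open import Data.Vec.Base using (Vec; []; _∷_; lookup; removeAt; tabulate)
open import Data.Vec.Properties using (lookup∘tabulate; tabulate∘lookup; tabulate-cong; lookup-replicate; ≡-dec)
open import Function using (_∘_; id)
open import Function.Bundles using (_⇔_; mk⇔)
open import Relation.Nullary using (Dec; yes; no)
open import Relation.Nullary.Decidable using (¬?; decidable-stable; map′; _×-dec_; _→-dec_)
open import Relation.Binary.PropositionalEquality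

-- Finite sums and integer linear algebra

-- Neither complex embeddings nor O ⊗ ℚ are constructed. The inverse 1/α is represented by the pair
-- γ, m, inequalities are cleared of denominators, and ‖x‖² ≤ C ‖x²‖ stands in for the comparison of
-- the sup norm with the largest conjugate. Each q brings its own implied constant; squaring
-- repeatedly and taking 2^j-th roots replaces it by C, and only then may q depend on k. A bound on
-- γ^k still allows conjugates of α on the unit circle, where division by α does not contract. Such
-- a conjugate and its complex conjugate multiply to 1, so they show up as an eigenvalue 1 of α ⊗ α,
-- and this can be tested by integer linear algebra. Uniqueness of expansions needs an argument: two
-- candidate digits satisfy α | d - d′ in O, whereas digits are separated modulo N(α). In the
-- Gaussian integers 2 divides 2 although its norm is 4. What helps is that every element has a
-- digit: then 1 generates O/αO, and an integer in αO is divisible by N(α).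

δ : ∀ {n} → Fin n → Fin n → ℤ
δ zero    zero    = 1ℤ
δ zero    (suc j) = 0ℤ
δ (suc i) zero    = 0ℤ
δ (suc i) (suc j) = δ i j

∑-cong : ∀ n {f g : Fin n → ℤ} → (∀ i → f i ≡ g i) → ∑ n f ≡ ∑ n g
∑-cong zero    e = refl
∑-cong (suc n) e = cong₂ _+_ (e zero) (∑-cong n (e ∘ suc))

∑-zero : ∀ n {f : Fin n → ℤ} → (∀ i → f i ≡ 0ℤ) → ∑ n f ≡ 0ℤ
∑-zero zero    e = refl
∑-zero (suc n) e = cong₂ _+_ (e zero) (∑-zero n (e ∘ suc))

∑-+ : ∀ n (f g : Fin n → ℤ) → ∑ n (λ i → f i + g i) ≡ ∑ n f + ∑ n g
∑-+ zero    f g = refl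
∑-+ (suc n) f g = trans (cong (f zero + g zero +_) (∑-+ n (f ∘ suc) (g ∘ suc))) (interchange (f zero) (g zero) (∑ n (f ∘ suc)) (∑ n (g ∘ suc)))
  where
  interchange : ∀ a b c d → a + b + (c + d) ≡ a + c + (b + d)
  interchange = solve-∀

∑-*ˡ : ∀ n c (f : Fin n → ℤ) → ∑ n (λ i → c * f i) ≡ c * ∑ n f
∑-*ˡ zero    c f = sym (ℤₚ.*-zeroʳ c)
∑-*ˡ (suc n) c f = trans (cong (c * f zero +_) (∑-*ˡ n c (f ∘ suc))) (sym (ℤₚ.*-distribˡ-+ c (f zero) (∑ n (f ∘ suc))))

∑-*ʳ : ∀ n c (f : Fin n → ℤ) → ∑ n (λ i → f i * c) ≡ ∑ n f * c
∑-*ʳ n c f = trans (∑-cong n (λ i → ℤₚ.*-comm (f i) c)) (trans (∑-*ˡ n c f) (ℤₚ.*-comm c (∑ n f)))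

∑-neg : ∀ n (f : Fin n → ℤ) → ∑ n (λ i → - f i) ≡ - ∑ n f
∑-neg zero    f = refl
∑-neg (suc n) f = trans (cong (- f zero +_) (∑-neg n (f ∘ suc))) (sym (ℤₚ.neg-distrib-+ (f zero) (∑ n (f ∘ suc))))

∑-swap : ∀ n m (f : Fin n → Fin m → ℤ) → ∑ n (λ i → ∑ m (f i)) ≡ ∑ m (λ j → ∑ n (λ i → f i j))
∑-swap zero    m f = sym (∑-zero m (λ _ → refl))
∑-swap (suc n) m f = trans (cong (∑ m (f zero) +_) (∑-swap n m (f ∘ suc))) (sym (∑-+ m (f zero) (λ j → ∑ n (λ i → f (suc i) j))))

∑-δ : ∀ n (f : Fin n → ℤ) j → ∑ n (λ i → f i * δ i j) ≡ f j
∑-δ (suc n) f zero    = trans (cong₂ _+_ (ℤₚ.*-identityʳ (f zero)) (∑-zero n (λ i → ℤₚ.*-zeroʳ (f (suc i))))) (ℤₚ.+-identityʳ (f zero))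
∑-δ (suc n) f (suc j) = trans (cong₂ _+_ (ℤₚ.*-zeroʳ (f zero)) (∑-δ n (f ∘ suc) j)) (ℤₚ.+-identityˡ (f (suc j)))

δ-sym : ∀ {n} (i j : Fin n) → δ i j ≡ δ j i
δ-sym zero    zero    = refl
δ-sym zero    (suc j) = refl
δ-sym (suc i) zero    = refl
δ-sym (suc i) (suc j) = δ-sym i j

∑-δˡ : ∀ n (f : Fin n → ℤ) j → ∑ n (λ i → δ j i * f i) ≡ f j
∑-δˡ n f j = trans (∑-cong n (λ i → trans (cong (_* f i) (δ-sym j i)) (ℤₚ.*-comm (δ i j) (f i)))) (∑-δ n f j)

∑-bound : ∀ n (f : Fin n → ℤ) r → (∀ i → ∣ f i ∣ ≤ r) → ∣ ∑ n f ∣ ≤ n ℕ.* r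
∑-bound zero    f r h = z≤n
∑-bound (suc n) f r h = ℕₚ.≤-trans (ℤₚ.∣i+j∣≤∣i∣+∣j∣ (f zero) (∑ n (f ∘ suc))) (ℕₚ.+-mono-≤ (h zero) (∑-bound n (f ∘ suc) r (h ∘ suc)))

bounded : ∀ n (f : Fin n → ℕ) → Σ ℕ λ b → ∀ i → f i ≤ b
bounded zero    f = 0 , λ ()
bounded (suc n) f with bounded n (f ∘ suc)
... | b , h = f zero ℕ.⊔ b , λ { zero → ℕₚ.m≤m⊔n _ _ ; (suc i) → ℕₚ.≤-trans (h i) (ℕₚ.m≤n⊔m (f zero) b) }

bounded₂ : ∀ p n (f : Fin p → Fin n → ℕ) → Σ ℕ λ b → ∀ i j → f i j ≤ b
bounded₂ p n f = proj₁ (bounded p (λ i → proj₁ (bounded n (f i)))) ,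
  λ i j → ℕₚ.≤-trans (proj₂ (bounded n (f i)) j) (proj₂ (bounded p (λ i → proj₁ (bounded n (f i)))) i)

∣i∣≤∣c*i∣ : ∀ c i → c ≢ 0ℤ → ∣ i ∣ ≤ ∣ c * i ∣
∣i∣≤∣c*i∣ c i c≢0 = subst (∣ i ∣ ≤_) (sym (ℤₚ.abs-* c i)) (ℕₚ.m≤n*m ∣ i ∣ ∣ c ∣ {{ℕ.≢-nonZero (c≢0 ∘ ℤₚ.∣i∣≡0⇒i≡0)}})

*-mono₃ : ∀ {a b c a′ b′ c′} → a ≤ a′ → b ≤ b′ → c ≤ c′ → a ℕ.* b ℕ.* c ≤ a′ ℕ.* b′ ℕ.* c′
*-mono₃ p q r = ℕₚ.*-mono-≤ (ℕₚ.*-mono-≤ p q) r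

Kernel : ∀ {p n} → (Fin p → Fin n → ℤ) → Set
Kernel {p} {n} M = Σ (Fin n → ℤ) λ w → (Σ (Fin n) λ j → w j ≢ 0ℤ) × (∀ i → ∑ n (λ j → M i j * w j) ≡ 0ℤ)

-- Injectivity over ℚ in quantitative form. An explicit constant replaces an inverse matrix, so M
-- may be rectangular and no fractions occur.
Coercive : ∀ {p n} → (Fin p → Fin n → ℤ) → Set
Coercive {p} {n} M = Σ ℕ λ b → ∀ (x : Fin n → ℤ) r → (∀ i → ∣ ∑ n (λ j → M i j * x j) ∣ ≤ r) → ∀ j → ∣ x j ∣ ≤ b ℕ.* r

-- Fraction-free clearing of the first column with pivot row `i`. The pivot row itself becomes zero
-- and may stay, so the number of rows does not change.
eliminate : ∀ {p n} → (Fin p → Fin (suc n) → ℤ) → Fin p → Fin p → Fin n → ℤ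
eliminate M i r j = M i zero * M r (suc j) - M r zero * M i (suc j)

-- Gaussian elimination, one column at a time. A zero first column puts the first unit vector in the
-- kernel. With a pivot, both a kernel vector and a bound for the eliminated matrix extend to the
-- first coordinate through the pivot row.
kernel-or-coercive : ∀ {p} n (M : Fin p → Fin n → ℤ) → Kernel M ⊎ Coercive M
kernel-or-coercive zero    M = inj₂ (0 , λ x r h → λ ())
kernel-or-coercive {p} (suc n) M with Finₚ.any? (λ i → ¬? (M i zero ℤₚ.≟ 0ℤ))
... | no ¬∃ = inj₁ (δ zero , (zero , λ ()) , λ i →
        trans (∑-cong (suc n) (λ j → trans (ℤₚ.*-comm (M i j) (δ zero j)) refl))
          (trans (∑-δˡ (suc n) (M i) zero) (decidable-stable (M i zero ℤₚ.≟ 0ℤ) (λ c → ¬∃ (i , c)))))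
... | yes (i , c≢0) with kernel-or-coercive n (eliminate M i)
...   | inj₁ (w , (j , wj≢0) , Mw≡0) = inj₁ (w′ , (suc j , w′j≢0) , M′w≡0)
  where
  c = M i zero
  s : Fin p → ℤ
  s r = ∑ n (λ j → M r (suc j) * w j)
  -- Scaling the tail by the pivot `c` makes the pivot equation solvable in integers.
  w′ : Fin (suc n) → ℤ
  w′ zero    = - s i
  w′ (suc j) = c * w j
  w′j≢0 : c * w j ≢ 0ℤ
  w′j≢0 e with ℤₚ.i*j≡0⇒i≡0∨j≡0 c e
  ... | inj₁ e₁ = c≢0 e₁
  ... | inj₂ e₂ = wj≢0 e₂
  distr : ∀ a b u v x → (a * u - b * v) * x ≡ a * (u * x) + (- b) * (v * x)
  distr = solve-∀
  regroup : ∀ a b x y → b * (- x) + a * y ≡ a * y + (- b) * x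
  regroup = solve-∀
  scale : ∀ a c x → a * (c * x) ≡ c * (a * x)
  scale = solve-∀
  M′w≡0 : ∀ r → ∑ (suc n) (λ j → M r j * w′ j) ≡ 0ℤ
  M′w≡0 r = begin
    M r zero * (- s i) + ∑ n (λ j → M r (suc j) * (c * w j))
      ≡⟨ cong (M r zero * (- s i) +_) (trans (∑-cong n (λ j → scale (M r (suc j)) c (w j))) (∑-*ˡ n c (λ j → M r (suc j) * w j))) ⟩
    M r zero * (- s i) + c * s r
      ≡⟨ regroup c (M r zero) (s i) (s r) ⟩
    c * s r + (- M r zero) * s i
      ≡⟨ sym (cong₂ _+_ (∑-*ˡ n c (λ j → M r (suc j) * w j)) (∑-*ˡ n (- M r zero) (λ j → M i (suc j) * w j))) ⟩
    ∑ n (λ j → c * (M r (suc j) * w j)) + ∑ n (λ j → (- M r zero) * (M i (suc j) * w j))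
      ≡⟨ sym (∑-+ n (λ j → c * (M r (suc j) * w j)) (λ j → (- M r zero) * (M i (suc j) * w j))) ⟩
    ∑ n (λ j → c * (M r (suc j) * w j) + (- M r zero) * (M i (suc j) * w j))
      ≡⟨ sym (∑-cong n (λ j → distr c (M r zero) (M r (suc j)) (M i (suc j)) (w j))) ⟩
    ∑ n (λ j → eliminate M i r j * w j)
      ≡⟨ Mw≡0 r ⟩
    0ℤ ∎
    where open ≡-Reasoning
...   | inj₂ (b , coer) = inj₂ (b₀ ℕ.⊔ b₁ , bound)
  where
  c = M i zero
  B : ℕ
  B = proj₁ (bounded₂ p (suc n) (λ i j → ∣ M i j ∣))
  M≤B : ∀ i j → ∣ M i j ∣ ≤ B
  M≤B = proj₂ (bounded₂ p (suc n) (λ i j → ∣ M i j ∣))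
  -- An eliminated row sends the tail to c y_k - M_k0 y_i, of size at most 2 B r; this gives `b₁`.
  -- The pivot row then reads c x_0 = y_i - s_i with |c| ≥ 1; this gives `b₀`.
  b₁ b₀ : ℕ
  b₁ = b ℕ.* (B ℕ.+ B)
  b₀ = 1 ℕ.+ n ℕ.* (B ℕ.* b₁)
  module _ (x : Fin (suc n) → ℤ) (r : ℕ) (h : ∀ i → ∣ ∑ (suc n) (λ j → M i j * x j) ∣ ≤ r) where
    y : Fin p → ℤ
    y k = ∑ (suc n) (λ j → M k j * x j)
    s : Fin p → ℤ
    s k = ∑ n (λ j → M k (suc j) * x (suc j))
    distr : ∀ a b u v x → (a * u - b * v) * x ≡ a * (u * x) + (- b) * (v * x)
    distr = solve-∀
    regroup : ∀ a b x p q → a * p + (- b) * q ≡ a * (b * x + p) + (- b) * (a * x + q)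
    regroup = solve-∀
    elim-y : ∀ k → ∑ n (λ j → eliminate M i k j * x (suc j)) ≡ c * y k + (- M k zero) * y i
    elim-y k = begin
      ∑ n (λ j → eliminate M i k j * x (suc j))
        ≡⟨ ∑-cong n (λ j → distr c (M k zero) (M k (suc j)) (M i (suc j)) (x (suc j))) ⟩
      ∑ n (λ j → c * (M k (suc j) * x (suc j)) + (- M k zero) * (M i (suc j) * x (suc j)))
        ≡⟨ ∑-+ n (λ j → c * (M k (suc j) * x (suc j))) (λ j → (- M k zero) * (M i (suc j) * x (suc j))) ⟩
      ∑ n (λ j → c * (M k (suc j) * x (suc j))) + ∑ n (λ j → (- M k zero) * (M i (suc j) * x (suc j)))
        ≡⟨ cong₂ _+_ (∑-*ˡ n c (λ j → M k (suc j) * x (suc j))) (∑-*ˡ n (- M k zero) (λ j → M i (suc j) * x (suc j))) ⟩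
      c * s k + (- M k zero) * s i
        ≡⟨ regroup c (M k zero) (x zero) (s k) (s i) ⟩
      c * y k + (- M k zero) * y i ∎
      where open ≡-Reasoning
    elim-bound : ∀ k → ∣ ∑ n (λ j → eliminate M i k j * x (suc j)) ∣ ≤ (B ℕ.+ B) ℕ.* r
    elim-bound k = begin
      ∣ ∑ n (λ j → eliminate M i k j * x (suc j)) ∣  ≡⟨ cong ∣_∣ (elim-y k) ⟩
      ∣ c * y k + (- M k zero) * y i ∣               ≤⟨ ℤₚ.∣i+j∣≤∣i∣+∣j∣ (c * y k) _ ⟩
      ∣ c * y k ∣ ℕ.+ ∣ (- M k zero) * y i ∣         ≡⟨ cong₂ ℕ._+_ (ℤₚ.abs-* c (y k)) (ℤₚ.abs-* (- M k zero) (y i)) ⟩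
      ∣ c ∣ ℕ.* ∣ y k ∣ ℕ.+ ∣ - M k zero ∣ ℕ.* ∣ y i ∣
        ≤⟨ ℕₚ.+-mono-≤ (ℕₚ.*-mono-≤ (M≤B i zero) (h k))
                       (ℕₚ.*-mono-≤ (subst (_≤ B) (sym (ℤₚ.∣-i∣≡∣i∣ (M k zero))) (M≤B k zero)) (h i)) ⟩
      B ℕ.* r ℕ.+ B ℕ.* r                            ≡⟨ sym (ℕₚ.*-distribʳ-+ r B B) ⟩
      (B ℕ.+ B) ℕ.* r                                ∎
      where open ℕₚ.≤-Reasoning
    tail-bound : ∀ j → ∣ x (suc j) ∣ ≤ b₁ ℕ.* r
    tail-bound j = ℕₚ.≤-trans (coer (x ∘ suc) ((B ℕ.+ B) ℕ.* r) elim-bound j) (ℕₚ.≤-reflexive (sym (ℕₚ.*-assoc b (B ℕ.+ B) r)))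
    isolate : ∀ u v → u ≡ (u + v) + (- v)
    isolate = solve-∀
    head-bound : ∣ x zero ∣ ≤ b₀ ℕ.* r
    head-bound = begin
      ∣ x zero ∣                ≤⟨ ∣i∣≤∣c*i∣ c (x zero) c≢0 ⟩
      ∣ c * x zero ∣            ≡⟨ cong ∣_∣ (isolate (c * x zero) (s i)) ⟩
      ∣ y i + (- s i) ∣         ≤⟨ ℤₚ.∣i+j∣≤∣i∣+∣j∣ (y i) _ ⟩
      ∣ y i ∣ ℕ.+ ∣ - s i ∣     ≡⟨ cong (∣ y i ∣ ℕ.+_) (ℤₚ.∣-i∣≡∣i∣ (s i)) ⟩
      ∣ y i ∣ ℕ.+ ∣ s i ∣
        ≤⟨ ℕₚ.+-mono-≤ (h i) (∑-bound n (λ j → M i (suc j) * x (suc j)) (B ℕ.* b₁ ℕ.* r) (λ j → begin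
             ∣ M i (suc j) * x (suc j) ∣          ≡⟨ ℤₚ.abs-* (M i (suc j)) (x (suc j)) ⟩
             ∣ M i (suc j) ∣ ℕ.* ∣ x (suc j) ∣    ≤⟨ ℕₚ.*-mono-≤ (M≤B i (suc j)) (tail-bound j) ⟩
             B ℕ.* (b₁ ℕ.* r)                     ≡⟨ sym (ℕₚ.*-assoc B b₁ r) ⟩
             B ℕ.* b₁ ℕ.* r                       ∎)) ⟩
      r ℕ.+ n ℕ.* (B ℕ.* b₁ ℕ.* r)                ≡⟨ cong (r ℕ.+_) (sym (ℕₚ.*-assoc n (B ℕ.* b₁) r)) ⟩
      b₀ ℕ.* r                                    ∎
      where open ℕₚ.≤-Reasoning
    bound : (j : Fin (suc n)) → ∣ x j ∣ ≤ (b₀ ℕ.⊔ b₁) ℕ.* r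
    bound zero    = ℕₚ.≤-trans head-bound (ℕₚ.*-monoˡ-≤ r (ℕₚ.m≤m⊔n b₀ b₁))
    bound (suc j) = ℕₚ.≤-trans (tail-bound j) (ℕₚ.*-monoˡ-≤ r (ℕₚ.m≤n⊔m b₀ b₁))

^-distribʳ-* : ∀ p m n → (m ℕ.* n) ℕ.^ p ≡ m ℕ.^ p ℕ.* n ℕ.^ p
^-distribʳ-* zero    m n = refl
^-distribʳ-* (suc p) m n = trans (cong (m ℕ.* n ℕ.*_) (^-distribʳ-* p m n)) (interchange m n (m ℕ.^ p) (n ℕ.^ p))
  where
  interchange : ∀ a b c d → a ℕ.* b ℕ.* (c ℕ.* d) ≡ a ℕ.* c ℕ.* (b ℕ.* d)
  interchange = ℕ-Ring.solve-∀

-- Determinants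

Matrix : ℕ → ℕ → Set
Matrix p n = Fin p → Fin n → ℤ

det-cong : ∀ n {M M′ : Matrix n n} → (∀ r c → M r c ≡ M′ r c) → det n M ≡ det n M′
det-cong zero    e = refl
det-cong (suc n) e = ∑-cong (suc n) λ j →
  cong (sgn j *_) (cong₂ _*_ (e zero j) (det-cong n (λ r c → e (suc r) (punchIn j c))))

det-δ : ∀ n → det n δ ≡ 1ℤ
det-δ zero    = refl
det-δ (suc n) = cong₂ _+_
  (trans (ℤₚ.*-identityˡ (1ℤ * det n δ)) (trans (ℤₚ.*-identityˡ (det n δ)) (det-δ n)))
  (∑-zero n (λ j → ℤₚ.*-zeroʳ (- sgn j)))

-- Expanding along the first row and then along the first column gives a formula that is
-- visibly symmetric under transposition.
module TransposeStep (n : ℕ)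
  (transpose₁ : ∀ (M : Matrix (suc n) (suc n)) → det (suc n) M ≡ det (suc n) (λ r c → M c r))
  (transpose₀ : ∀ (M : Matrix n n) → det n M ≡ det n (λ r c → M c r))
  (M : Matrix (2 ℕ.+ n) (2 ℕ.+ n)) where
  open ≡-Reasoning
  Mᵀ : Matrix (2 ℕ.+ n) (2 ℕ.+ n)
  Mᵀ r c = M c r
  inner : Matrix (2 ℕ.+ n) (2 ℕ.+ n) → Fin (suc n) → Fin (suc n) → ℤ
  inner M i j = det n (λ r c → M (suc (punchIn i r)) (suc (punchIn j c)))
  corner : Matrix (2 ℕ.+ n) (2 ℕ.+ n) → ℤ
  corner M = 1ℤ * (M zero zero * det (suc n) (λ r c → M (suc r) (suc c)))
  term : Matrix (2 ℕ.+ n) (2 ℕ.+ n) → Fin (suc n) → Fin (suc n) → ℤ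
  term M j i = (- sgn j) * (M zero (suc j) * (sgn i * (M (suc i) zero * inner M i j)))
  expand : ∀ M → det (2 ℕ.+ n) M ≡ corner M + ∑ (suc n) (λ j → ∑ (suc n) (term M j))
  expand M = cong (corner M +_) (∑-cong (suc n) λ j → begin
    (- sgn j) * (M zero (suc j) * det (suc n) (λ r c → M (suc r) (punchIn (suc j) c)))
      ≡⟨ cong (λ d → (- sgn j) * (M zero (suc j) * d)) (trans
           (transpose₁ (λ r c → M (suc r) (punchIn (suc j) c)))
           (∑-cong (suc n) λ i → cong (λ d → sgn i * (M (suc i) zero * d))
             (transpose₀ (λ r c → M (suc (punchIn i c)) (suc (punchIn j r)))))) ⟩
    (- sgn j) * (M zero (suc j) * ∑ (suc n) (λ i → sgn i * (M (suc i) zero * inner M i j)))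
      ≡⟨ sym (trans (∑-*ˡ (suc n) (- sgn j) (λ i → M zero (suc j) * (sgn i * (M (suc i) zero * inner M i j))))
           (cong ((- sgn j) *_) (∑-*ˡ (suc n) (M zero (suc j)) (λ i → sgn i * (M (suc i) zero * inner M i j))))) ⟩
    ∑ (suc n) (term M j) ∎)
  rearrange : ∀ s t a b d → (- s) * (a * (t * (b * d))) ≡ (- t) * (b * (s * (a * d)))
  rearrange = solve-∀
  term-transpose : ∀ i j → term M j i ≡ term Mᵀ i j
  term-transpose i j = trans
    (rearrange (sgn j) (sgn i) (M zero (suc j)) (M (suc i) zero) (inner M i j))
    (cong (λ d → (- sgn i) * (M (suc i) zero * (sgn j * (M zero (suc j) * d))))
      (transpose₀ (λ r c → M (suc (punchIn i r)) (suc (punchIn j c)))))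
  transpose : det (2 ℕ.+ n) M ≡ det (2 ℕ.+ n) Mᵀ
  transpose = begin
    det (2 ℕ.+ n) M
      ≡⟨ expand M ⟩
    corner M + ∑ (suc n) (λ j → ∑ (suc n) (term M j))
      ≡⟨ cong₂ _+_ (cong (λ d → 1ℤ * (M zero zero * d)) (transpose₁ (λ r c → M (suc r) (suc c))))
           (trans (∑-swap (suc n) (suc n) (term M))
             (∑-cong (suc n) λ i → ∑-cong (suc n) λ j → term-transpose i j)) ⟩
    corner Mᵀ + ∑ (suc n) (λ j → ∑ (suc n) (term Mᵀ j))
      ≡⟨ sym (expand Mᵀ) ⟩
    det (2 ℕ.+ n) Mᵀ ∎

det-transpose : ∀ n (M : Matrix n n) → det n M ≡ det n (λ r c → M c r)
det-transpose zero          M = refl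
det-transpose (suc zero)    M = refl
det-transpose (suc (suc n)) M = TransposeStep.transpose n (det-transpose (suc n)) (det-transpose n) M

swap₀₁ : ∀ {n} → Fin (2 ℕ.+ n) → Fin (2 ℕ.+ n)
swap₀₁ zero          = suc zero
swap₀₁ (suc zero)    = zero
swap₀₁ (suc (suc i)) = suc (suc i)

-- In the expansion along the first row the first two terms trade places, with opposite signs. Every
-- later minor still contains both columns in front, so induction applies to it.
det-swap-columns : ∀ n (M : Matrix (2 ℕ.+ n) (2 ℕ.+ n)) →
  det (2 ℕ.+ n) (λ r c → M r (swap₀₁ c)) ≡ - det (2 ℕ.+ n) M
det-swap-columns n M = begin
  det (2 ℕ.+ n) (λ r c → M r (swap₀₁ c))
    ≡⟨ cong₂ (λ a b → 1ℤ * (M zero (suc zero) * a) + ((- 1ℤ) * (M zero zero * b) + rest′))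
         (det-cong (suc n) {λ r c → M (suc r) (swap₀₁ (punchIn zero c))} {λ r c → M (suc r) (punchIn (suc zero) c)}
           (λ { r zero → refl ; r (suc c) → refl }))
         (det-cong (suc n) {λ r c → M (suc r) (swap₀₁ (punchIn (suc zero) c))} {λ r c → M (suc r) (punchIn zero c)} (λ { r zero → refl ; r (suc c) → refl })) ⟩
  1ℤ * (M zero (suc zero) * minor (suc zero)) + ((- 1ℤ) * (M zero zero * minor zero) + rest′)
    ≡⟨ cong (λ x → 1ℤ * (M zero (suc zero) * minor (suc zero)) + ((- 1ℤ) * (M zero zero * minor zero) + x))
         (trans (∑-cong n (later n M)) (∑-neg n (λ j → sgn (suc (suc j)) * (M zero (suc (suc j)) * minor (suc (suc j)))))) ⟩
  1ℤ * (M zero (suc zero) * minor (suc zero)) + ((- 1ℤ) * (M zero zero * minor zero) + (- rest))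
    ≡⟨ regroup (M zero (suc zero) * minor (suc zero)) (M zero zero * minor zero) rest ⟩
  - det (2 ℕ.+ n) M ∎
  where
  open ≡-Reasoning
  minor : Fin (2 ℕ.+ n) → ℤ
  minor j = det (suc n) (λ r c → M (suc r) (punchIn j c))
  rest rest′ : ℤ
  rest  = ∑ n (λ j → sgn (suc (suc j)) * (M zero (suc (suc j)) * minor (suc (suc j))))
  rest′ = ∑ n (λ j → sgn (suc (suc j)) *
    (M zero (suc (suc j)) * det (suc n) (λ r c → M (suc r) (swap₀₁ (punchIn (suc (suc j)) c)))))
  regroup : ∀ a b r → 1ℤ * a + ((- 1ℤ) * b + (- r)) ≡ - (1ℤ * b + ((- 1ℤ) * a + r))
  regroup = solve-∀
  neg-inside : ∀ s a d → s * (a * (- d)) ≡ - (s * (a * d))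
  neg-inside = solve-∀
  later : ∀ n (M : Matrix (2 ℕ.+ n) (2 ℕ.+ n)) (j : Fin n) →
    sgn (suc (suc j)) * (M zero (suc (suc j)) * det (suc n) (λ r c → M (suc r) (swap₀₁ (punchIn (suc (suc j)) c))))
    ≡ - (sgn (suc (suc j)) * (M zero (suc (suc j)) * det (suc n) (λ r c → M (suc r) (punchIn (suc (suc j)) c))))
  later (suc n) M j = trans
    (cong (λ d → sgn (suc (suc j)) * (M zero (suc (suc j)) * d)) (trans
      (det-cong (2 ℕ.+ n) {λ r c → M (suc r) (swap₀₁ (punchIn (suc (suc j)) c))} {λ r c → M (suc r) (punchIn (suc (suc j)) (swap₀₁ c))}
        (λ { r zero → refl ; r (suc zero) → refl ; r (suc (suc c)) → refl }))
      (det-swap-columns n (λ r c → M (suc r) (punchIn (suc (suc j)) c)))))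
    (neg-inside (sgn (suc (suc j))) (M zero (suc (suc j))) (det (2 ℕ.+ n) (λ r c → M (suc r) (punchIn (suc (suc j)) c))))

det-swap-rows : ∀ n (M : Matrix (2 ℕ.+ n) (2 ℕ.+ n)) →
  det (2 ℕ.+ n) (λ r c → M (swap₀₁ r) c) ≡ - det (2 ℕ.+ n) M
det-swap-rows n M = trans (det-transpose (2 ℕ.+ n) (λ r c → M (swap₀₁ r) c))
  (trans (det-swap-columns n (λ r c → M c r)) (cong -_ (sym (det-transpose (2 ℕ.+ n) M))))

front : ∀ {k} → Fin (suc k) → Fin (suc k) → Fin (suc k)
front l zero    = l
front l (suc r) = punchIn l r

-- Moving row l + 1 to the front is done by first moving it to the second place, which happens
-- inside the minors of the first row, and then swapping the first two rows.
det-front : ∀ k (l : Fin (suc k)) (M : Matrix (suc k) (suc k)) →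
  det (suc k) (λ r c → M (front l r) c) ≡ sgn l * det (suc k) M
det-front k       zero    M = trans
  (det-cong (suc k) {λ r c → M (front zero r) c} {M} (λ { zero c → refl ; (suc r) c → refl })) (sym (ℤₚ.*-identityˡ (det (suc k) M)))
det-front (suc k) (suc l) M = begin
  det (2 ℕ.+ k) (λ r c → M (front (suc l) r) c)
    ≡⟨ det-cong (2 ℕ.+ k) {λ r c → M (front (suc l) r) c} {λ r c → below (swap₀₁ r) c} (λ { zero c → refl ; (suc zero) c → refl ; (suc (suc r)) c → refl }) ⟩
  det (2 ℕ.+ k) (λ r c → below (swap₀₁ r) c)
    ≡⟨ det-swap-rows k below ⟩
  - det (2 ℕ.+ k) below
    ≡⟨ cong -_ (∑-cong (2 ℕ.+ k) λ j → trans
         (cong (λ d → sgn j * (M zero j * d)) (det-front k l (λ r c → M (suc r) (punchIn j c))))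
         (pull (sgn l) (sgn j) (M zero j) (minor j))) ⟩
  - ∑ (2 ℕ.+ k) (λ j → sgn l * (sgn j * (M zero j * minor j)))
    ≡⟨ cong -_ (∑-*ˡ (2 ℕ.+ k) (sgn l) (λ j → sgn j * (M zero j * minor j))) ⟩
  - (sgn l * det (2 ℕ.+ k) M)
    ≡⟨ ℤₚ.neg-distribˡ-* (sgn l) (det (2 ℕ.+ k) M) ⟩
  (- sgn l) * det (2 ℕ.+ k) M ∎
  where
  open ≡-Reasoning
  below : Matrix (2 ℕ.+ k) (2 ℕ.+ k)
  below zero    = M zero
  below (suc r) = M (suc (front l r))
  minor : Fin (2 ℕ.+ k) → ℤ
  minor j = det (suc k) (λ r c → M (suc r) (punchIn j c))
  pull : ∀ t s a d → s * (a * (t * d)) ≡ t * (s * (a * d))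
  pull = solve-∀

x≡-x⇒x≡0 : ∀ x → x ≡ - x → x ≡ 0ℤ
x≡-x⇒x≡0 (pos zero)  e = refl
x≡-x⇒x≡0 (pos (suc n)) ()
x≡-x⇒x≡0 -[1+ n ]  ()

sgn-involutive : ∀ {n} (l : Fin n) x → sgn l * (sgn l * x) ≡ x
sgn-involutive zero    x = trans (ℤₚ.*-identityˡ (1ℤ * x)) (ℤₚ.*-identityˡ x)
sgn-involutive (suc l) x = trans (neg-neg (sgn l) x) (sgn-involutive l x)
  where
  neg-neg : ∀ s x → (- s) * ((- s) * x) ≡ s * (s * x)
  neg-neg = solve-∀

-- Once the repeated row is moved to the front, the first two rows agree, and swapping them shows
-- that the determinant is its own negative.
det-first-row-repeated : ∀ n (M : Matrix (suc n) (suc n)) q → (∀ c → M zero c ≡ M (suc q) c) → det (suc n) M ≡ 0ℤ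
det-first-row-repeated (suc n) M q e = begin
  det (2 ℕ.+ n) M
    ≡⟨ sym (sgn-involutive (suc q) (det (2 ℕ.+ n) M)) ⟩
  sgn (suc q) * (sgn (suc q) * det (2 ℕ.+ n) M)
    ≡⟨ cong (sgn (suc q) *_) (trans (sym (det-front (suc n) (suc q) M)) (x≡-x⇒x≡0 (det (2 ℕ.+ n) M′) anti)) ⟩
  sgn (suc q) * 0ℤ
    ≡⟨ ℤₚ.*-zeroʳ (sgn (suc q)) ⟩
  0ℤ ∎
  where
  open ≡-Reasoning
  M′ : Matrix (2 ℕ.+ n) (2 ℕ.+ n)
  M′ r c = M (front (suc q) r) c
  anti : det (2 ℕ.+ n) M′ ≡ - det (2 ℕ.+ n) M′
  anti = trans
    (det-cong (2 ℕ.+ n) {M′} {λ r c → M′ (swap₀₁ r) c}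
      (λ { zero c → sym (e c) ; (suc zero) c → e c ; (suc (suc r)) c → refl }))
    (det-swap-rows n M′)

det-equal-rows : ∀ n (M : Matrix n n) p q → p ≢ q → (∀ c → M p c ≡ M q c) → det n M ≡ 0ℤ
det-equal-rows (suc n) M zero    zero    p≢q e = ⊥-elim (p≢q refl)
det-equal-rows (suc n) M zero    (suc q) p≢q e = det-first-row-repeated n M q e
det-equal-rows (suc n) M (suc p) zero    p≢q e = det-first-row-repeated n M p (λ c → sym (e c))
det-equal-rows (suc n) M (suc p) (suc q) p≢q e = ∑-zero (suc n) λ j → trans
  (cong (λ d → sgn j * (M zero j * d))
    (det-equal-rows n (λ r c → M (suc r) (punchIn j c)) p q (p≢q ∘ cong suc) (λ c → e (punchIn j c))))
  (trans (cong (sgn j *_) (ℤₚ.*-zeroʳ (M zero j))) (ℤₚ.*-zeroʳ (sgn j)))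

-- Sums over index tuples and the Cayley-Hamilton theorem

sumVec : ∀ n k → (Vec (Fin n) k → ℤ) → ℤ
sumVec n zero    g = g []
sumVec n (suc k) g = ∑ n (λ a → sumVec n k (λ i → g (a ∷ i)))

sumVec-cong : ∀ n k {f g : Vec (Fin n) k → ℤ} → (∀ i → f i ≡ g i) → sumVec n k f ≡ sumVec n k g
sumVec-cong n zero    e = e []
sumVec-cong n (suc k) e = ∑-cong n (λ a → sumVec-cong n k (λ i → e (a ∷ i)))

sumVec-zero : ∀ n k {f : Vec (Fin n) k → ℤ} → (∀ i → f i ≡ 0ℤ) → sumVec n k f ≡ 0ℤ
sumVec-zero n zero    e = e []
sumVec-zero n (suc k) e = ∑-zero n (λ a → sumVec-zero n k (λ i → e (a ∷ i)))

sumVec-*ˡ : ∀ n k c (f : Vec (Fin n) k → ℤ) → sumVec n k (λ i → c * f i) ≡ c * sumVec n k f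
sumVec-*ˡ n zero    c f = refl
sumVec-*ˡ n (suc k) c f = trans (∑-cong n (λ a → sumVec-*ˡ n k c (λ i → f (a ∷ i)))) (∑-*ˡ n c (λ a → sumVec n k (λ i → f (a ∷ i))))

sumVec-+ : ∀ n k (f g : Vec (Fin n) k → ℤ) → sumVec n k (λ i → f i + g i) ≡ sumVec n k f + sumVec n k g
sumVec-+ n zero    f g = refl
sumVec-+ n (suc k) f g = trans (∑-cong n (λ a → sumVec-+ n k (λ i → f (a ∷ i)) (λ i → g (a ∷ i))))
  (∑-+ n (λ a → sumVec n k (λ i → f (a ∷ i))) (λ a → sumVec n k (λ i → g (a ∷ i))))

sumVec-∑ : ∀ n k m (f : Vec (Fin n) k → Fin m → ℤ) → sumVec n k (λ i → ∑ m (f i)) ≡ ∑ m (λ l → sumVec n k (λ i → f i l))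
sumVec-∑ n zero    m f = refl
sumVec-∑ n (suc k) m f = trans (∑-cong n (λ a → sumVec-∑ n k m (λ i → f (a ∷ i))))
  (∑-swap n m (λ a l → sumVec n k (λ i → f (a ∷ i) l)))

-- The advantage of tuples over subsets: any position can be split off as an independent index. The
-- price is the factor k! in `E` and `F`.
sumVec-extract : ∀ n k (l : Fin (suc k)) (H : Fin n → Vec (Fin n) k → ℤ) →
  sumVec n (suc k) (λ i → H (lookup i l) (removeAt i l)) ≡ ∑ n (λ m → sumVec n k (H m))
sumVec-extract n k zero H = refl
sumVec-extract n (suc k) (suc l) H = trans
  (∑-cong n (λ a → trans
    (sumVec-cong n (suc k) {λ i → H (lookup (a ∷ i) (suc l)) (removeAt (a ∷ i) (suc l))}
      {λ i → H (lookup i l) (a ∷ removeAt i l)} (λ { (b ∷ i) → refl }))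
    (sumVec-extract n k l (λ m i → H m (a ∷ i)))))
  (∑-swap n n (λ a m → sumVec n k (λ i → H m (a ∷ i))))

-- With e_k the elementary symmetric functions of the eigenvalues of A, E k = k! e_k and
-- F k = k! (e_k A - e_(k-1) A² + …); thus F n = 0 is the Cayley–Hamilton theorem multiplied by A.
module TraceIdentity {n : ℕ} (A : Matrix n n) where

  E : ℕ → ℤ
  E k = sumVec n k (λ i → det k (λ r c → A (lookup i r) (lookup i c)))

  F : ℕ → Matrix n n
  F k a b = sumVec n k (λ i → det (suc k) (λ r c → A (lookup (a ∷ i) r) (lookup (b ∷ i) c)))

  F-zero : ∀ a b → F 0 a b ≡ A a b
  F-zero a b = unit (A a b)
    where
    unit : ∀ x → 1ℤ * (x * 1ℤ) + 0ℤ ≡ x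
    unit = solve-∀

  -- Expand along the row indexed by `a`. The entry `A a b` meets a principal minor. The entry in
  -- the column of i_l meets a minor in which the row i_l can be moved to the front; the two signs
  -- combine to -1 and leave the determinant defining `F k`. All k + 1 positions l contribute the
  -- same sum.
  F-suc : ∀ k a b → F (suc k) a b ≡ E (suc k) * A a b - (pos (suc k)) * ∑ n (λ m → A a m * F k m b)
  F-suc k a b = begin
    F (suc k) a b
      ≡⟨ sumVec-cong n (suc k) (λ i → cong₂ _+_ (first i) (∑-cong (suc k) (other i))) ⟩
    sumVec n (suc k) (λ i → A a b * principal i + ∑ (suc k) (λ l → (- 1ℤ) * H (lookup i l) (removeAt i l)))
      ≡⟨ sumVec-+ n (suc k) (λ i → A a b * principal i) (λ i → ∑ (suc k) (λ l → (- 1ℤ) * H (lookup i l) (removeAt i l))) ⟩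
    sumVec n (suc k) (λ i → A a b * principal i) + sumVec n (suc k) (λ i → ∑ (suc k) (λ l → (- 1ℤ) * H (lookup i l) (removeAt i l)))
      ≡⟨ cong₂ _+_ (sumVec-*ˡ n (suc k) (A a b) principal)
           (sumVec-∑ n (suc k) (suc k) (λ i l → (- 1ℤ) * H (lookup i l) (removeAt i l))) ⟩
    A a b * E (suc k) + ∑ (suc k) (λ l → sumVec n (suc k) (λ i → (- 1ℤ) * H (lookup i l) (removeAt i l)))
      ≡⟨ cong (A a b * E (suc k) +_) (∑-cong (suc k) (λ l → trans
           (sumVec-*ˡ n (suc k) (- 1ℤ) (λ i → H (lookup i l) (removeAt i l)))
           (cong ((- 1ℤ) *_) (trans (sumVec-extract n k l H)
             (∑-cong n (λ m → sumVec-*ˡ n k (A a m) (λ i → det (suc k) (λ r c → A (lookup (m ∷ i) r) (lookup (b ∷ i) c))))))))) ⟩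
    A a b * E (suc k) + ∑ (suc k) (λ l → (- 1ℤ) * S)
      ≡⟨ cong (A a b * E (suc k) +_) (∑-const (suc k) ((- 1ℤ) * S)) ⟩
    A a b * E (suc k) + (pos (suc k)) * ((- 1ℤ) * S)
      ≡⟨ regroup (A a b) (E (suc k)) (pos (suc k)) S ⟩
    E (suc k) * A a b - (pos (suc k)) * S ∎
    where
    open ≡-Reasoning
    S : ℤ
    S = ∑ n (λ m → A a m * F k m b)
    principal : Vec (Fin n) (suc k) → ℤ
    principal i = det (suc k) (λ r c → A (lookup i r) (lookup i c))
    H : Fin n → Vec (Fin n) k → ℤ
    H m i = A a m * det (suc k) (λ r c → A (lookup (m ∷ i) r) (lookup (b ∷ i) c))
    regroup : ∀ x e m s → x * e + m * ((- 1ℤ) * s) ≡ e * x - m * s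
    regroup = solve-∀
    ∑-const : ∀ m x → ∑ m (λ _ → x) ≡ (pos m) * x
    ∑-const zero    x = refl
    ∑-const (suc m) x = trans (cong (x +_) (∑-const m x)) (sym (trans (ℤₚ.*-distribʳ-+ x 1ℤ (pos m)) (cong (_+ pos m * x) (ℤₚ.*-identityˡ x))))
    first : ∀ i → 1ℤ * (A a b * principal i) ≡ A a b * principal i
    first i = ℤₚ.*-identityˡ (A a b * principal i)
    column : (i : Vec (Fin n) (suc k)) (l : Fin (suc k)) → Fin (suc k) → Fin n
    column i l c = lookup (b ∷ i) (punchIn (suc l) c)
    lookup-front : ∀ {k} (i : Vec (Fin n) (suc k)) l r → lookup i (front l r) ≡ lookup (lookup i l ∷ removeAt i l) r
    lookup-front i l zero = refl
    lookup-front i l (suc r) = lookup-punchIn i l r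
      where
      lookup-punchIn : ∀ {k} (i : Vec (Fin n) (suc k)) l r → lookup i (punchIn l r) ≡ lookup (removeAt i l) r
      lookup-punchIn (x ∷ xs)         zero    r       = refl
      lookup-punchIn (x ∷ xs@(_ ∷ _)) (suc l) zero    = refl
      lookup-punchIn (x ∷ xs@(_ ∷ _)) (suc l) (suc r) = lookup-punchIn xs l r
    lookup-column : ∀ i l c → column i l c ≡ lookup (b ∷ removeAt i l) c
    lookup-column i l zero    = refl
    lookup-column i l (suc c) = lookup-front i l (suc c)
    cancel : ∀ s a d → (- s) * (a * d) ≡ (- 1ℤ) * (a * (s * d))
    cancel = solve-∀
    other : ∀ i l → (- sgn l) * (A a (lookup i l) * det (suc k) (λ r c → A (lookup i r) (column i l c)))
      ≡ (- 1ℤ) * H (lookup i l) (removeAt i l)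
    other i l = trans (cancel (sgn l) (A a (lookup i l)) (det (suc k) (λ r c → A (lookup i r) (column i l c))))
      (cong (λ d → (- 1ℤ) * (A a (lookup i l) * d)) (trans
        (sym (det-front k l (λ r c → A (lookup i r) (column i l c))))
        (det-cong (suc k) (λ r c → cong₂ A (lookup-front i l r) (lookup-column i l c)))))

  -- Among n + 1 row indices two coincide.
  F-vanish : ∀ a b → F n a b ≡ 0ℤ
  F-vanish a b = sumVec-zero n n λ i → vanish i (Finₚ.pigeonhole ℕₚ.≤-refl (lookup (a ∷ i)))
    where
    vanish : ∀ i → (∃ λ p → ∃ λ q → p < q × lookup (a ∷ i) p ≡ lookup (a ∷ i) q) →
      det (suc n) (λ r c → A (lookup (a ∷ i) r) (lookup (b ∷ i) c)) ≡ 0ℤ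
    vanish i (p , q , p<q , e) = det-equal-rows (suc n) (λ r c → A (lookup (a ∷ i) r) (lookup (b ∷ i) c)) p q
      (λ p≡q → Finₚ.<⇒≢ p<q p≡q) (λ c → cong (λ k → A k (lookup (b ∷ i) c)) e)

-- Arithmetic and sup norm of an order

lookup-ext : ∀ {n} {x y : Elem n} → (∀ i → lookup x i ≡ lookup y i) → x ≡ y
lookup-ext {x = x} {y} e = trans (sym (tabulate∘lookup x)) (trans (tabulate-cong e) (tabulate∘lookup y))

‖_‖ : ∀ {n} → Elem n → ℕ
‖ [] ‖     = 0
‖ x ∷ xs ‖ = ∣ x ∣ ℕ.⊔ ‖ xs ‖

∣lookup∣≤‖‖ : ∀ {n} (x : Elem n) i → ∣ lookup x i ∣ ≤ ‖ x ‖
∣lookup∣≤‖‖ (x ∷ xs) zero    = ℕₚ.m≤m⊔n ∣ x ∣ ‖ xs ‖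
∣lookup∣≤‖‖ (x ∷ xs) (suc i) = ℕₚ.≤-trans (∣lookup∣≤‖‖ xs i) (ℕₚ.m≤n⊔m ∣ x ∣ ‖ xs ‖)

‖‖-least : ∀ {n} (x : Elem n) r → (∀ i → ∣ lookup x i ∣ ≤ r) → ‖ x ‖ ≤ r
‖‖-least []       r h = z≤n
‖‖-least (x ∷ xs) r h = ℕₚ.⊔-lub (h zero) (‖‖-least xs r (h ∘ suc))

‖‖-attained : ∀ {n} (x : Elem n) → ‖ x ‖ ≡ 0 ⊎ ∃ λ i → ‖ x ‖ ≡ ∣ lookup x i ∣
‖‖-attained []       = inj₁ refl
‖‖-attained (x ∷ xs) with ℕₚ.⊔-sel ∣ x ∣ ‖ xs ‖
... | inj₁ e = inj₂ (zero , e)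
... | inj₂ e with ‖‖-attained xs
...   | inj₁ e′       = inj₁ (trans e e′)
...   | inj₂ (i , e′) = inj₂ (suc i , trans e e′)

-- The laws of ⊕ and · do not involve the multiplication table.
module Linear {n : ℕ} (c : Fin n → Fin n → Fin n → ℤ) where
  open Arith c

  lookup-⊕ : ∀ x y i → lookup (x ⊕ y) i ≡ lookup x i + lookup y i
  lookup-⊕ x y i = lookup∘tabulate (λ k → lookup x k + lookup y k) i

  lookup-· : ∀ a x i → lookup (a · x) i ≡ a * lookup x i
  lookup-· a x i = lookup∘tabulate (λ k → a * lookup x k) i

  lookup-zeroE : ∀ i → lookup zeroE i ≡ 0ℤ
  lookup-zeroE i = lookup-replicate i 0ℤ

  ⊕-comm : ∀ x y → x ⊕ y ≡ y ⊕ x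
  ⊕-comm x y = lookup-ext λ i → trans (lookup-⊕ x y i) (trans (ℤₚ.+-comm (lookup x i) (lookup y i)) (sym (lookup-⊕ y x i)))

  ⊕-assoc : ∀ x y z → (x ⊕ y) ⊕ z ≡ x ⊕ (y ⊕ z)
  ⊕-assoc x y z = lookup-ext λ i → begin
    lookup ((x ⊕ y) ⊕ z) i                     ≡⟨ trans (lookup-⊕ (x ⊕ y) z i) (cong (_+ lookup z i) (lookup-⊕ x y i)) ⟩
    lookup x i + lookup y i + lookup z i       ≡⟨ ℤₚ.+-assoc (lookup x i) (lookup y i) (lookup z i) ⟩
    lookup x i + (lookup y i + lookup z i)     ≡⟨ sym (trans (lookup-⊕ x (y ⊕ z) i) (cong (lookup x i +_) (lookup-⊕ y z i))) ⟩
    lookup (x ⊕ (y ⊕ z)) i                     ∎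
    where open ≡-Reasoning

  ⊕-identityˡ : ∀ x → zeroE ⊕ x ≡ x
  ⊕-identityˡ x = lookup-ext λ i →
    trans (lookup-⊕ zeroE x i) (trans (cong (_+ lookup x i) (lookup-zeroE i)) (ℤₚ.+-identityˡ (lookup x i)))

  ⊕-identityʳ : ∀ x → x ⊕ zeroE ≡ x
  ⊕-identityʳ x = trans (⊕-comm x zeroE) (⊕-identityˡ x)

  ·-identity : ∀ x → 1ℤ · x ≡ x
  ·-identity x = lookup-ext λ i → trans (lookup-· 1ℤ x i) (ℤₚ.*-identityˡ (lookup x i))

  ·-zeroˡ : ∀ x → 0ℤ · x ≡ zeroE
  ·-zeroˡ x = lookup-ext λ i → trans (lookup-· 0ℤ x i) (sym (lookup-zeroE i))

  ·-zeroʳ : ∀ a → a · zeroE ≡ zeroE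
  ·-zeroʳ a = lookup-ext λ i →
    trans (lookup-· a zeroE i) (trans (cong (a *_) (lookup-zeroE i)) (trans (ℤₚ.*-zeroʳ a) (sym (lookup-zeroE i))))

  ·-assoc : ∀ a b x → a · (b · x) ≡ (a * b) · x
  ·-assoc a b x = lookup-ext λ i → begin
    lookup (a · (b · x)) i     ≡⟨ trans (lookup-· a (b · x) i) (cong (a *_) (lookup-· b x i)) ⟩
    a * (b * lookup x i)       ≡⟨ sym (ℤₚ.*-assoc a b (lookup x i)) ⟩
    a * b * lookup x i         ≡⟨ sym (lookup-· (a * b) x i) ⟩
    lookup ((a * b) · x) i     ∎
    where open ≡-Reasoning

  ·-comm : ∀ a b x → a · (b · x) ≡ b · (a · x)
  ·-comm a b x = trans (·-assoc a b x) (trans (cong (_· x) (ℤₚ.*-comm a b)) (sym (·-assoc b a x)))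

  ·-distribʳ : ∀ a b x → (a + b) · x ≡ (a · x) ⊕ (b · x)
  ·-distribʳ a b x = lookup-ext λ i → begin
    lookup ((a + b) · x) i                     ≡⟨ lookup-· (a + b) x i ⟩
    (a + b) * lookup x i                       ≡⟨ ℤₚ.*-distribʳ-+ (lookup x i) a b ⟩
    a * lookup x i + b * lookup x i            ≡⟨ sym (trans (lookup-⊕ (a · x) (b · x) i) (cong₂ _+_ (lookup-· a x i) (lookup-· b x i))) ⟩
    lookup ((a · x) ⊕ (b · x)) i               ∎
    where open ≡-Reasoning

  ·-distribˡ : ∀ a x y → a · (x ⊕ y) ≡ (a · x) ⊕ (a · y)
  ·-distribˡ a x y = lookup-ext λ i → begin
    lookup (a · (x ⊕ y)) i                     ≡⟨ trans (lookup-· a (x ⊕ y) i) (cong (a *_) (lookup-⊕ x y i)) ⟩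
    a * (lookup x i + lookup y i)              ≡⟨ ℤₚ.*-distribˡ-+ a (lookup x i) (lookup y i) ⟩
    a * lookup x i + a * lookup y i            ≡⟨ sym (trans (lookup-⊕ (a · x) (a · y) i) (cong₂ _+_ (lookup-· a x i) (lookup-· a y i))) ⟩
    lookup ((a · x) ⊕ (a · y)) i               ∎
    where open ≡-Reasoning

  ⊕-swap : ∀ x y z → x ⊕ (y ⊕ z) ≡ y ⊕ (x ⊕ z)
  ⊕-swap x y z = trans (sym (⊕-assoc x y z)) (trans (cong (_⊕ z) (⊕-comm x y)) (⊕-assoc y x z))

  ⊕-inverse : ∀ x → x ⊕ ((- 1ℤ) · x) ≡ zeroE
  ⊕-inverse x = trans (cong (_⊕ ((- 1ℤ) · x)) (sym (·-identity x))) (trans (sym (·-distribʳ 1ℤ (- 1ℤ) x)) (·-zeroˡ x))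

  ⊕-cancelˡ : ∀ x y z → x ⊕ y ≡ x ⊕ z → y ≡ z
  ⊕-cancelˡ x y z e = begin
    y                              ≡⟨ sym (undo y) ⟩
    ((- 1ℤ) · x) ⊕ (x ⊕ y)           ≡⟨ cong (((- 1ℤ) · x) ⊕_) e ⟩
    ((- 1ℤ) · x) ⊕ (x ⊕ z)           ≡⟨ undo z ⟩
    z                              ∎
    where
    open ≡-Reasoning
    undo : ∀ y → ((- 1ℤ) · x) ⊕ (x ⊕ y) ≡ y
    undo y = trans (sym (⊕-assoc ((- 1ℤ) · x) x y))
      (trans (cong (_⊕ y) (trans (⊕-comm ((- 1ℤ) · x) x) (⊕-inverse x))) (⊕-identityˡ y))

  ·-cancel : ∀ a x y → a ≢ 0ℤ → a · x ≡ a · y → x ≡ y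
  ·-cancel a x y a≢0 e = lookup-ext λ i → ℤₚ.*-cancelˡ-≡ a (lookup x i) (lookup y i) {{ℕ.≢-nonZero (a≢0 ∘ ℤₚ.∣i∣≡0⇒i≡0)}}
    (trans (sym (lookup-· a x i)) (trans (cong (λ v → lookup v i) e) (lookup-· a y i)))

  ·≡0⇒≡0 : ∀ a x → a ≢ 0ℤ → a · x ≡ zeroE → x ≡ zeroE
  ·≡0⇒≡0 a x a≢0 e = ·-cancel a x zeroE a≢0 (trans e (sym (·-zeroʳ a)))

  ‖zero‖ : ‖ zeroE ‖ ≡ 0
  ‖zero‖ = ℕₚ.n≤0⇒n≡0 (‖‖-least zeroE 0 (λ i → ℕₚ.≤-reflexive (cong ∣_∣ (lookup-zeroE i))))

  ‖⊕‖ : ∀ x y → ‖ x ⊕ y ‖ ≤ ‖ x ‖ ℕ.+ ‖ y ‖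
  ‖⊕‖ x y = ‖‖-least (x ⊕ y) _ λ i → begin
    ∣ lookup (x ⊕ y) i ∣                 ≡⟨ cong ∣_∣ (lookup-⊕ x y i) ⟩
    ∣ lookup x i + lookup y i ∣          ≤⟨ ℤₚ.∣i+j∣≤∣i∣+∣j∣ (lookup x i) (lookup y i) ⟩
    ∣ lookup x i ∣ ℕ.+ ∣ lookup y i ∣    ≤⟨ ℕₚ.+-mono-≤ (∣lookup∣≤‖‖ x i) (∣lookup∣≤‖‖ y i) ⟩
    ‖ x ‖ ℕ.+ ‖ y ‖                      ∎
    where open ℕₚ.≤-Reasoning

  ∣lookup-·∣ : ∀ a x i → ∣ lookup (a · x) i ∣ ≡ ∣ a ∣ ℕ.* ∣ lookup x i ∣
  ∣lookup-·∣ a x i = trans (cong ∣_∣ (lookup-· a x i)) (ℤₚ.abs-* a (lookup x i))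

  -- Equality, and not just an upper bound, is what later allows powers of m to be cancelled from
  -- inequalities between norms.
  ‖·‖ : ∀ a x → ‖ a · x ‖ ≡ ∣ a ∣ ℕ.* ‖ x ‖
  ‖·‖ a x = ℕₚ.≤-antisym
    (‖‖-least (a · x) _ λ i → ℕₚ.≤-trans (ℕₚ.≤-reflexive (∣lookup-·∣ a x i)) (ℕₚ.*-monoʳ-≤ ∣ a ∣ (∣lookup∣≤‖‖ x i)))
    (lower (‖‖-attained x))
    where
    lower : (‖ x ‖ ≡ 0 ⊎ ∃ λ i → ‖ x ‖ ≡ ∣ lookup x i ∣) → ∣ a ∣ ℕ.* ‖ x ‖ ≤ ‖ a · x ‖
    lower (inj₁ e)       = ℕₚ.≤-trans (ℕₚ.≤-reflexive (trans (cong (∣ a ∣ ℕ.*_) e) (ℕₚ.*-zeroʳ ∣ a ∣))) z≤n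
    lower (inj₂ (i , e)) = ℕₚ.≤-trans (ℕₚ.≤-reflexive (trans (cong (∣ a ∣ ℕ.*_) e) (sym (∣lookup-·∣ a x i)))) (∣lookup∣≤‖‖ (a · x) i)

module Algebra (O : Order) where
  open Order O public
  open Linear table public

  -- The matrix whose determinant is N x.
  mulMatrix : Elem rank → Matrix rank rank
  mulMatrix x k j = ∑ rank (λ i → lookup x i * table i j k)

  basis : Fin rank → Elem rank
  basis j = tabulate (δ j)

  lookup-⊗ : ∀ x y k → lookup (x ⊗ y) k ≡ ∑ rank (λ j → mulMatrix x k j * lookup y j)
  lookup-⊗ x y k = begin
    lookup (x ⊗ y) k
      ≡⟨ lookup∘tabulate (λ k → ∑ rank (λ i → ∑ rank (λ j → (lookup x i * lookup y j) * table i j k))) k ⟩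
    ∑ rank (λ i → ∑ rank (λ j → (lookup x i * lookup y j) * table i j k))
      ≡⟨ ∑-swap rank rank (λ i j → (lookup x i * lookup y j) * table i j k) ⟩
    ∑ rank (λ j → ∑ rank (λ i → (lookup x i * lookup y j) * table i j k))
      ≡⟨ ∑-cong rank (λ j → trans
           (∑-cong rank (λ i → rotate (lookup x i) (lookup y j) (table i j k)))
           (∑-*ʳ rank (lookup y j) (λ i → lookup x i * table i j k))) ⟩
    ∑ rank (λ j → mulMatrix x k j * lookup y j) ∎
    where
    open ≡-Reasoning
    rotate : ∀ a b c → a * b * c ≡ a * c * b
    rotate = solve-∀

  lookup-⊗-basis : ∀ x j k → lookup (x ⊗ basis j) k ≡ mulMatrix x k j
  lookup-⊗-basis x j k = trans (lookup-⊗ x (basis j) k)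
    (trans (∑-cong rank (λ l → cong (mulMatrix x k l *_) (trans (lookup∘tabulate (δ j) l) (δ-sym j l))))
      (∑-δ rank (mulMatrix x k) j))

  mulMatrix-⊗ : ∀ x y k j → mulMatrix (x ⊗ y) k j ≡ ∑ rank (λ l → mulMatrix x k l * mulMatrix y l j)
  mulMatrix-⊗ x y k j = begin
    mulMatrix (x ⊗ y) k j                                        ≡⟨ sym (lookup-⊗-basis (x ⊗ y) j k) ⟩
    lookup ((x ⊗ y) ⊗ basis j) k                                 ≡⟨ cong (λ v → lookup v k) (assoc x y (basis j)) ⟩
    lookup (x ⊗ (y ⊗ basis j)) k                                 ≡⟨ lookup-⊗ x (y ⊗ basis j) k ⟩
    ∑ rank (λ l → mulMatrix x k l * lookup (y ⊗ basis j) l)      ≡⟨ ∑-cong rank (λ l → cong (mulMatrix x k l *_) (lookup-⊗-basis y j l)) ⟩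
    ∑ rank (λ l → mulMatrix x k l * mulMatrix y l j)             ∎
    where open ≡-Reasoning

  ⊗-distribˡ : ∀ x y z → x ⊗ (y ⊕ z) ≡ (x ⊗ y) ⊕ (x ⊗ z)
  ⊗-distribˡ x y z = lookup-ext λ k → begin
    lookup (x ⊗ (y ⊕ z)) k
      ≡⟨ lookup-⊗ x (y ⊕ z) k ⟩
    ∑ rank (λ j → mulMatrix x k j * lookup (y ⊕ z) j)
      ≡⟨ ∑-cong rank (λ j → trans (cong (mulMatrix x k j *_) (lookup-⊕ y z j)) (ℤₚ.*-distribˡ-+ (mulMatrix x k j) (lookup y j) (lookup z j))) ⟩
    ∑ rank (λ j → mulMatrix x k j * lookup y j + mulMatrix x k j * lookup z j)
      ≡⟨ ∑-+ rank (λ j → mulMatrix x k j * lookup y j) (λ j → mulMatrix x k j * lookup z j) ⟩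
    ∑ rank (λ j → mulMatrix x k j * lookup y j) + ∑ rank (λ j → mulMatrix x k j * lookup z j)
      ≡⟨ sym (trans (lookup-⊕ (x ⊗ y) (x ⊗ z) k) (cong₂ _+_ (lookup-⊗ x y k) (lookup-⊗ x z k))) ⟩
    lookup ((x ⊗ y) ⊕ (x ⊗ z)) k ∎
    where open ≡-Reasoning

  ⊗-·ʳ : ∀ a x y → x ⊗ (a · y) ≡ a · (x ⊗ y)
  ⊗-·ʳ a x y = lookup-ext λ k → begin
    lookup (x ⊗ (a · y)) k
      ≡⟨ lookup-⊗ x (a · y) k ⟩
    ∑ rank (λ j → mulMatrix x k j * lookup (a · y) j)
      ≡⟨ ∑-cong rank (λ j → trans (cong (mulMatrix x k j *_) (lookup-· a y j)) (swap (mulMatrix x k j) a (lookup y j))) ⟩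
    ∑ rank (λ j → a * (mulMatrix x k j * lookup y j))
      ≡⟨ ∑-*ˡ rank a (λ j → mulMatrix x k j * lookup y j) ⟩
    a * ∑ rank (λ j → mulMatrix x k j * lookup y j)
      ≡⟨ sym (trans (lookup-· a (x ⊗ y) k) (cong (a *_) (lookup-⊗ x y k))) ⟩
    lookup (a · (x ⊗ y)) k ∎
    where
    open ≡-Reasoning
    swap : ∀ m a y → m * (a * y) ≡ a * (m * y)
    swap = solve-∀

  ⊗-·ˡ : ∀ a x y → (a · x) ⊗ y ≡ a · (x ⊗ y)
  ⊗-·ˡ a x y = trans (comm (a · x) y) (trans (⊗-·ʳ a y x) (cong (a ·_) (comm y x)))

  ⊗-zeroʳ : ∀ x → x ⊗ zeroE ≡ zeroE
  ⊗-zeroʳ x = trans (cong (x ⊗_) (sym (·-zeroˡ x))) (trans (⊗-·ʳ 0ℤ x x) (·-zeroˡ (x ⊗ x)))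

  ⊗-identityʳ : ∀ x → x ⊗ one ≡ x
  ⊗-identityʳ x = trans (comm x one) (identity x)

  ⊗-left-comm : ∀ x y z → x ⊗ (y ⊗ z) ≡ y ⊗ (x ⊗ z)
  ⊗-left-comm x y z = trans (sym (assoc x y z)) (trans (cong (_⊗ z) (comm x y)) (assoc y x z))

  infixr 8 _^_
  _^_ : Elem rank → ℕ → Elem rank
  x ^ k = pow one x k

  ^-+ : ∀ x a b → x ^ (a ℕ.+ b) ≡ (x ^ a) ⊗ (x ^ b)
  ^-+ x zero    b = sym (identity (x ^ b))
  ^-+ x (suc a) b = trans (cong (x ⊗_) (^-+ x a b)) (sym (assoc x (x ^ a) (x ^ b)))

  κ : ℕ
  κ = rank ℕ.* (rank ℕ.* proj₁ (bounded₂ rank rank (λ i j → proj₁ (bounded rank (λ k → ∣ table i j k ∣)))))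

  ‖⊗‖ : ∀ x y → ‖ x ⊗ y ‖ ≤ κ ℕ.* (‖ x ‖ ℕ.* ‖ y ‖)
  ‖⊗‖ x y = ‖‖-least (x ⊗ y) _ λ k → begin
    ∣ lookup (x ⊗ y) k ∣
      ≡⟨ cong ∣_∣ (lookup∘tabulate (λ k → ∑ rank (λ i → ∑ rank (λ j → (lookup x i * lookup y j) * table i j k))) k) ⟩
    ∣ ∑ rank (λ i → ∑ rank (λ j → (lookup x i * lookup y j) * table i j k)) ∣
      ≤⟨ ∑-bound rank (λ i → ∑ rank (λ j → (lookup x i * lookup y j) * table i j k)) _ (λ i →
           ∑-bound rank (λ j → (lookup x i * lookup y j) * table i j k) (B ℕ.* (‖ x ‖ ℕ.* ‖ y ‖)) (λ j → entry i j k)) ⟩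
    rank ℕ.* (rank ℕ.* (B ℕ.* (‖ x ‖ ℕ.* ‖ y ‖)))
      ≡⟨ sym (trans (ℕₚ.*-assoc rank (rank ℕ.* B) xy) (cong (rank ℕ.*_) (ℕₚ.*-assoc rank B xy))) ⟩
    κ ℕ.* (‖ x ‖ ℕ.* ‖ y ‖) ∎
    where
    open ℕₚ.≤-Reasoning
    xy B : ℕ
    xy = ‖ x ‖ ℕ.* ‖ y ‖
    B = proj₁ (bounded₂ rank rank (λ i j → proj₁ (bounded rank (λ k → ∣ table i j k ∣))))
    table≤B : ∀ i j k → ∣ table i j k ∣ ≤ B
    table≤B i j k = ℕₚ.≤-trans (proj₂ (bounded rank (λ k → ∣ table i j k ∣)) k)
      (proj₂ (bounded₂ rank rank (λ i j → proj₁ (bounded rank (λ k → ∣ table i j k ∣)))) i j)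
    entry : ∀ i j k → ∣ (lookup x i * lookup y j) * table i j k ∣ ≤ B ℕ.* xy
    entry i j k = begin
      ∣ (lookup x i * lookup y j) * table i j k ∣                        ≡⟨ ℤₚ.abs-* (lookup x i * lookup y j) (table i j k) ⟩
      ∣ lookup x i * lookup y j ∣ ℕ.* ∣ table i j k ∣                    ≡⟨ cong (ℕ._* ∣ table i j k ∣) (ℤₚ.abs-* (lookup x i) (lookup y j)) ⟩
      ∣ lookup x i ∣ ℕ.* ∣ lookup y j ∣ ℕ.* ∣ table i j k ∣              ≤⟨ *-mono₃ (∣lookup∣≤‖‖ x i) (∣lookup∣≤‖‖ y j) (table≤B i j k) ⟩
      ‖ x ‖ ℕ.* ‖ y ‖ ℕ.* B                                              ≡⟨ ℕₚ.*-comm xy B ⟩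
      B ℕ.* xy                                                           ∎

-- The trace form and the bound ‖x‖² ≤ C ‖x²‖

module Trace (O : Order) where
  open Algebra O public

  mulMatrix-⊕ : ∀ x y k j → mulMatrix (x ⊕ y) k j ≡ mulMatrix x k j + mulMatrix y k j
  mulMatrix-⊕ x y k j = trans
    (∑-cong rank (λ i → trans (cong (_* table i j k) (lookup-⊕ x y i)) (ℤₚ.*-distribʳ-+ (table i j k) (lookup x i) (lookup y i))))
    (∑-+ rank (λ i → lookup x i * table i j k) (λ i → lookup y i * table i j k))

  mulMatrix-· : ∀ a x k j → mulMatrix (a · x) k j ≡ a * mulMatrix x k j
  mulMatrix-· a x k j = trans
    (∑-cong rank (λ i → trans (cong (_* table i j k) (lookup-· a x i)) (ℤₚ.*-assoc a (lookup x i) (table i j k))))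
    (∑-*ˡ rank a (λ i → lookup x i * table i j k))

  tr : Elem rank → ℤ
  tr x = ∑ rank (λ j → mulMatrix x j j)

  tr-⊕ : ∀ x y → tr (x ⊕ y) ≡ tr x + tr y
  tr-⊕ x y = trans (∑-cong rank (λ j → mulMatrix-⊕ x y j j)) (∑-+ rank (λ j → mulMatrix x j j) (λ j → mulMatrix y j j))

  tr-· : ∀ a x → tr (a · x) ≡ a * tr x
  tr-· a x = trans (∑-cong rank (λ j → mulMatrix-· a x j j)) (∑-*ˡ rank a (λ j → mulMatrix x j j))

  tr-expand : ∀ x y → tr (x ⊗ y) ≡ ∑ rank (λ i → lookup x i * tr (basis i ⊗ y))
  tr-expand x y = trans (expand x) (∑-cong rank (λ i → cong (lookup x i *_) (sym (trans (expand (basis i))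
      (trans (∑-cong rank (λ k → cong (_* coeff k) (lookup∘tabulate (δ i) k))) (∑-δˡ rank coeff i))))))
    where
    coeff : Fin rank → ℤ
    coeff i = ∑ rank (λ l → ∑ rank (λ p → table i p l * mulMatrix y p l))
    expand : ∀ x → tr (x ⊗ y) ≡ ∑ rank (λ i → lookup x i * coeff i)
    expand x = begin
      ∑ rank (λ l → mulMatrix (x ⊗ y) l l)
        ≡⟨ ∑-cong rank (λ l → mulMatrix-⊗ x y l l) ⟩
      ∑ rank (λ l → ∑ rank (λ p → mulMatrix x l p * mulMatrix y p l))
        ≡⟨ ∑-cong rank (λ l → ∑-cong rank (λ p → trans
             (sym (∑-*ʳ rank (mulMatrix y p l) (λ i → lookup x i * table i p l)))
             (∑-cong rank (λ i → ℤₚ.*-assoc (lookup x i) (table i p l) (mulMatrix y p l))))) ⟩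
      ∑ rank (λ l → ∑ rank (λ p → ∑ rank (λ i → lookup x i * (table i p l * mulMatrix y p l))))
        ≡⟨ ∑-cong rank (λ l → trans
             (∑-swap rank rank (λ p i → lookup x i * (table i p l * mulMatrix y p l)))
             (∑-cong rank (λ i → ∑-*ˡ rank (lookup x i) (λ p → table i p l * mulMatrix y p l)))) ⟩
      ∑ rank (λ l → ∑ rank (λ i → lookup x i * ∑ rank (λ p → table i p l * mulMatrix y p l)))
        ≡⟨ trans (∑-swap rank rank (λ l i → lookup x i * ∑ rank (λ p → table i p l * mulMatrix y p l)))
             (∑-cong rank (λ i → ∑-*ˡ rank (lookup x i) (λ l → ∑ rank (λ p → table i p l * mulMatrix y p l)))) ⟩
      ∑ rank (λ i → lookup x i * coeff i) ∎
      where open ≡-Reasoning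

  ‖basis‖≤1 : ∀ j → ‖ basis j ‖ ≤ 1
  ‖basis‖≤1 j = ‖‖-least (basis j) 1 (λ i → subst (λ v → ∣ v ∣ ≤ 1) (sym (lookup∘tabulate (δ j) i)) (∣δ∣≤1 j i))
    where
    ∣δ∣≤1 : ∀ {n} (i j : Fin n) → ∣ δ i j ∣ ≤ 1
    ∣δ∣≤1 zero    zero    = ℕₚ.≤-refl
    ∣δ∣≤1 zero    (suc j) = z≤n
    ∣δ∣≤1 (suc i) zero    = z≤n
    ∣δ∣≤1 (suc i) (suc j) = ∣δ∣≤1 i j

  ‖⊗basis‖ : ∀ x j → ‖ x ⊗ basis j ‖ ≤ κ ℕ.* ‖ x ‖
  ‖⊗basis‖ x j = ℕₚ.≤-trans (‖⊗‖ x (basis j))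
    (ℕₚ.*-monoʳ-≤ κ (ℕₚ.≤-trans (ℕₚ.*-monoʳ-≤ ‖ x ‖ (‖basis‖≤1 j)) (ℕₚ.≤-reflexive (ℕₚ.*-identityʳ ‖ x ‖))))

  τ : ℕ
  τ = rank ℕ.* κ

  ∣tr∣ : ∀ x → ∣ tr x ∣ ≤ τ ℕ.* ‖ x ‖
  ∣tr∣ x = ℕₚ.≤-trans
    (∑-bound rank (λ j → mulMatrix x j j) (κ ℕ.* ‖ x ‖) (λ j → subst (λ v → ∣ v ∣ ≤ κ ℕ.* ‖ x ‖) (lookup-⊗-basis x j j)
      (ℕₚ.≤-trans (∣lookup∣≤‖‖ (x ⊗ basis j) j) (‖⊗basis‖ x j))))
    (ℕₚ.≤-reflexive (sym (ℕₚ.*-assoc rank κ ‖ x ‖)))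

  module Newton (y : Elem rank) where
    open TraceIdentity (mulMatrix y) public

    -- The elements of O whose multiplication matrices are the F k.
    f g : ℕ → Elem rank
    f k = (E k · y) ⊕ g k
    g zero    = zeroE
    g (suc k) = (- pos (suc k)) · (y ⊗ f k)

    mulMatrix-f : ∀ k a b → mulMatrix (f k) a b ≡ F k a b
    mulMatrix-f zero a b = trans (cong (λ v → mulMatrix v a b) (trans (⊕-identityʳ (1ℤ · y)) (·-identity y))) (sym (F-zero a b))
    mulMatrix-f (suc k) a b = begin
      mulMatrix ((E (suc k) · y) ⊕ g (suc k)) a b
        ≡⟨ mulMatrix-⊕ (E (suc k) · y) (g (suc k)) a b ⟩
      mulMatrix (E (suc k) · y) a b + mulMatrix (g (suc k)) a b
        ≡⟨ cong₂ _+_ (mulMatrix-· (E (suc k)) y a b) (trans (mulMatrix-· (- pos (suc k)) (y ⊗ f k) a b)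
             (cong ((- pos (suc k)) *_) (trans (mulMatrix-⊗ y (f k) a b)
               (∑-cong rank (λ l → cong (mulMatrix y a l *_) (mulMatrix-f k l b)))))) ⟩
      E (suc k) * mulMatrix y a b + (- pos (suc k)) * ∑ rank (λ m → mulMatrix y a m * F k m b)
        ≡⟨ sym (trans (F-suc k a b) (cong (E (suc k) * mulMatrix y a b +_) (ℤₚ.neg-distribˡ-* (pos (suc k)) (∑ rank (λ m → mulMatrix y a m * F k m b))))) ⟩
      F (suc k) a b ∎
      where open ≡-Reasoning

    tr-f : ∀ k → tr (f k) ≡ E (suc k)
    tr-f k = ∑-cong rank (λ a → mulMatrix-f k a a)

    -- Cayley-Hamilton inside O: an element is recovered from its multiplication matrix by applying
    -- the matrix to `one`.
    f-rank : f rank ≡ zeroE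
    f-rank = trans (sym (⊗-identityʳ (f rank))) (lookup-ext λ k → trans (lookup-⊗ (f rank) one k)
      (trans (∑-zero rank (λ j → cong (_* lookup one j) (trans (mulMatrix-f rank k j) (F-vanish k j)))) (sym (lookup-zeroE k))))

    -- If y is orthogonal to everything, only the last term of Newton's recursion survives.
    tr-nilpotent : (∀ z → tr (y ⊗ z) ≡ 0ℤ) → ∀ k → ∃ λ a → a ≢ 0ℤ × f k ≡ a · (y ^ suc k)
    tr-nilpotent h zero = 1ℤ , (λ ()) ,
      trans (⊕-identityʳ (1ℤ · y)) (cong (1ℤ ·_) (sym (⊗-identityʳ y)))
    tr-nilpotent h (suc k) with tr-nilpotent h k
    ... | a , a≢0 , e = - pos (suc k) * a , nonzero , (begin
      (E (suc k) · y) ⊕ g (suc k)                          ≡⟨ cong (λ v → (v · y) ⊕ g (suc k)) E≡0 ⟩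
      (0ℤ · y) ⊕ g (suc k)                                 ≡⟨ trans (cong (_⊕ g (suc k)) (·-zeroˡ y)) (⊕-identityˡ (g (suc k))) ⟩
      (- pos (suc k)) · (y ⊗ f k)                          ≡⟨ cong (λ v → (- pos (suc k)) · (y ⊗ v)) e ⟩
      (- pos (suc k)) · (y ⊗ (a · (y ^ suc k)))            ≡⟨ cong ((- pos (suc k)) ·_) (⊗-·ʳ a y (y ^ suc k)) ⟩
      (- pos (suc k)) · (a · (y ^ suc (suc k)))            ≡⟨ ·-assoc (- pos (suc k)) a (y ^ suc (suc k)) ⟩
      (- pos (suc k) * a) · (y ^ suc (suc k))              ∎)
      where
      open ≡-Reasoning
      E≡0 : E (suc k) ≡ 0ℤ
      E≡0 = trans (sym (tr-f k)) (trans (cong tr e) (trans (tr-· a (y ^ suc k))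
        (trans (cong (a *_) (h (y ^ k))) (ℤₚ.*-zeroʳ a))))
      nonzero : - pos (suc k) * a ≢ 0ℤ
      nonzero z with ℤₚ.i*j≡0⇒i≡0∨j≡0 (- pos (suc k)) z
      ... | inj₂ a≡0 = a≢0 a≡0

  -- For y orthogonal to everything, the element that vanishes by Cayley-Hamilton is a nonzero
  -- multiple of y^(rank + 1). Thus y is nilpotent, and this is where `reduced` enters.
  tr-nondegenerate : ∀ y → (∀ z → tr (y ⊗ z) ≡ 0ℤ) → y ≡ zeroE
  tr-nondegenerate y h with Newton.tr-nilpotent y h rank
  ... | a , a≢0 , e = reduced y rank (·≡0⇒≡0 a (y ^ suc rank) a≢0 (trans (sym e) (Newton.f-rank y)))

  traceForm : Matrix rank rank
  traceForm j i = tr (basis i ⊗ basis j)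

  traceForm-apply : ∀ (x : Fin rank → ℤ) j → ∑ rank (λ i → traceForm j i * x i) ≡ tr (tabulate x ⊗ basis j)
  traceForm-apply x j = sym (trans (tr-expand (tabulate x) (basis j)) (∑-cong rank (λ i →
    trans (cong (_* traceForm j i) (lookup∘tabulate x i)) (ℤₚ.*-comm (x i) (traceForm j i)))))

  -- A kernel vector would be orthogonal to all basis elements, hence to all of O.
  traceForm-coercive : Coercive traceForm
  traceForm-coercive with kernel-or-coercive rank traceForm
  ... | inj₂ coercive = coercive
  ... | inj₁ (w , (j , wj≢0) , Tw≡0) = ⊥-elim (wj≢0 (trans (sym (lookup∘tabulate w j))
          (trans (cong (λ v → lookup v j) (tr-nondegenerate (tabulate w) orthogonal)) (lookup-zeroE j))))
    where
    orthogonal : ∀ z → tr (tabulate w ⊗ z) ≡ 0ℤ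
    orthogonal z = trans (cong tr (comm (tabulate w) z)) (trans (tr-expand z (tabulate w)) (∑-zero rank (λ i →
      trans (cong (lookup z i *_) (trans (cong tr (comm (basis i) (tabulate w))) (trans (sym (traceForm-apply w i)) (Tw≡0 i))))
        (ℤₚ.*-zeroʳ (lookup z i)))))

  -- Modulo y² Newton's recursion reads E (k + 1) ≡ E k · tr y, and E (rank + 1) = 0, so (tr y) ^ (rank + 1) ≡ 0.
  -- The following bounds make this quantitative; X and S are upper bounds for ‖ y ‖ and ‖ y ⊗ y ‖.
  open ℕₚ.≤-Reasoning

  -- Homogeneity: `f k` has degree k + 1 in y and `E k` has degree k. The constants are chosen
  -- before y and depend only on O and k.
  f-bound : ∀ k → ∃ λ b → ∀ X y → ‖ y ‖ ≤ X → ‖ Newton.f y k ‖ ≤ b ℕ.* (X ℕ.* X ℕ.^ k)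
  E-bound : ∀ k → ∃ λ a → ∀ X y → ‖ y ‖ ≤ X → ∣ Newton.E y k ∣ ≤ a ℕ.* X ℕ.^ k

  f-bound zero = 1 , λ X y y≤X → begin
    ‖ (1ℤ · y) ⊕ zeroE ‖     ≡⟨ cong ‖_‖ (trans (⊕-identityʳ (1ℤ · y)) (·-identity y)) ⟩
    ‖ y ‖                    ≤⟨ y≤X ⟩
    X                        ≡⟨ sym (trans (ℕₚ.*-identityˡ (X ℕ.* 1)) (ℕₚ.*-identityʳ X)) ⟩
    1 ℕ.* (X ℕ.* 1)          ∎
  f-bound (suc k) with E-bound (suc k) | f-bound k
  ... | a , E≤ | b , f≤ = a ℕ.+ suc k ℕ.* (κ ℕ.* b) , λ X y y≤X → let open Newton y in begin
    ‖ (E (suc k) · y) ⊕ g (suc k) ‖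
      ≤⟨ ‖⊕‖ (E (suc k) · y) (g (suc k)) ⟩
    ‖ E (suc k) · y ‖ ℕ.+ ‖ g (suc k) ‖
      ≡⟨ cong₂ ℕ._+_ (‖·‖ (E (suc k)) y) (trans (‖·‖ (- pos (suc k)) (y ⊗ f k)) (cong (ℕ._* ‖ y ⊗ f k ‖) (ℤₚ.∣-i∣≡∣i∣ (pos (suc k))))) ⟩
    ∣ E (suc k) ∣ ℕ.* ‖ y ‖ ℕ.+ suc k ℕ.* ‖ y ⊗ f k ‖
      ≤⟨ ℕₚ.+-mono-≤ (ℕₚ.*-mono-≤ (E≤ X y y≤X) y≤X)
           (ℕₚ.*-monoʳ-≤ (suc k) (ℕₚ.≤-trans (‖⊗‖ y (f k)) (ℕₚ.*-monoʳ-≤ κ (ℕₚ.*-mono-≤ y≤X (f≤ X y y≤X))))) ⟩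
    a ℕ.* (X ℕ.* X ℕ.^ k) ℕ.* X ℕ.+ suc k ℕ.* (κ ℕ.* (X ℕ.* (b ℕ.* (X ℕ.* X ℕ.^ k))))
      ≡⟨ collect a (suc k) κ b X (X ℕ.^ k) ⟩
    (a ℕ.+ suc k ℕ.* (κ ℕ.* b)) ℕ.* (X ℕ.* (X ℕ.* X ℕ.^ k)) ∎
    where
    collect : ∀ a k κ b x p → a ℕ.* (x ℕ.* p) ℕ.* x ℕ.+ k ℕ.* (κ ℕ.* (x ℕ.* (b ℕ.* (x ℕ.* p))))
      ≡ (a ℕ.+ k ℕ.* (κ ℕ.* b)) ℕ.* (x ℕ.* (x ℕ.* p))
    collect = ℕ-Ring.solve-∀

  E-bound zero = 1 , λ X y y≤X → ℕₚ.≤-refl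
  E-bound (suc k) with f-bound k
  ... | b , f≤ = τ ℕ.* b , λ X y y≤X → let open Newton y in begin
    ∣ E (suc k) ∣                         ≡⟨ cong ∣_∣ (sym (tr-f k)) ⟩
    ∣ tr (f k) ∣                          ≤⟨ ∣tr∣ (f k) ⟩
    τ ℕ.* ‖ f k ‖                         ≤⟨ ℕₚ.*-monoʳ-≤ τ (f≤ X y y≤X) ⟩
    τ ℕ.* (b ℕ.* (X ℕ.* X ℕ.^ k))         ≡⟨ sym (ℕₚ.*-assoc τ b (X ℕ.* X ℕ.^ k)) ⟩
    τ ℕ.* b ℕ.* (X ℕ.* X ℕ.^ k)           ∎

  -- Since `g (k + 1)` is a multiple of y f(k) = E(k) y² + y g(k), each of its terms contains y².
  -- Multiplication by X replaces the expected X^(k-1) S by X^k S and so avoids truncated exponents.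
  g-bound : ∀ k → ∃ λ h → ∀ X S y → ‖ y ‖ ≤ X → ‖ y ⊗ y ‖ ≤ S → X ℕ.* ‖ Newton.g y k ‖ ≤ h ℕ.* (X ℕ.^ k ℕ.* S)
  g-bound zero = 0 , λ X S y _ _ → ℕₚ.≤-reflexive (trans (cong (X ℕ.*_) ‖zero‖) (ℕₚ.*-zeroʳ X))
  g-bound (suc k) with E-bound k | g-bound k
  ... | a , E≤ | h , g≤ = suc k ℕ.* (a ℕ.+ κ ℕ.* h) , λ X S y y≤X y²≤S → let open Newton y in begin
    X ℕ.* ‖ (- pos (suc k)) · (y ⊗ f k) ‖
      ≡⟨ cong (X ℕ.*_) (trans (‖·‖ (- pos (suc k)) (y ⊗ f k)) (cong₂ ℕ._*_ (ℤₚ.∣-i∣≡∣i∣ (pos (suc k)))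
           (cong ‖_‖ (trans (⊗-distribˡ y (E k · y) (g k)) (cong (_⊕ (y ⊗ g k)) (⊗-·ʳ (E k) y y)))))) ⟩
    X ℕ.* (suc k ℕ.* ‖ (E k · (y ⊗ y)) ⊕ (y ⊗ g k) ‖)
      ≤⟨ ℕₚ.*-monoʳ-≤ X (ℕₚ.*-monoʳ-≤ (suc k) (ℕₚ.≤-trans (‖⊕‖ (E k · (y ⊗ y)) (y ⊗ g k)) (ℕₚ.+-mono-≤
           (ℕₚ.≤-trans (ℕₚ.≤-reflexive (‖·‖ (E k) (y ⊗ y))) (ℕₚ.*-mono-≤ (E≤ X y y≤X) y²≤S))
           (ℕₚ.≤-trans (‖⊗‖ y (g k)) (ℕₚ.*-monoʳ-≤ κ (ℕₚ.≤-trans (ℕₚ.*-monoˡ-≤ ‖ g k ‖ y≤X) (g≤ X S y y≤X y²≤S))))))) ⟩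
    X ℕ.* (suc k ℕ.* (a ℕ.* X ℕ.^ k ℕ.* S ℕ.+ κ ℕ.* (h ℕ.* (X ℕ.^ k ℕ.* S))))
      ≡⟨ collect X (suc k) a (X ℕ.^ k) S κ h ⟩
    suc k ℕ.* (a ℕ.+ κ ℕ.* h) ℕ.* (X ℕ.* X ℕ.^ k ℕ.* S) ∎
    where
    collect : ∀ x k a p s κ h → x ℕ.* (k ℕ.* (a ℕ.* p ℕ.* s ℕ.+ κ ℕ.* (h ℕ.* (p ℕ.* s))))
      ≡ k ℕ.* (a ℕ.+ κ ℕ.* h) ℕ.* (x ℕ.* p ℕ.* s)
    collect = ℕ-Ring.solve-∀

  -- The error obeys E(k+1) - t^(k+1) = t (E(k) - t^k) + tr g(k) with t = tr y. The factor X² plays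
  -- the same role as the factor X in `g-bound`.
  trace-power : ∀ k → ∃ λ e → ∀ X S y → ‖ y ‖ ≤ X → ‖ y ⊗ y ‖ ≤ S →
    X ℕ.* X ℕ.* ∣ Newton.E y k - tr y ℤ.^ k ∣ ≤ e ℕ.* (X ℕ.^ k ℕ.* S)
  trace-power zero = 0 , λ X S y _ _ → ℕₚ.≤-reflexive (ℕₚ.*-zeroʳ (X ℕ.* X))
  trace-power (suc k) with trace-power k | g-bound k
  ... | e , err≤ | h , g≤ = τ ℕ.* (e ℕ.+ h) , λ X S y y≤X y²≤S → let open Newton y in begin
    X ℕ.* X ℕ.* ∣ E (suc k) - tr y * tr y ℤ.^ k ∣
      ≡⟨ cong (λ v → X ℕ.* X ℕ.* ∣ v ∣) (trans
           (cong (_- tr y * tr y ℤ.^ k) (trans (sym (tr-f k)) (trans (tr-⊕ (E k · y) (g k)) (cong (_+ tr (g k)) (tr-· (E k) y)))))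
           (factor (E k) (tr y) (tr (g k)) (tr y ℤ.^ k))) ⟩
    X ℕ.* X ℕ.* ∣ tr y * (E k - tr y ℤ.^ k) + tr (g k) ∣
      ≤⟨ ℕₚ.*-monoʳ-≤ (X ℕ.* X) (ℕₚ.≤-trans (ℤₚ.∣i+j∣≤∣i∣+∣j∣ (tr y * (E k - tr y ℤ.^ k)) (tr (g k))) (ℕₚ.+-mono-≤
           (ℕₚ.≤-trans (ℕₚ.≤-reflexive (ℤₚ.abs-* (tr y) (E k - tr y ℤ.^ k)))
             (ℕₚ.*-monoˡ-≤ ∣ E k - tr y ℤ.^ k ∣ (ℕₚ.≤-trans (∣tr∣ y) (ℕₚ.*-monoʳ-≤ τ y≤X))))
           (∣tr∣ (g k)))) ⟩
    X ℕ.* X ℕ.* (τ ℕ.* X ℕ.* ∣ E k - tr y ℤ.^ k ∣ ℕ.+ τ ℕ.* ‖ g k ‖)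
      ≡⟨ regroup X τ ∣ E k - tr y ℤ.^ k ∣ ‖ g k ‖ ⟩
    τ ℕ.* (X ℕ.* (X ℕ.* X ℕ.* ∣ E k - tr y ℤ.^ k ∣ ℕ.+ X ℕ.* ‖ g k ‖))
      ≤⟨ ℕₚ.*-monoʳ-≤ τ (ℕₚ.*-monoʳ-≤ X (ℕₚ.+-mono-≤ (err≤ X S y y≤X y²≤S) (g≤ X S y y≤X y²≤S))) ⟩
    τ ℕ.* (X ℕ.* (e ℕ.* (X ℕ.^ k ℕ.* S) ℕ.+ h ℕ.* (X ℕ.^ k ℕ.* S)))
      ≡⟨ collect X τ e h (X ℕ.^ k) S ⟩
    τ ℕ.* (e ℕ.+ h) ℕ.* (X ℕ.* X ℕ.^ k ℕ.* S) ∎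
    where
    factor : ∀ e t g p → e * t + g - t * p ≡ t * (e - p) + g
    factor = solve-∀
    regroup : ∀ x τ d g → x ℕ.* x ℕ.* (τ ℕ.* x ℕ.* d ℕ.+ τ ℕ.* g) ≡ τ ℕ.* (x ℕ.* (x ℕ.* x ℕ.* d ℕ.+ x ℕ.* g))
    regroup = ℕ-Ring.solve-∀
    collect : ∀ x τ e h p s → τ ℕ.* (x ℕ.* (e ℕ.* (p ℕ.* s) ℕ.+ h ℕ.* (p ℕ.* s))) ≡ τ ℕ.* (e ℕ.+ h) ℕ.* (x ℕ.* p ℕ.* s)
    collect = ℕ-Ring.solve-∀

  abs-^ : ∀ i k → ∣ i ℤ.^ k ∣ ≡ ∣ i ∣ ℕ.^ k
  abs-^ i zero    = refl
  abs-^ i (suc k) = trans (ℤₚ.abs-* i (i ℤ.^ k)) (cong (∣ i ∣ ℕ.*_) (abs-^ i k))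

  -- By Cayley-Hamilton E(rank + 1) = tr (f rank) = 0, so only the power of the trace remains in the
  -- error term.
  ∣tr∣-power : ∃ λ e → ∀ X S y → ‖ y ‖ ≤ X → ‖ y ⊗ y ‖ ≤ S →
    X ℕ.* X ℕ.* ∣ tr y ∣ ℕ.^ suc rank ≤ e ℕ.* (X ℕ.^ suc rank ℕ.* S)
  ∣tr∣-power with trace-power (suc rank)
  ... | e , err≤ = e , λ X S y y≤X y²≤S → ℕₚ.≤-trans (ℕₚ.≤-reflexive (cong (X ℕ.* X ℕ.*_) (sym (vanish y)))) (err≤ X S y y≤X y²≤S)
    where
    vanish : ∀ y → ∣ Newton.E y (suc rank) - tr y ℤ.^ suc rank ∣ ≡ ∣ tr y ∣ ℕ.^ suc rank
    vanish y = trans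
      (cong (λ v → ∣ v - tr y ℤ.^ suc rank ∣) (trans (sym (Newton.tr-f y rank)) (trans (cong tr (Newton.f-rank y)) tr-zero)))
      (trans (cong ∣_∣ (ℤₚ.+-identityˡ (- tr y ℤ.^ suc rank))) (trans (ℤₚ.∣-i∣≡∣i∣ (tr y ℤ.^ suc rank)) (abs-^ (tr y) (suc rank))))
      where
      tr-zero : tr zeroE ≡ 0ℤ
      tr-zero = trans (cong tr (sym (·-zeroˡ zeroE))) (tr-· 0ℤ zeroE)

  -- Apply `∣tr∣-power` to y = x e_j, for which y² = x² e_j² has norm at most a constant times ‖x²‖.
  -- By coercivity of the trace form ‖x‖ ≤ b t, where t is the largest of the |tr (x e_j)|.
  -- Inserting this in place of the trace and cancelling ‖x‖^(rank + 1) leaves the square of the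
  -- norm.
  square-bound : ∃ λ C → ∀ x → ‖ x ‖ ℕ.* ‖ x ‖ ≤ C ℕ.* ‖ x ⊗ x ‖
  square-bound = b ℕ.^ p ℕ.* (e ℕ.* (K ℕ.^ p ℕ.* (K ℕ.* K))) , bound
    where
    b e p K : ℕ
    b = proj₁ traceForm-coercive
    e = proj₁ ∣tr∣-power
    p = suc rank
    -- The successor keeps `K` positive even if κ = 0, so that ‖x‖ ≤ K ‖x‖.
    K = suc κ
    traces : Elem rank → Elem rank
    traces x = tabulate (λ j → tr (x ⊗ basis j))
    ‖x‖≤ : ∀ x → ‖ x ‖ ≤ b ℕ.* ‖ traces x ‖
    ‖x‖≤ x = ‖‖-least x _ (proj₂ traceForm-coercive (lookup x) ‖ traces x ‖ (λ j →
      subst (λ v → ∣ v ∣ ≤ ‖ traces x ‖)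
        (trans (lookup∘tabulate (λ j → tr (x ⊗ basis j)) j)
          (sym (trans (traceForm-apply (lookup x) j) (cong (λ v → tr (v ⊗ basis j)) (tabulate∘lookup x)))))
        (∣lookup∣≤‖‖ (traces x) j)))
    traces≤ : ∀ x j → let X = K ℕ.* ‖ x ‖ in
      X ℕ.* X ℕ.* ∣ tr (x ⊗ basis j) ∣ ℕ.^ p ≤ e ℕ.* (X ℕ.^ p ℕ.* (K ℕ.* (K ℕ.* ‖ x ⊗ x ‖)))
    traces≤ x j = proj₂ ∣tr∣-power (K ℕ.* ‖ x ‖) (K ℕ.* (K ℕ.* ‖ x ⊗ x ‖)) (x ⊗ basis j)
      (step x) (subst (λ v → ‖ v ‖ ≤ K ℕ.* (K ℕ.* ‖ x ⊗ x ‖)) (sym regroup)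
        (ℕₚ.≤-trans (step ((x ⊗ x) ⊗ basis j)) (ℕₚ.*-monoʳ-≤ K (step (x ⊗ x)))))
      where
      step : ∀ z → ‖ z ⊗ basis j ‖ ≤ K ℕ.* ‖ z ‖
      step z = ℕₚ.≤-trans (‖⊗basis‖ z j) (ℕₚ.*-monoˡ-≤ ‖ z ‖ (ℕₚ.n≤1+n κ))
      regroup : (x ⊗ basis j) ⊗ (x ⊗ basis j) ≡ ((x ⊗ x) ⊗ basis j) ⊗ basis j
      regroup = trans (assoc x (basis j) (x ⊗ basis j)) (trans (cong (x ⊗_) (trans (⊗-left-comm (basis j) x (basis j)) (sym (assoc x (basis j) (basis j)))))
        (trans (sym (assoc x (x ⊗ basis j) (basis j))) (cong (_⊗ basis j) (sym (assoc x x (basis j))))))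
    bound : ∀ x → ‖ x ‖ ℕ.* ‖ x ‖ ≤ b ℕ.^ p ℕ.* (e ℕ.* (K ℕ.^ p ℕ.* (K ℕ.* K))) ℕ.* ‖ x ⊗ x ‖
    bound x with ‖ x ‖ in ‖x‖≡ | ‖‖-attained (traces x)
    ... | zero      | _      = z≤n
    ... | X@(suc _) | inj₁ z = ⊥-elim (ℕₚ.<⇒≱ (ℕ.s≤s z≤n) (subst₂ _≤_ ‖x‖≡ (trans (cong (b ℕ.*_) z) (ℕₚ.*-zeroʳ b)) (‖x‖≤ x)))
    ... | X@(suc _) | inj₂ (j , ‖traces‖≡) = ℕₚ.*-cancelʳ-≤ (X ℕ.* X) (C ℕ.* S) (X ℕ.^ p) {{ℕₚ.m^n≢0 X p}} (begin
      X ℕ.* X ℕ.* X ℕ.^ p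
        ≤⟨ ℕₚ.*-mono-≤ (ℕₚ.*-mono-≤ (ℕₚ.m≤n*m X K) (ℕₚ.m≤n*m X K)) (ℕₚ.^-monoˡ-≤ p X≤bt) ⟩
      K ℕ.* X ℕ.* (K ℕ.* X) ℕ.* (b ℕ.* t) ℕ.^ p
        ≡⟨ cong (K ℕ.* X ℕ.* (K ℕ.* X) ℕ.*_) (^-distribʳ-* p b t) ⟩
      K ℕ.* X ℕ.* (K ℕ.* X) ℕ.* (b ℕ.^ p ℕ.* t ℕ.^ p)
        ≡⟨ shuffle (K ℕ.* X ℕ.* (K ℕ.* X)) (b ℕ.^ p) (t ℕ.^ p) ⟩
      b ℕ.^ p ℕ.* (K ℕ.* X ℕ.* (K ℕ.* X) ℕ.* t ℕ.^ p)
        ≤⟨ ℕₚ.*-monoʳ-≤ (b ℕ.^ p) (subst (λ Y → K ℕ.* Y ℕ.* (K ℕ.* Y) ℕ.* t ℕ.^ p ≤ e ℕ.* ((K ℕ.* Y) ℕ.^ p ℕ.* (K ℕ.* (K ℕ.* S)))) ‖x‖≡ (traces≤ x j)) ⟩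
      b ℕ.^ p ℕ.* (e ℕ.* ((K ℕ.* X) ℕ.^ p ℕ.* (K ℕ.* (K ℕ.* S))))
        ≡⟨ cong (λ v → b ℕ.^ p ℕ.* (e ℕ.* (v ℕ.* (K ℕ.* (K ℕ.* S))))) (^-distribʳ-* p K X) ⟩
      b ℕ.^ p ℕ.* (e ℕ.* (K ℕ.^ p ℕ.* X ℕ.^ p ℕ.* (K ℕ.* (K ℕ.* S))))
        ≡⟨ collect (b ℕ.^ p) e (K ℕ.^ p) (X ℕ.^ p) K S ⟩
      C ℕ.* S ℕ.* X ℕ.^ p ∎)
      where
      S t C : ℕ
      S = ‖ x ⊗ x ‖
      t = ∣ tr (x ⊗ basis j) ∣
      C = b ℕ.^ p ℕ.* (e ℕ.* (K ℕ.^ p ℕ.* (K ℕ.* K)))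
      X≤bt : X ≤ b ℕ.* t
      X≤bt = subst₂ _≤_ ‖x‖≡ (cong (b ℕ.*_) (trans ‖traces‖≡ (cong ∣_∣ (lookup∘tabulate (λ j → tr (x ⊗ basis j)) j)))) (‖x‖≤ x)
      shuffle : ∀ a b c → a ℕ.* (b ℕ.* c) ≡ b ℕ.* (a ℕ.* c)
      shuffle = ℕ-Ring.solve-∀
      collect : ∀ b e k x K s → b ℕ.* (e ℕ.* (k ℕ.* x ℕ.* (K ℕ.* (K ℕ.* s)))) ≡ b ℕ.* (e ℕ.* (k ℕ.* (K ℕ.* K))) ℕ.* s ℕ.* x
      collect = ℕ-Ring.solve-∀

-- Growth of the powers of 1/α

n<2^n : ∀ n → suc n ≤ 2 ℕ.^ n
n<2^n zero    = ℕₚ.≤-refl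
n<2^n (suc n) = begin
  suc (suc n)            ≤⟨ ℕₚ.+-monoˡ-≤ (suc n) (s≤s z≤n) ⟩
  suc n ℕ.+ suc n        ≤⟨ ℕₚ.+-mono-≤ (n<2^n n) (n<2^n n) ⟩
  2 ℕ.^ n ℕ.+ 2 ℕ.^ n    ≡⟨ cong (2 ℕ.^ n ℕ.+_) (sym (ℕₚ.+-identityʳ (2 ℕ.^ n))) ⟩
  2 ℕ.^ suc n            ∎
  where open ℕₚ.≤-Reasoning

-- The inequality 1 + p/e ≤ (1 + 1/e)^p multiplied by e^(p+1).
bernoulli : ∀ e p → e ℕ.^ p ℕ.* (e ℕ.+ p) ≤ e ℕ.* suc e ℕ.^ p
bernoulli e zero    = ℕₚ.≤-reflexive (unit e)
  where
  unit : ∀ e → 1 ℕ.* (e ℕ.+ 0) ≡ e ℕ.* 1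
  unit = ℕ-Ring.solve-∀
bernoulli e (suc p) = begin
  e ℕ.* e ℕ.^ p ℕ.* (e ℕ.+ suc p)                ≤⟨ ℕₚ.m≤m+n _ (e ℕ.^ p ℕ.* p) ⟩
  e ℕ.* e ℕ.^ p ℕ.* (e ℕ.+ suc p) ℕ.+ e ℕ.^ p ℕ.* p ≡⟨ factor e (e ℕ.^ p) p ⟩
  e ℕ.^ p ℕ.* (e ℕ.+ p) ℕ.* suc e                ≤⟨ ℕₚ.*-monoˡ-≤ (suc e) (bernoulli e p) ⟩
  e ℕ.* suc e ℕ.^ p ℕ.* suc e                    ≡⟨ rotate e (suc e ℕ.^ p) (suc e) ⟩
  e ℕ.* (suc e ℕ.* suc e ℕ.^ p)                  ∎
  where
  open ℕₚ.≤-Reasoning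
  factor : ∀ e x p → e ℕ.* x ℕ.* (e ℕ.+ (1 ℕ.+ p)) ℕ.+ x ℕ.* p ≡ x ℕ.* (e ℕ.+ p) ℕ.* (1 ℕ.+ e)
  factor = ℕ-Ring.solve-∀
  rotate : ∀ a b c → a ℕ.* b ℕ.* c ≡ a ℕ.* (c ℕ.* b)
  rotate = ℕ-Ring.solve-∀

-- If a ≥ e + 1, then (a/e)^P ≥ 1 + P/e by Bernoulli, which exceeds K for P = 2^(eK). Only exponents
-- 2^j are assumed because repeated squaring supplies no others.
absorb-constant : ∀ a e K .{{_ : NonZero e}} → (∀ j → a ℕ.^ (2 ℕ.^ j) ≤ K ℕ.* e ℕ.^ (2 ℕ.^ j)) → a ≤ e
absorb-constant a e K h with a ℕₚ.≤? e
... | yes a≤e = a≤e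
... | no  a≰e = ⊥-elim (ℕₚ.<⇒≱ (n<2^n (e ℕ.* K)) (ℕₚ.≤-trans (ℕₚ.m≤n+m P e) e+P≤eK))
  where
  P : ℕ
  P = 2 ℕ.^ (e ℕ.* K)
  open ℕₚ.≤-Reasoning
  e+P≤eK : e ℕ.+ P ≤ e ℕ.* K
  e+P≤eK = ℕₚ.*-cancelˡ-≤ (e ℕ.^ P) {{ℕₚ.m^n≢0 e P}} (begin
    e ℕ.^ P ℕ.* (e ℕ.+ P)        ≤⟨ bernoulli e P ⟩
    e ℕ.* suc e ℕ.^ P            ≤⟨ ℕₚ.*-monoʳ-≤ e (ℕₚ.^-monoˡ-≤ P (ℕₚ.≰⇒> a≰e)) ⟩
    e ℕ.* a ℕ.^ P                ≤⟨ ℕₚ.*-monoʳ-≤ e (h (e ℕ.* K)) ⟩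
    e ℕ.* (K ℕ.* e ℕ.^ P)        ≡⟨ rotate e K (e ℕ.^ P) ⟩
    e ℕ.^ P ℕ.* (e ℕ.* K)        ∎)
    where
    rotate : ∀ a b c → a ℕ.* (b ℕ.* c) ≡ c ℕ.* (a ℕ.* b)
    rotate = ℕ-Ring.solve-∀

-- That is, (1 + 1/q)^i ≤ q / (q - i) with q = i + r.
power-ratio : ∀ i r → suc (i ℕ.+ r) ℕ.^ i ℕ.* r ≤ (i ℕ.+ r) ℕ.^ i ℕ.* (i ℕ.+ r)
power-ratio zero    r = ℕₚ.≤-refl
power-ratio (suc i) r = begin
  suc q ℕ.* suc q ℕ.^ i ℕ.* r            ≡⟨ rotate (suc q) (suc q ℕ.^ i) r ⟩
  suc q ℕ.^ i ℕ.* (suc q ℕ.* r)          ≤⟨ ℕₚ.*-monoʳ-≤ (suc q ℕ.^ i) (begin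
                                              r ℕ.+ q ℕ.* r    ≤⟨ ℕₚ.+-monoˡ-≤ (q ℕ.* r) (ℕₚ.m≤n+m r (suc i)) ⟩
                                              q ℕ.+ q ℕ.* r    ≡⟨ commute q r ⟩
                                              suc r ℕ.* q      ∎) ⟩
  suc q ℕ.^ i ℕ.* (suc r ℕ.* q)          ≡⟨ sym (ℕₚ.*-assoc (suc q ℕ.^ i) (suc r) q) ⟩
  suc q ℕ.^ i ℕ.* suc r ℕ.* q            ≤⟨ ℕₚ.*-monoˡ-≤ q (subst (λ v → suc v ℕ.^ i ℕ.* suc r ≤ v ℕ.^ i ℕ.* v) (ℕₚ.+-suc i r) (power-ratio i (suc r))) ⟩
  q ℕ.^ i ℕ.* q ℕ.* q                    ≡⟨ cong (ℕ._* q) (ℕₚ.*-comm (q ℕ.^ i) q) ⟩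
  q ℕ.* q ℕ.^ i ℕ.* q                    ∎
  where
  open ℕₚ.≤-Reasoning
  q : ℕ
  q = suc i ℕ.+ r
  rotate : ∀ a b c → a ℕ.* b ℕ.* c ≡ b ℕ.* (a ℕ.* c)
  rotate = ℕ-Ring.solve-∀
  commute : ∀ q r → q ℕ.+ q ℕ.* r ≡ (1 ℕ.+ r) ℕ.* q
  commute = ℕ-Ring.solve-∀

-- The case i = r = k: with q = 2k the factor (1 + 1/q)^k is at most 2. This is the origin of the 2
-- in the bound for the powers of γ.
power-ratio≤2 : ∀ k → suc (k ℕ.+ k) ℕ.^ k ≤ 2 ℕ.* (k ℕ.+ k) ℕ.^ k
power-ratio≤2 zero      = s≤s z≤n
power-ratio≤2 k@(suc _) = ℕₚ.*-cancelʳ-≤ _ _ k (ℕₚ.≤-trans (power-ratio k k)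
  (ℕₚ.≤-reflexive (double k ((k ℕ.+ k) ℕ.^ k))))
  where
  double : ∀ k x → x ℕ.* (k ℕ.+ k) ≡ 2 ℕ.* x ℕ.* k
  double = ℕ-Ring.solve-∀

-- The hypothesis of growth is q u(j) ≤ m u(j - 1) + m² u(j - 2) + … + m^L u(j - L) for all j > L.  Its
-- conclusion u(j) ≤ K (m (q + 1) / q)^j propagates because (q/(q + 1)) + (q/(q + 1))² + … = q.
module Recurrence (u : ℕ → ℕ) (m : ℕ) .{{_ : NonZero m}} where

  -- The Horner form of u(l+k) + m u(l+k-1) + ... + m^(l-1) u(k+1), matching the way in which `eval`
  -- consumes digits.
  weighted : ℕ → ℕ → ℕ
  weighted zero    k = 0
  weighted (suc l) k = u (suc l ℕ.+ k) ℕ.+ m ℕ.* weighted l k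

  growth : ∀ q L → (∀ k → q ℕ.* u (suc L ℕ.+ k) ≤ m ℕ.* weighted L k) →
    ∃ λ K → ∀ j → u j ℕ.* q ℕ.^ j ≤ K ℕ.* (suc q ℕ.* m) ℕ.^ j
  growth q L rec = K , <-rec (λ j → u j ℕ.* q ℕ.^ j ≤ K ℕ.* b ℕ.^ j) step
    where
    b : ℕ
    b = suc q ℕ.* m
    initial : ∃ λ K → ∀ (i : Fin (suc L)) → u (toℕ i) ℕ.* q ℕ.^ toℕ i ≤ K
    initial = bounded (suc L) (λ i → u (toℕ i) ℕ.* q ℕ.^ toℕ i)
    K : ℕ
    K = proj₁ initial
    open ℕₚ.≤-Reasoning
    -- The induction closes because m + m q is exactly `b`.
    weighted-bound : ∀ l k → (∀ i → i ℕ.< suc l ℕ.+ k → u i ℕ.* q ℕ.^ i ≤ K ℕ.* b ℕ.^ i) →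
      m ℕ.* weighted l k ℕ.* q ℕ.^ (l ℕ.+ k) ≤ K ℕ.* b ℕ.^ (suc l ℕ.+ k)
    weighted-bound zero    k h = ℕₚ.≤-trans (ℕₚ.≤-reflexive (cong (ℕ._* q ℕ.^ k) (ℕₚ.*-zeroʳ m))) z≤n
    weighted-bound (suc l) k h = begin
      m ℕ.* (u j ℕ.+ m ℕ.* weighted l k) ℕ.* (q ℕ.* q ℕ.^ (l ℕ.+ k))
        ≡⟨ split m (u j) (weighted l k) q (q ℕ.^ (l ℕ.+ k)) ⟩
      m ℕ.* (u j ℕ.* (q ℕ.* q ℕ.^ (l ℕ.+ k))) ℕ.+ m ℕ.* q ℕ.* (m ℕ.* weighted l k ℕ.* q ℕ.^ (l ℕ.+ k))
        ≤⟨ ℕₚ.+-mono-≤ (ℕₚ.*-monoʳ-≤ m (h j ℕₚ.≤-refl))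
             (ℕₚ.*-monoʳ-≤ (m ℕ.* q) (weighted-bound l k (λ i i<j → h i (ℕₚ.m≤n⇒m≤1+n i<j)))) ⟩
      m ℕ.* (K ℕ.* b ℕ.^ j) ℕ.+ m ℕ.* q ℕ.* (K ℕ.* b ℕ.^ j)
        ≡⟨ merge m K (b ℕ.^ j) q ⟩
      K ℕ.* (b ℕ.* b ℕ.^ j) ∎
      where
      j : ℕ
      j = suc l ℕ.+ k
      split : ∀ m u w q x → m ℕ.* (u ℕ.+ m ℕ.* w) ℕ.* (q ℕ.* x) ≡ m ℕ.* (u ℕ.* (q ℕ.* x)) ℕ.+ m ℕ.* q ℕ.* (m ℕ.* w ℕ.* x)
      split = ℕ-Ring.solve-∀
      merge : ∀ m K x q → m ℕ.* (K ℕ.* x) ℕ.+ m ℕ.* q ℕ.* (K ℕ.* x) ≡ K ℕ.* ((1 ℕ.+ q) ℕ.* m ℕ.* x)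
      merge = ℕ-Ring.solve-∀
    beyond : ∀ k → (∀ i → i ℕ.< suc L ℕ.+ k → u i ℕ.* q ℕ.^ i ≤ K ℕ.* b ℕ.^ i) →
      u (suc L ℕ.+ k) ℕ.* q ℕ.^ (suc L ℕ.+ k) ≤ K ℕ.* b ℕ.^ (suc L ℕ.+ k)
    beyond k h = begin
      u (suc L ℕ.+ k) ℕ.* (q ℕ.* q ℕ.^ (L ℕ.+ k))      ≡⟨ rotate (u (suc L ℕ.+ k)) q (q ℕ.^ (L ℕ.+ k)) ⟩
      q ℕ.* u (suc L ℕ.+ k) ℕ.* q ℕ.^ (L ℕ.+ k)        ≤⟨ ℕₚ.*-monoˡ-≤ (q ℕ.^ (L ℕ.+ k)) (rec k) ⟩
      m ℕ.* weighted L k ℕ.* q ℕ.^ (L ℕ.+ k)           ≤⟨ weighted-bound L k h ⟩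
      K ℕ.* b ℕ.^ (suc L ℕ.+ k)                        ∎
      where
      rotate : ∀ a b c → a ℕ.* (b ℕ.* c) ≡ b ℕ.* a ℕ.* c
      rotate = ℕ-Ring.solve-∀
    step : ∀ j → (∀ {i} → i ℕ.< j → u i ℕ.* q ℕ.^ i ≤ K ℕ.* b ℕ.^ i) → u j ℕ.* q ℕ.^ j ≤ K ℕ.* b ℕ.^ j
    step j h with j ℕₚ.<? suc L
    ... | yes j≤L = begin
      u j ℕ.* q ℕ.^ j    ≤⟨ subst (λ v → u v ℕ.* q ℕ.^ v ≤ K) (Finₚ.toℕ-fromℕ< j≤L) (proj₂ initial (fromℕ< j≤L)) ⟩
      K                  ≤⟨ ℕₚ.m≤m*n K (b ℕ.^ j) {{ℕₚ.m^n≢0 b j {{ℕₚ.m*n≢0 (suc q) m}}}} ⟩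
      K ℕ.* b ℕ.^ j      ∎
    ... | no  j≰L = subst (λ v → u v ℕ.* q ℕ.^ v ≤ K ℕ.* b ℕ.^ v) j≡
        (beyond (j ℕ.∸ suc L) (λ i i<j → h (subst (i ℕ.<_) j≡ i<j)))
      where
      j≡ : suc L ℕ.+ (j ℕ.∸ suc L) ≡ j
      j≡ = ℕₚ.m+[n∸m]≡n (ℕₚ.≮⇒≥ j≰L)

  -- Iterating the square inequality gives u(k)^P ≤ C^P u(P k) for P = 2^j. Growth at P k has a
  -- factor K that does not depend on P, so it disappears on taking P-th roots: u(k) q^k ≤ C ((q +
  -- 1) m)^k. Since no K is left, q may now depend on k, and q = 2k is taken.
  growth⇒bounded : ∀ C .{{_ : NonZero C}} → (∀ k → u k ℕ.* u k ≤ C ℕ.* u (k ℕ.+ k)) →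
    (∀ q → ∃ λ K → ∀ j → u j ℕ.* q ℕ.^ j ≤ K ℕ.* (suc q ℕ.* m) ℕ.^ j) →
    ∀ k → u k ≤ 2 ℕ.* C ℕ.* m ℕ.^ k
  growth⇒bounded C square growing k = ℕₚ.*-cancelʳ-≤ (u k) (2 ℕ.* C ℕ.* m ℕ.^ k) ((k ℕ.+ k) ℕ.^ k) {{nonzero k}} (begin
      u k ℕ.* (k ℕ.+ k) ℕ.^ k                        ≤⟨ sharp (k ℕ.+ k) k ⟩
      C ℕ.* (suc (k ℕ.+ k) ℕ.* m) ℕ.^ k              ≡⟨ cong (C ℕ.*_) (^-distribʳ-* k (suc (k ℕ.+ k)) m) ⟩
      C ℕ.* (suc (k ℕ.+ k) ℕ.^ k ℕ.* m ℕ.^ k)        ≤⟨ ℕₚ.*-monoʳ-≤ C (ℕₚ.*-monoˡ-≤ (m ℕ.^ k) (power-ratio≤2 k)) ⟩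
      C ℕ.* (2 ℕ.* (k ℕ.+ k) ℕ.^ k ℕ.* m ℕ.^ k)      ≡⟨ rotate C ((k ℕ.+ k) ℕ.^ k) (m ℕ.^ k) ⟩
      2 ℕ.* C ℕ.* m ℕ.^ k ℕ.* (k ℕ.+ k) ℕ.^ k        ∎)
    where
    open ℕₚ.≤-Reasoning
    rotate : ∀ c x y → c ℕ.* (2 ℕ.* x ℕ.* y) ≡ 2 ℕ.* c ℕ.* y ℕ.* x
    rotate = ℕ-Ring.solve-∀
    nonzero : ∀ k → NonZero ((k ℕ.+ k) ℕ.^ k)
    -- For k = 0 the divisor is 0^0 = 1.
    nonzero zero    = _
    nonzero (suc k) = ℕₚ.m^n≢0 (suc k ℕ.+ suc k) (suc k)
    iterate-square : ∀ j k → u k ℕ.^ (2 ℕ.^ j) ≤ C ℕ.^ (2 ℕ.^ j) ℕ.* u (2 ℕ.^ j ℕ.* k)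
    iterate-square zero    k = ℕₚ.≤-trans (ℕₚ.≤-reflexive (ℕₚ.*-identityʳ (u k)))
      (ℕₚ.≤-trans (ℕₚ.m≤n*m (u k) (C ℕ.* 1) {{ℕₚ.m*n≢0 C 1}}) (ℕₚ.≤-reflexive (cong (λ v → C ℕ.* 1 ℕ.* u v) (sym (ℕₚ.*-identityˡ k)))))
    iterate-square (suc j) k = begin
      u k ℕ.^ (2 ℕ.* P)                              ≡⟨ sym (ℕₚ.^-*-assoc (u k) 2 P) ⟩
      (u k ℕ.* (u k ℕ.* 1)) ℕ.^ P                    ≡⟨ cong (λ v → (u k ℕ.* v) ℕ.^ P) (ℕₚ.*-identityʳ (u k)) ⟩
      (u k ℕ.* u k) ℕ.^ P                            ≤⟨ ℕₚ.^-monoˡ-≤ P (square k) ⟩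
      (C ℕ.* u (k ℕ.+ k)) ℕ.^ P                      ≡⟨ ^-distribʳ-* P C (u (k ℕ.+ k)) ⟩
      C ℕ.^ P ℕ.* u (k ℕ.+ k) ℕ.^ P                  ≤⟨ ℕₚ.*-monoʳ-≤ (C ℕ.^ P) (iterate-square j (k ℕ.+ k)) ⟩
      C ℕ.^ P ℕ.* (C ℕ.^ P ℕ.* u (P ℕ.* (k ℕ.+ k)))  ≡⟨ sym (ℕₚ.*-assoc (C ℕ.^ P) (C ℕ.^ P) _) ⟩
      C ℕ.^ P ℕ.* C ℕ.^ P ℕ.* u (P ℕ.* (k ℕ.+ k))    ≡⟨ cong₂ (λ v w → v ℕ.* u w)
                                                          (trans (sym (ℕₚ.^-distribˡ-+-* C P P)) (cong (λ v → C ℕ.^ (P ℕ.+ v)) (sym (ℕₚ.+-identityʳ P))))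
                                                          (double P k) ⟩
      C ℕ.^ (2 ℕ.* P) ℕ.* u (2 ℕ.* P ℕ.* k)          ∎
      where
      P : ℕ
      P = 2 ℕ.^ j
      double : ∀ p k → p ℕ.* (k ℕ.+ k) ≡ 2 ℕ.* p ℕ.* k
      double = ℕ-Ring.solve-∀
    nonzero-product : ∀ n → NonZero n → NonZero (C ℕ.* n)
    nonzero-product n n≢0 = ℕₚ.m*n≢0 C n
      where
      instance
        _ : NonZero n
        _ = n≢0
    sharp : ∀ q k → u k ℕ.* q ℕ.^ k ≤ C ℕ.* (suc q ℕ.* m) ℕ.^ k
    sharp q k with growing q
    ... | K , growth = absorb-constant (u k ℕ.* q ℕ.^ k) (C ℕ.* b ℕ.^ k) K
          {{nonzero-product (b ℕ.^ k) (ℕₚ.m^n≢0 b k {{ℕₚ.m*n≢0 (suc q) m}})}} λ j → let P = 2 ℕ.^ j in begin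
      (u k ℕ.* q ℕ.^ k) ℕ.^ P                                 ≡⟨ ^-distribʳ-* P (u k) (q ℕ.^ k) ⟩
      u k ℕ.^ P ℕ.* (q ℕ.^ k) ℕ.^ P                           ≤⟨ ℕₚ.*-monoˡ-≤ ((q ℕ.^ k) ℕ.^ P) (iterate-square j k) ⟩
      C ℕ.^ P ℕ.* u (P ℕ.* k) ℕ.* (q ℕ.^ k) ℕ.^ P             ≡⟨ cong (C ℕ.^ P ℕ.* u (P ℕ.* k) ℕ.*_) (power-power q k P) ⟩
      C ℕ.^ P ℕ.* u (P ℕ.* k) ℕ.* q ℕ.^ (P ℕ.* k)             ≡⟨ ℕₚ.*-assoc (C ℕ.^ P) (u (P ℕ.* k)) (q ℕ.^ (P ℕ.* k)) ⟩
      C ℕ.^ P ℕ.* (u (P ℕ.* k) ℕ.* q ℕ.^ (P ℕ.* k))           ≤⟨ ℕₚ.*-monoʳ-≤ (C ℕ.^ P) (growth (P ℕ.* k)) ⟩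
      C ℕ.^ P ℕ.* (K ℕ.* b ℕ.^ (P ℕ.* k))                     ≡⟨ cong (λ v → C ℕ.^ P ℕ.* (K ℕ.* v)) (sym (power-power b k P)) ⟩
      C ℕ.^ P ℕ.* (K ℕ.* (b ℕ.^ k) ℕ.^ P)                     ≡⟨ shuffle (C ℕ.^ P) K ((b ℕ.^ k) ℕ.^ P) ⟩
      K ℕ.* (C ℕ.^ P ℕ.* (b ℕ.^ k) ℕ.^ P)                     ≡⟨ cong (K ℕ.*_) (sym (^-distribʳ-* P C (b ℕ.^ k))) ⟩
      K ℕ.* (C ℕ.* b ℕ.^ k) ℕ.^ P                             ∎
      where
      b : ℕ
      b = suc q ℕ.* m
      power-power : ∀ x k P → (x ℕ.^ k) ℕ.^ P ≡ x ℕ.^ (P ℕ.* k)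
      power-power x k P = trans (ℕₚ.^-*-assoc x k P) (cong (x ℕ.^_) (ℕₚ.*-comm k P))
      shuffle : ∀ a b c → a ℕ.* (b ℕ.* c) ≡ b ℕ.* (a ℕ.* c)
      shuffle = ℕ-Ring.solve-∀

-- Expansions as recurrences for the powers of γ

module _ (O : Order) where
  open Trace O

  Expansion : Elem rank → List ℤ → Elem rank → Set
  Expansion α D x = Σ (List ℤ) λ ds → All (_∈ D) ds × eval O α ds ≡ x

  -- The empty word has no first digit; it is read as the digit 0 followed by the empty word, which
  -- uses 0 ∈ D.
  leading-digit : ∀ α {D x} → 0ℤ ∈ D → Expansion α D x →
    ∃₂ λ d ds → d ∈ D × All (_∈ D) ds × x ≡ (d · one) ⊕ (α ⊗ eval O α ds)
  leading-digit α 0∈D ([] , [] , e)           = 0ℤ , [] , 0∈D , [] ,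
    trans (sym e) (sym (trans (cong₂ _⊕_ (·-zeroˡ one) (⊗-zeroʳ α)) (⊕-identityˡ zeroE)))
  leading-digit α 0∈D (d ∷ ds , d∈D ∷ ds∈D , e) = d , ds , d∈D , ds∈D , sym e

  subtract-digit : ∀ z d w → z · one ≡ (d · one) ⊕ w → (z - d) · one ≡ w
  subtract-digit z d w e = ⊕-cancelˡ (d · one) ((z - d) · one) w
    (trans (sym (·-distribʳ d (z - d) one)) (trans (cong (_· one) (restore d z)) e))
    where
    restore : ∀ d z → d + (z - d) ≡ z
    restore = solve-∀

-- The quotient γ/m is 1/α without leaving O: a negative power of α is a power of γ together with a
-- power of m to be cancelled later.
module Inverse (O : Order) (α γ : Elem (Order.rank O)) (m : ℕ) .{{_ : NonZero m}}
  (αγ≡m : Order._⊗_ O α γ ≡ Order._·_ O (pos m) (Order.one O)) where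
  open Trace O

  m≢0 : pos m ≢ 0ℤ
  m≢0 e = ℕ.≢-nonZero⁻¹ m (cong ∣_∣ e)

  γα-cancel : ∀ x y → (γ ⊗ x) ⊗ (α ⊗ y) ≡ pos m · (x ⊗ y)
  γα-cancel x y = begin
    (γ ⊗ x) ⊗ (α ⊗ y)        ≡⟨ ⊗-left-comm (γ ⊗ x) α y ⟩
    α ⊗ ((γ ⊗ x) ⊗ y)        ≡⟨ cong (α ⊗_) (assoc γ x y) ⟩
    α ⊗ (γ ⊗ (x ⊗ y))        ≡⟨ sym (assoc α γ (x ⊗ y)) ⟩
    (α ⊗ γ) ⊗ (x ⊗ y)        ≡⟨ cong (_⊗ (x ⊗ y)) αγ≡m ⟩
    (pos m · one) ⊗ (x ⊗ y)  ≡⟨ trans (⊗-·ˡ (pos m) one (x ⊗ y)) (cong (pos m ·_) (identity (x ⊗ y))) ⟩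
    pos m · (x ⊗ y)          ∎
    where open ≡-Reasoning

  γ-cancel : ∀ y → γ ⊗ (α ⊗ y) ≡ pos m · y
  γ-cancel y = trans (cong (_⊗ (α ⊗ y)) (sym (⊗-identityʳ γ))) (trans (γα-cancel one y) (cong (pos m ·_) (identity y)))

  α-cancel : ∀ y → α ⊗ (γ ⊗ y) ≡ pos m · y
  α-cancel y = trans (⊗-left-comm α γ y) (γ-cancel y)

  α-injective : ∀ x y → α ⊗ x ≡ α ⊗ y → x ≡ y
  α-injective x y e = ·-cancel (pos m) x y m≢0 (trans (sym (γ-cancel x)) (trans (cong (γ ⊗_) e) (γ-cancel y)))

  notZeroDivisor : NotZeroDivisor O α
  notZeroDivisor x e = α-injective x zeroE (trans e (sym (⊗-zeroʳ α)))

  module _ (M : ℕ) .{{_ : NonZero M}} where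
    open Recurrence (λ k → ‖ γ ^ k ‖) m

    -- Multiplication by γ^(L+k), with L the number of digits, turns d_i α^i into d_i m^i γ^(L-i+k),
    -- so no power of α survives.
    eval-bound : ∀ ds → All (λ d → ∣ d ∣ ≤ M) ds → ∀ k →
      ‖ (γ ^ (length ds ℕ.+ k)) ⊗ eval O α ds ‖ ≤ M ℕ.* weighted (length ds) k
    eval-bound []       []       k = ℕₚ.≤-trans (ℕₚ.≤-reflexive (trans (cong ‖_‖ (⊗-zeroʳ (γ ^ k))) ‖zero‖)) z≤n
    eval-bound (d ∷ ds) (d≤ ∷ ds≤) k = begin
      ‖ (γ ⊗ γₙ) ⊗ ((d · one) ⊕ (α ⊗ e)) ‖
        ≡⟨ cong ‖_‖ (trans (⊗-distribˡ (γ ⊗ γₙ) (d · one) (α ⊗ e)) (cong₂ _⊕_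
             (trans (⊗-·ʳ d (γ ⊗ γₙ) one) (cong (d ·_) (⊗-identityʳ (γ ⊗ γₙ)))) (γα-cancel γₙ e))) ⟩
      ‖ (d · (γ ⊗ γₙ)) ⊕ (pos m · (γₙ ⊗ e)) ‖
        ≤⟨ ‖⊕‖ (d · (γ ⊗ γₙ)) (pos m · (γₙ ⊗ e)) ⟩
      ‖ d · (γ ⊗ γₙ) ‖ ℕ.+ ‖ pos m · (γₙ ⊗ e) ‖
        ≡⟨ cong₂ ℕ._+_ (‖·‖ d (γ ⊗ γₙ)) (‖·‖ (pos m) (γₙ ⊗ e)) ⟩
      ∣ d ∣ ℕ.* ‖ γ ⊗ γₙ ‖ ℕ.+ m ℕ.* ‖ γₙ ⊗ e ‖
        ≤⟨ ℕₚ.+-mono-≤ (ℕₚ.*-monoˡ-≤ ‖ γ ⊗ γₙ ‖ d≤) (ℕₚ.*-monoʳ-≤ m (eval-bound ds ds≤ k)) ⟩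
      M ℕ.* ‖ γ ⊗ γₙ ‖ ℕ.+ m ℕ.* (M ℕ.* weighted (length ds) k)
        ≡⟨ factor M ‖ γ ⊗ γₙ ‖ m (weighted (length ds) k) ⟩
      M ℕ.* (‖ γ ⊗ γₙ ‖ ℕ.+ m ℕ.* weighted (length ds) k) ∎
      where
      open ℕₚ.≤-Reasoning
      γₙ e : Elem rank
      γₙ = γ ^ (length ds ℕ.+ k)
      e = eval O α ds
      factor : ∀ M u m w → M ℕ.* u ℕ.+ m ℕ.* (M ℕ.* w) ≡ M ℕ.* (u ℕ.+ m ℕ.* w)
      factor = ℕ-Ring.solve-∀

    -- The expansion of z·1 with z = M + M q is a polynomial relation for γ/m with dominating leading term.
    expansion-recurrence : ∀ q d ds → ∣ d ∣ ≤ M → All (λ d → ∣ d ∣ ≤ M) ds →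
      (pos (M ℕ.+ M ℕ.* q) - d) · one ≡ α ⊗ eval O α ds →
      ∀ k → q ℕ.* ‖ γ ^ (suc (length ds) ℕ.+ k) ‖ ≤ m ℕ.* weighted (length ds) k
    expansion-recurrence q d ds d≤ ds≤ e k = ℕₚ.*-cancelˡ-≤ M (begin
      M ℕ.* (q ℕ.* ‖ γ ⊗ γₙ ‖)                ≡⟨ sym (ℕₚ.*-assoc M q ‖ γ ⊗ γₙ ‖) ⟩
      M ℕ.* q ℕ.* ‖ γ ⊗ γₙ ‖                  ≤⟨ ℕₚ.*-monoˡ-≤ ‖ γ ⊗ γₙ ‖ Mq≤ ⟩
      ∣ z - d ∣ ℕ.* ‖ γ ⊗ γₙ ‖                ≡⟨ sym (‖·‖ (z - d) (γ ⊗ γₙ)) ⟩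
      ‖ (z - d) · (γ ⊗ γₙ) ‖                  ≡⟨ cong ‖_‖ (trans (sym (trans (⊗-·ʳ (z - d) (γ ⊗ γₙ) one) (cong ((z - d) ·_) (⊗-identityʳ (γ ⊗ γₙ)))))
                                                  (trans (cong ((γ ⊗ γₙ) ⊗_) e) (γα-cancel γₙ (eval O α ds)))) ⟩
      ‖ pos m · (γₙ ⊗ eval O α ds) ‖          ≡⟨ ‖·‖ (pos m) (γₙ ⊗ eval O α ds) ⟩
      m ℕ.* ‖ γₙ ⊗ eval O α ds ‖              ≤⟨ ℕₚ.*-monoʳ-≤ m (eval-bound ds ds≤ k) ⟩
      m ℕ.* (M ℕ.* weighted (length ds) k)    ≡⟨ shuffle m M (weighted (length ds) k) ⟩
      M ℕ.* (m ℕ.* weighted (length ds) k)    ∎)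
      where
      open ℕₚ.≤-Reasoning
      z : ℤ
      z = pos (M ℕ.+ M ℕ.* q)
      γₙ : Elem rank
      γₙ = γ ^ (length ds ℕ.+ k)
      shuffle : ∀ a b c → a ℕ.* (b ℕ.* c) ≡ b ℕ.* (a ℕ.* c)
      shuffle = ℕ-Ring.solve-∀
      restore : ∀ z d → z ≡ z - d + d
      restore = solve-∀
      -- The extra `M` in `z` pays for the subtraction of the lowest digit.
      Mq≤ : M ℕ.* q ≤ ∣ z - d ∣
      Mq≤ = ℕₚ.+-cancelˡ-≤ M (M ℕ.* q) ∣ z - d ∣ (begin
        M ℕ.+ M ℕ.* q            ≡⟨ cong ∣_∣ (restore z d) ⟩
        ∣ z - d + d ∣            ≤⟨ ℤₚ.∣i+j∣≤∣i∣+∣j∣ (z - d) d ⟩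
        ∣ z - d ∣ ℕ.+ ∣ d ∣      ≤⟨ ℕₚ.+-monoʳ-≤ ∣ z - d ∣ d≤ ⟩
        ∣ z - d ∣ ℕ.+ M          ≡⟨ ℕₚ.+-comm ∣ z - d ∣ M ⟩
        M ℕ.+ ∣ z - d ∣          ∎)

  -- Each q uses the expansion of its own integer M + M q, whose length may vary with q. The length
  -- affects only the constant that `growth⇒bounded` removes, so the final factor depends on O
  -- alone. The successor makes that factor nonzero.
  powers-bounded : ∀ {D} M .{{_ : NonZero M}} → 0ℤ ∈ D → (∀ {d} → d ∈ D → ∣ d ∣ ≤ M) → HasFiniteness O α D →
    ∀ k → ‖ γ ^ k ‖ ≤ 2 ℕ.* suc (proj₁ square-bound) ℕ.* m ℕ.^ k
  powers-bounded {D} M 0∈D D≤M finite = growth⇒bounded (suc (proj₁ square-bound)) square λ q →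
      growth-from q (finite (pos (M ℕ.+ M ℕ.* q) · one))
    where
    open Recurrence (λ k → ‖ γ ^ k ‖) m
    square : ∀ k → ‖ γ ^ k ‖ ℕ.* ‖ γ ^ k ‖ ≤ suc (proj₁ square-bound) ℕ.* ‖ γ ^ (k ℕ.+ k) ‖
    square k = ℕₚ.≤-trans (proj₂ square-bound (γ ^ k))
      (subst (λ v → proj₁ square-bound ℕ.* ‖ v ‖ ≤ suc (proj₁ square-bound) ℕ.* ‖ γ ^ (k ℕ.+ k) ‖) (^-+ γ k k)
        (ℕₚ.*-monoˡ-≤ ‖ γ ^ (k ℕ.+ k) ‖ (ℕₚ.n≤1+n (proj₁ square-bound))))
    growth-from : ∀ q → Expansion O α D (pos (M ℕ.+ M ℕ.* q) · one) →
      ∃ λ K → ∀ j → ‖ γ ^ j ‖ ℕ.* q ℕ.^ j ≤ K ℕ.* (suc q ℕ.* m) ℕ.^ j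
    growth-from q expansion = let d , ds , d∈D , ds∈D , e = leading-digit O α 0∈D expansion in
      growth q (length ds) (expansion-recurrence M q d ds (D≤M d∈D) (All.map D≤M ds∈D)
        (subtract-digit O (pos (M ℕ.+ M ℕ.* q)) d (α ⊗ eval O α ds) e))

-- Alternating forms and the norm

module Multilinear (O : Order) where
  open Trace O

  Linear₁ : ∀ {q} → (Vec (Elem rank) (suc q) → ℤ) → Set
  Linear₁ f = ∀ a x y vs → f (((a · x) ⊕ y) ∷ vs) ≡ a * f (x ∷ vs) + f (y ∷ vs)

  Antisymmetric : ∀ q → (Vec (Elem rank) (suc q) → ℤ) → Set
  Antisymmetric zero    f = ⊤
  Antisymmetric (suc q) f = ∀ u v vs → f (u ∷ v ∷ vs) ≡ - f (v ∷ u ∷ vs)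

  -- Linearity and antisymmetry are stated at the front only; the clause on partial applications
  -- carries them to all later positions.
  Alternating : ∀ q → (Vec (Elem rank) q → ℤ) → Set
  Alternating zero    f = ⊤
  Alternating (suc q) f = Linear₁ f × (∀ v → Alternating q (λ vs → f (v ∷ vs))) × Antisymmetric q f

  Kills : Elem rank → ∀ q → (Vec (Elem rank) q → ℤ) → Set
  Kills b zero    f = ⊤
  Kills b (suc q) f = ∀ vs → f (b ∷ vs) ≡ 0ℤ

  linear-zero : ∀ {q} (f : Vec (Elem rank) (suc q) → ℤ) → Linear₁ f → ∀ vs → f (zeroE ∷ vs) ≡ 0ℤ
  linear-zero f linear vs = begin
    f (zeroE ∷ vs)                                    ≡⟨ cong (λ v → f (v ∷ vs)) (sym (trans (⊕-identityʳ ((- 1ℤ) · zeroE)) (·-zeroʳ (- 1ℤ)))) ⟩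
    f ((((- 1ℤ) · zeroE) ⊕ zeroE) ∷ vs)               ≡⟨ linear (- 1ℤ) zeroE zeroE vs ⟩
    (- 1ℤ) * f (zeroE ∷ vs) + f (zeroE ∷ vs)          ≡⟨ cancel (f (zeroE ∷ vs)) ⟩
    0ℤ                                                ∎
    where
    open ≡-Reasoning
    cancel : ∀ x → (- 1ℤ) * x + x ≡ 0ℤ
    cancel = solve-∀

  linear-· : ∀ {q} (f : Vec (Elem rank) (suc q) → ℤ) → Linear₁ f → ∀ a x vs → f ((a · x) ∷ vs) ≡ a * f (x ∷ vs)
  linear-· f linear a x vs = trans (cong (λ v → f (v ∷ vs)) (sym (⊕-identityʳ (a · x)))) (trans (linear a x zeroE vs)
    (trans (cong (a * f (x ∷ vs) +_) (linear-zero f linear vs)) (ℤₚ.+-identityʳ (a * f (x ∷ vs)))))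

  combination : ∀ {p} → (Fin p → ℤ) → Vec (Elem rank) p → Elem rank
  combination y []       = zeroE
  combination y (b ∷ bs) = (y zero · b) ⊕ combination (y ∘ suc) bs

  lookup-combination : ∀ {p} (y : Fin p → ℤ) B k → lookup (combination y B) k ≡ ∑ p (λ j → y j * lookup (lookup B j) k)
  lookup-combination y []       k = lookup-zeroE k
  lookup-combination y (b ∷ bs) k = trans (lookup-⊕ (y zero · b) (combination (y ∘ suc) bs) k)
    (cong₂ _+_ (lookup-· (y zero) b k) (lookup-combination (y ∘ suc) bs k))

  linear-combination : ∀ {p q} (f : Vec (Elem rank) (suc q) → ℤ) → Linear₁ f → ∀ (y : Fin p → ℤ) B vs →
    f (combination y B ∷ vs) ≡ ∑ p (λ k → y k * f (lookup B k ∷ vs))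
  linear-combination f linear y []       vs = linear-zero f linear vs
  linear-combination f linear y (b ∷ bs) vs = trans (linear (y zero) b (combination (y ∘ suc) bs) vs)
    (cong (y zero * f (b ∷ vs) +_) (linear-combination f linear (y ∘ suc) bs vs))

  combination-split : ∀ {p} (y : Fin (suc p) → ℤ) B k →
    combination y B ≡ (y k · lookup B k) ⊕ combination (y ∘ punchIn k) (removeAt B k)
  combination-split y (b ∷ bs)         zero    = refl
  combination-split y (b ∷ bs@(_ ∷ _)) (suc k) = trans
    (cong ((y zero · b) ⊕_) (combination-split (y ∘ suc) bs k))
    (⊕-swap (y zero · b) (y (suc k) · lookup bs k) (combination (y ∘ suc ∘ punchIn k) (removeAt bs k)))

  kills-repeated : ∀ q f b → Alternating (suc q) f → Kills b q (λ vs → f (b ∷ vs))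
  kills-repeated zero    f b alt             = tt
  kills-repeated (suc q) f b (_ , _ , anti) vs = x≡-x⇒x≡0 (f (b ∷ b ∷ vs)) (anti b b vs)

  kills-next : ∀ q f b w → Alternating (suc q) f → Kills b (suc q) f → Kills b q (λ vs → f (w ∷ vs))
  kills-next zero    f b w alt             kills = tt
  kills-next (suc q) f b w (_ , _ , anti) kills vs = trans (anti w b vs) (cong -_ (kills (w ∷ vs)))

  -- By linearity the first argument splits off a term with `b` in front, which vanishes.
  -- Antisymmetry shows that `b` also kills the form in the remaining arguments.
  drop-killed : ∀ q f b → Alternating q f → Kills b q f → ∀ (r : Fin q → ℤ) (w : Fin q → Elem rank) →
    f (tabulate (λ i → (r i · b) ⊕ w i)) ≡ f (tabulate w)
  drop-killed zero    f b alt kills r w = refl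
  drop-killed (suc q) f b alt@(linear , partial , _) kills r w = begin
    f (((r zero · b) ⊕ w zero) ∷ rest)               ≡⟨ linear (r zero) b (w zero) rest ⟩
    r zero * f (b ∷ rest) + f (w zero ∷ rest)        ≡⟨ cong (λ v → r zero * v + f (w zero ∷ rest)) (kills rest) ⟩
    r zero * 0ℤ + f (w zero ∷ rest)                  ≡⟨ trans (cong (_+ f (w zero ∷ rest)) (ℤₚ.*-zeroʳ (r zero))) (ℤₚ.+-identityˡ (f (w zero ∷ rest))) ⟩
    f (w zero ∷ rest)                                ≡⟨ drop-killed q (λ vs → f (w zero ∷ vs)) b (partial (w zero))
                                                          (kills-next q f b (w zero) alt kills) (r ∘ suc) (w ∘ suc) ⟩
    f (w zero ∷ tabulate (w ∘ suc))                  ∎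
    where
    open ≡-Reasoning
    rest : Vec (Elem rank) q
    rest = tabulate (λ i → (r (suc i) · b) ⊕ w (suc i))

  move-to-front : ∀ q f → Alternating (suc q) f → ∀ B k → f (lookup B k ∷ removeAt B k) ≡ sgn k * f B
  move-to-front q       f alt                  (b ∷ bs)           zero    = sym (ℤₚ.*-identityˡ (f (b ∷ bs)))
  move-to-front (suc q) f (_ , partial , anti) (b ∷ bs@(_ ∷ _)) (suc k) = begin
    f (lookup bs k ∷ b ∷ removeAt bs k)        ≡⟨ anti (lookup bs k) b (removeAt bs k) ⟩
    - f (b ∷ lookup bs k ∷ removeAt bs k)      ≡⟨ cong -_ (move-to-front q (λ vs → f (b ∷ vs)) (partial b) bs k) ⟩
    - (sgn k * f (b ∷ bs))                     ≡⟨ ℤₚ.neg-distribˡ-* (sgn k) (f (b ∷ bs)) ⟩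
    (- sgn k) * f (b ∷ bs)                     ∎
    where open ≡-Reasoning

  alternating-det : ∀ q f → Alternating q f → ∀ (Y : Matrix q q) B →
    f (tabulate (λ r → combination (Y r) B)) ≡ det q Y * f B
  alternating-det zero    f alt Y []  = sym (ℤₚ.*-identityˡ (f []))
  alternating-det (suc q) f alt@(linear , partial , _) Y B = begin
    f (combination (Y zero) B ∷ rest)
      ≡⟨ linear-combination f linear (Y zero) B rest ⟩
    ∑ (suc q) (λ k → Y zero k * f (lookup B k ∷ rest))
      ≡⟨ ∑-cong (suc q) (λ k → trans (cong (Y zero k *_) (row k)) (collect (Y zero k) (minor k) (sgn k) (f B))) ⟩
    ∑ (suc q) (λ k → sgn k * (Y zero k * minor k) * f B)
      ≡⟨ ∑-*ʳ (suc q) (f B) (λ k → sgn k * (Y zero k * minor k)) ⟩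
    det (suc q) Y * f B ∎
    where
    open ≡-Reasoning
    rest : Vec (Elem rank) q
    rest = tabulate (λ r → combination (Y (suc r)) B)
    minor : Fin (suc q) → ℤ
    minor k = det q (λ r c → Y (suc r) (punchIn k c))
    collect : ∀ y d s x → y * (d * (s * x)) ≡ s * (y * d) * x
    collect = solve-∀
    row : ∀ k → f (lookup B k ∷ rest) ≡ minor k * (sgn k * f B)
    row k = begin
      f (lookup B k ∷ rest)
        ≡⟨ cong (λ vs → f (lookup B k ∷ vs)) (tabulate-cong (λ r → combination-split (Y (suc r)) B k)) ⟩
      f (lookup B k ∷ tabulate (λ r → (Y (suc r) k · lookup B k) ⊕ combination (λ c → Y (suc r) (punchIn k c)) (removeAt B k)))
        ≡⟨ drop-killed q (λ vs → f (lookup B k ∷ vs)) (lookup B k) (partial (lookup B k)) (kills-repeated q f (lookup B k) alt)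
             (λ r → Y (suc r) k) (λ r → combination (λ c → Y (suc r) (punchIn k c)) (removeAt B k)) ⟩
      f (lookup B k ∷ tabulate (λ r → combination (λ c → Y (suc r) (punchIn k c)) (removeAt B k)))
        ≡⟨ alternating-det q (λ vs → f (lookup B k ∷ vs)) (partial (lookup B k)) (λ r c → Y (suc r) (punchIn k c)) (removeAt B k) ⟩
      minor k * f (lookup B k ∷ removeAt B k)
        ≡⟨ cong (minor k *_) (move-to-front q f alt B k) ⟩
      minor k * (sgn k * f B) ∎

  alternating-∑ : ∀ q m (a b : Fin m → ℤ) (g : Fin m → Vec (Elem rank) q → ℤ) → (∀ j → Alternating q (g j)) →
    Alternating q (λ vs → ∑ m (λ j → a j * (b j * g j vs)))
  alternating-∑ zero    m a b g alt = tt
  alternating-∑ (suc q) m a b g alt = linear ,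
    (λ v → alternating-∑ q m a b (λ j vs → g j (v ∷ vs)) (λ j → proj₁ (proj₂ (alt j)) v)) ,
    antisymmetric q g (λ j → proj₂ (proj₂ (alt j)))
    where
    distr : ∀ a b s x y → a * (b * (s * x + y)) ≡ s * (a * (b * x)) + a * (b * y)
    distr = solve-∀
    negate : ∀ a b x → a * (b * (- x)) ≡ - (a * (b * x))
    negate = solve-∀
    linear : Linear₁ (λ vs → ∑ m (λ j → a j * (b j * g j vs)))
    linear s x y vs = trans
      (∑-cong m (λ j → trans (cong (λ v → a j * (b j * v)) (proj₁ (alt j) s x y vs)) (distr (a j) (b j) s (g j (x ∷ vs)) (g j (y ∷ vs)))))
      (trans (∑-+ m (λ j → s * (a j * (b j * g j (x ∷ vs)))) (λ j → a j * (b j * g j (y ∷ vs))))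
        (cong (_+ ∑ m (λ j → a j * (b j * g j (y ∷ vs)))) (∑-*ˡ m s (λ j → a j * (b j * g j (x ∷ vs))))))
    antisymmetric : ∀ q (g : Fin m → Vec (Elem rank) (suc q) → ℤ) → (∀ j → Antisymmetric q (g j)) →
      Antisymmetric q (λ vs → ∑ m (λ j → a j * (b j * g j vs)))
    antisymmetric zero    g anti = tt
    antisymmetric (suc q) g anti u v vs = trans
      (∑-cong m (λ j → trans (cong (λ w → a j * (b j * w)) (anti j u v vs)) (negate (a j) (b j) (g j (v ∷ u ∷ vs)))))
      (∑-neg m (λ j → a j * (b j * g j (v ∷ u ∷ vs))))

  -- The choice `C` of columns makes the class closed under cofactor expansion: fixing the first
  -- vector leaves a combination of forms with one column removed.
  minorForm : ∀ k → (Fin k → Fin rank) → Vec (Elem rank) k → ℤ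
  minorForm k C vs = det k (λ r c → lookup (lookup vs r) (C c))

  minorForm-alternating : ∀ k C → Alternating k (minorForm k C)
  minorForm-alternating zero    C = tt
  minorForm-alternating (suc k) C = linear ,
    (λ v → alternating-∑ k (suc k) sgn (λ j → lookup v (C j)) (λ j → minorForm k (C ∘ punchIn j))
      (λ j → minorForm-alternating k (C ∘ punchIn j))) ,
    antisymmetric k C
    where
    distr : ∀ s a x y d → s * ((a * x + y) * d) ≡ a * (s * (x * d)) + s * (y * d)
    distr = solve-∀
    linear : Linear₁ (minorForm (suc k) C)
    linear a x y vs = trans
      (∑-cong (suc k) (λ j → trans
        (cong (λ v → sgn j * (v * minor j)) (trans (lookup-⊕ (a · x) y (C j)) (cong (_+ lookup y (C j)) (lookup-· a x (C j)))))
        (distr (sgn j) a (lookup x (C j)) (lookup y (C j)) (minor j))))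
      (trans (∑-+ (suc k) (λ j → a * (sgn j * (lookup x (C j) * minor j))) (λ j → sgn j * (lookup y (C j) * minor j)))
        (cong (_+ minorForm (suc k) C (y ∷ vs)) (∑-*ˡ (suc k) a (λ j → sgn j * (lookup x (C j) * minor j)))))
      where
      minor : Fin (suc k) → ℤ
      minor j = minorForm k (C ∘ punchIn j) vs
    antisymmetric : ∀ k C → Antisymmetric k (minorForm (suc k) C)
    antisymmetric zero    C = tt
    antisymmetric (suc k) C u v vs = trans
      (det-cong (2 ℕ.+ k) {λ r c → lookup (lookup (u ∷ v ∷ vs) r) (C c)} {λ r c → lookup (lookup (v ∷ u ∷ vs) (swap₀₁ r)) (C c)}
        (λ { zero c → refl ; (suc zero) c → refl ; (suc (suc r)) c → refl }))
      (det-swap-rows k (λ r c → lookup (lookup (v ∷ u ∷ vs) r) (C c)))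

  -- Why N α divides every integer z in αO when ℤ represents all classes modulo α: write the basis vectors as
  -- r · 1 + α v and expand their determinant, which is 1.  The term without an entry 1 is divisible by N α, terms
  -- with two entries 1 vanish, and z times a term with one entry 1 is again a determinant of elements of αO.
  module Cyclic (α : Elem rank) (representative : ∀ w → ∃₂ λ r v → w ≡ (r · one) ⊕ (α ⊗ v)) where

    multiples : Vec (Elem rank) rank
    multiples = tabulate (λ j → α ⊗ basis j)

    lookup-multiples : ∀ j k → lookup (lookup multiples j) k ≡ mulMatrix α k j
    lookup-multiples j k = trans (cong (λ v → lookup v k) (lookup∘tabulate (λ j → α ⊗ basis j) j)) (lookup-⊗-basis α j k)

    multiple-combination : ∀ y → α ⊗ y ≡ combination (lookup y) multiples
    multiple-combination y = lookup-ext λ k → trans (lookup-⊗ α y k) (sym (trans (lookup-combination (lookup y) multiples k)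
      (∑-cong rank (λ j → trans (cong (lookup y j *_) (lookup-multiples j k)) (ℤₚ.*-comm (lookup y j) (mulMatrix α k j))))))

    N≡minorForm : N O α ≡ minorForm rank id multiples
    N≡minorForm = trans (det-transpose rank (mulMatrix α))
      (det-cong rank {λ j k → mulMatrix α k j} {λ j k → lookup (lookup multiples j) k} (λ j k → sym (lookup-multiples j k)))

    N∣multiples : ∀ (y : Fin rank → Elem rank) → N O α Signed.∣ minorForm rank id (tabulate (λ i → α ⊗ y i))
    N∣multiples y = Signed.divides (det rank (λ i → lookup (y i))) (begin
      minorForm rank id (tabulate (λ i → α ⊗ y i))
        ≡⟨ cong (minorForm rank id) (tabulate-cong (λ i → multiple-combination (y i))) ⟩
      minorForm rank id (tabulate (λ i → combination (lookup (y i)) multiples))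
        ≡⟨ alternating-det rank (minorForm rank id) (minorForm-alternating rank id) (λ i → lookup (y i)) multiples ⟩
      det rank (λ i → lookup (y i)) * minorForm rank id multiples
        ≡⟨ cong (det rank (λ i → lookup (y i)) *_) (sym N≡minorForm) ⟩
      det rank (λ i → lookup (y i)) * N O α ∎)
      where open ≡-Reasoning

    module _ (m z : ℤ) (y₀ : Elem rank) (αy₀≡z : α ⊗ y₀ ≡ z · one) where

      -- Stated for every alternating form so that the arguments already replaced by multiples of α
      -- can be absorbed into the form. In the term with 1 in front, all other multiples of 1 drop
      -- out and z · 1 = α y₀ turns the front into a multiple of α.
      divides-all : ∀ q f → Alternating q f → (∀ (y : Fin q → Elem rank) → m Signed.∣ f (tabulate (λ i → α ⊗ y i))) →
        ∀ (w : Fin q → Elem rank) → m Signed.∣ z * f (tabulate w)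
      divides-all zero    f alt h w = Signed.∣n⇒∣m*n z (h (λ ()))
      divides-all (suc q) f alt@(linear , partial , _) h w = subst (m Signed.∣_) (sym split)
        (Signed.∣m∣n⇒∣m+n (Signed.∣n⇒∣m*n r (subst (m Signed.∣_) (sym one-first) (h with-y₀)))
          (divides-all q (λ vs → f ((α ⊗ v) ∷ vs)) (partial (α ⊗ v)) (λ y → h (cons v y)) (w ∘ suc)))
        where
        open ≡-Reasoning
        r : ℤ
        r = proj₁ (representative (w zero))
        v : Elem rank
        v = proj₁ (proj₂ (representative (w zero)))
        ρ : Fin q → ℤ
        ρ i = proj₁ (representative (w (suc i)))
        ν : Fin q → Elem rank
        ν i = proj₁ (proj₂ (representative (w (suc i))))
        cons : Elem rank → (Fin q → Elem rank) → Fin (suc q) → Elem rank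
        cons x y zero    = x
        cons x y (suc i) = y i
        with-y₀ : Fin (suc q) → Elem rank
        with-y₀ = cons y₀ ν
        ws vs : Vec (Elem rank) q
        ws = tabulate (w ∘ suc)
        vs = tabulate (λ i → α ⊗ ν i)
        distr : ∀ z r a b → z * (r * a + b) ≡ r * (z * a) + z * b
        distr = solve-∀
        split : z * f (w zero ∷ ws) ≡ r * (z * f (one ∷ ws)) + z * f ((α ⊗ v) ∷ ws)
        split = trans (cong (z *_) (trans (cong (λ x → f (x ∷ ws)) (proj₂ (proj₂ (representative (w zero))))) (linear r one (α ⊗ v) ws)))
          (distr z r (f (one ∷ ws)) (f ((α ⊗ v) ∷ ws)))
        one-first : z * f (one ∷ ws) ≡ f ((α ⊗ y₀) ∷ vs)
        one-first = begin
          z * f (one ∷ ws)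
            ≡⟨ cong (λ xs → z * f (one ∷ xs)) (tabulate-cong (λ i → proj₂ (proj₂ (representative (w (suc i)))))) ⟩
          z * f (one ∷ tabulate (λ i → (ρ i · one) ⊕ (α ⊗ ν i)))
            ≡⟨ cong (z *_) (drop-killed q (λ xs → f (one ∷ xs)) one (partial one) (kills-repeated q f one alt) ρ (λ i → α ⊗ ν i)) ⟩
          z * f (one ∷ vs)
            ≡⟨ sym (linear-· f linear z one vs) ⟩
          f ((z · one) ∷ vs)
            ≡⟨ cong (λ x → f (x ∷ vs)) (sym αy₀≡z) ⟩
          f ((α ⊗ y₀) ∷ vs) ∎

    N∣integer-multiple : ∀ z y → α ⊗ y ≡ z · one → N O α Signed.∣ z
    N∣integer-multiple z y e = subst (N O α Signed.∣_) (trans (cong (z *_) unit) (ℤₚ.*-identityʳ z))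
      (divides-all (N O α) z y e rank (minorForm rank id) (minorForm-alternating rank id) N∣multiples basis)
      where
      unit : minorForm rank id (tabulate basis) ≡ 1ℤ
      unit = trans (det-cong rank {λ r c → lookup (lookup (tabulate basis) r) c} {δ} (λ r c →
        trans (cong (λ v → lookup v c) (lookup∘tabulate basis r)) (lookup∘tabulate (δ r) c))) (det-δ rank)

-- Boxes and tensors

integers : ℕ → List ℤ
integers R = List.map pos (upTo (suc R)) ++ List.map -[1+_] (upTo R)

∈-integers : ∀ R z → ∣ z ∣ ≤ R → z ∈ integers R
∈-integers R (pos n)    n≤R = ∈-++⁺ˡ (∈-map⁺ pos (∈-upTo⁺ (s≤s n≤R)))
∈-integers R -[1+ n ] n<R = ∈-++⁺ʳ (List.map pos (upTo (suc R))) (∈-map⁺ -[1+_] (∈-upTo⁺ n<R))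

box : ∀ n → ℕ → List (Elem n)
box zero    R = [] ∷ []
box (suc n) R = cartesianProductWith _∷_ (integers R) (box n R)

∈-box : ∀ {n} R (x : Elem n) → ‖ x ‖ ≤ R → x ∈ box n R
∈-box R []       h = here refl
∈-box R (x ∷ xs) h = ∈-cartesianProductWith⁺ _∷_
  (∈-integers R x (ℕₚ.≤-trans (ℕₚ.m≤m⊔n ∣ x ∣ ‖ xs ‖) h)) (∈-box R xs (ℕₚ.≤-trans (ℕₚ.m≤n⊔m ∣ x ∣ ‖ xs ‖) h))

-- The explicit bound on b is kept because it serves as the horizon of the search in `reaches?`.
bounded⇒repetition : ∀ {n} (s : ℕ → Elem n) R → (∀ k → ‖ s k ‖ ≤ R) →
  ∃₂ λ a b → a ℕ.< b × b ≤ length (box n R) × s a ≡ s b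
bounded⇒repetition {n} s R h with Finₚ.pigeonhole (ℕₚ.n<1+n (length (box n R))) index
  where
  index : Fin (suc (length (box n R))) → Fin (length (box n R))
  index k = Any.index (∈-box R (s (toℕ k)) (h (toℕ k)))
... | a , b , a<b , e = toℕ a , toℕ b , a<b , ℕₚ.≤-pred (Finₚ.toℕ<n b) ,
      trans (lookup-index (∈-box R (s (toℕ a)) (h (toℕ a))))
        (trans (cong (List.lookup (box n R)) e) (sym (lookup-index (∈-box R (s (toℕ b)) (h (toℕ b))))))

∑-split : ∀ a b (f : Fin (a ℕ.+ b) → ℤ) → ∑ (a ℕ.+ b) f ≡ ∑ a (λ i → f (i ↑ˡ b)) + ∑ b (λ j → f (a ↑ʳ j))
∑-split zero    b f = sym (ℤₚ.+-identityˡ (∑ b f))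
∑-split (suc a) b f = trans (cong (f zero +_) (∑-split a b (f ∘ suc)))
  (sym (ℤₚ.+-assoc (f zero) (∑ a (λ i → f (suc (i ↑ˡ b)))) (∑ b (λ j → f (suc (a ↑ʳ j))))))

∑-combine : ∀ n m (f : Fin (n ℕ.* m) → ℤ) → ∑ (n ℕ.* m) f ≡ ∑ n (λ i → ∑ m (λ j → f (combine i j)))
∑-combine zero    m f = refl
∑-combine (suc n) m f = trans (∑-split m (n ℕ.* m) f)
  (cong (∑ m (λ j → f (j ↑ˡ (n ℕ.* m))) +_) (∑-combine n m (λ k → f (m ↑ʳ k))))

total : ∀ n → (Fin n → ℕ) → ℕ
total zero    f = 0
total (suc n) f = f zero ℕ.+ total n (f ∘ suc)

total-linear : ∀ n a (f h : Fin n → ℕ) → total n (λ i → a ℕ.* f i ℕ.+ h i) ≡ a ℕ.* total n f ℕ.+ total n h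
total-linear zero    a f h = sym (trans (ℕₚ.+-identityʳ (a ℕ.* 0)) (ℕₚ.*-zeroʳ a))
total-linear (suc n) a f h = trans (cong (a ℕ.* f zero ℕ.+ h zero ℕ.+_) (total-linear n a (f ∘ suc) (h ∘ suc)))
  (regroup a (f zero) (h zero) (total n (f ∘ suc)) (total n (h ∘ suc)))
  where
  regroup : ∀ a f h F H → a ℕ.* f ℕ.+ h ℕ.+ (a ℕ.* F ℕ.+ H) ≡ a ℕ.* (f ℕ.+ F) ℕ.+ (h ℕ.+ H)
  regroup = ℕ-Ring.solve-∀

total-bound : ∀ n (f : Fin n → ℕ) r → (∀ i → f i ≤ r) → total n f ≤ n ℕ.* r
total-bound zero    f r h = z≤n
total-bound (suc n) f r h = ℕₚ.+-mono-≤ (h zero) (total-bound n (f ∘ suc) r (h ∘ suc))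

≤total : ∀ n (f : Fin n → ℕ) i → f i ≤ total n f
≤total (suc n) f zero    = ℕₚ.m≤m+n (f zero) _
≤total (suc n) f (suc i) = ℕₚ.≤-trans (≤total n (f ∘ suc) i) (ℕₚ.m≤n+m _ (f zero))

i*i≡∣i∣*∣i∣ : ∀ i → i * i ≡ pos (∣ i ∣ ℕ.* ∣ i ∣)
i*i≡∣i∣*∣i∣ (pos n)  = sym (ℤₚ.pos-* n n)
i*i≡∣i∣*∣i∣ -[1+ n ] = refl

-- The product A X Aᵀ. For A the multiplication matrix of α this is the action of α ⊗ α on an
-- element of O ⊗ O written as the matrix of its coordinates.
conjugate : ∀ {n} → Matrix n n → Matrix n n → Matrix n n
conjugate {n} A X i j = ∑ n (λ k → ∑ n (λ l → A i k * A j l * X k l))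

FixedTensor : ∀ {n} → Matrix n n → Set
FixedTensor {n} A = Σ (Matrix n n) λ W → (∃₂ λ k l → W k l ≢ 0ℤ) × (∀ i j → conjugate A W i j ≡ W i j)

TensorCoercive : ∀ {n} → Matrix n n → Set
TensorCoercive {n} A = Σ ℕ λ b → ∀ (X : Matrix n n) r → (∀ i j → ∣ conjugate A X i j - X i j ∣ ≤ r) → ∀ i j → ∣ X i j ∣ ≤ b ℕ.* r

-- Elimination applied to A ⊗ A - 1, with pairs of indices encoded as one index by `combine`.
fixed-or-coercive : ∀ {n} (A : Matrix n n) → FixedTensor A ⊎ TensorCoercive A
fixed-or-coercive {n} A = from (kernel-or-coercive (n ℕ.* n) T)
  where
  T : Matrix (n ℕ.* n) (n ℕ.* n)
  T I J = let (i , j) = remQuot n I ; (k , l) = remQuot n J in A i k * A j l - δ i k * δ j l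
  distr : ∀ a b d e x → (a * b - d * e) * x ≡ a * b * x + (- 1ℤ) * (d * (e * x))
  distr = solve-∀
  apply : ∀ (X : Matrix n n) x → (∀ k l → x (combine k l) ≡ X k l) → ∀ I → let (i , j) = remQuot n I in
    ∑ (n ℕ.* n) (λ J → T I J * x J) ≡ conjugate A X i j - X i j
  apply X x x≡X I = begin
    ∑ (n ℕ.* n) (λ J → T I J * x J)
      ≡⟨ ∑-combine n n (λ J → T I J * x J) ⟩
    ∑ n (λ k → ∑ n (λ l → T I (combine k l) * x (combine k l)))
      ≡⟨ ∑-cong n (λ k → ∑-cong n (λ l → trans
           (cong₂ (λ (kl : Fin n × Fin n) v → (A i (proj₁ kl) * A j (proj₂ kl) - δ i (proj₁ kl) * δ j (proj₂ kl)) * v)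
             (Finₚ.remQuot-combine k l) (x≡X k l))
           (distr (A i k) (A j l) (δ i k) (δ j l) (X k l)))) ⟩
    ∑ n (λ k → ∑ n (λ l → A i k * A j l * X k l + (- 1ℤ) * (δ i k * (δ j l * X k l))))
      ≡⟨ ∑-cong n (λ k → trans (∑-+ n (λ l → A i k * A j l * X k l) (λ l → (- 1ℤ) * (δ i k * (δ j l * X k l))))
           (cong (∑ n (λ l → A i k * A j l * X k l) +_) (trans (∑-*ˡ n (- 1ℤ) (λ l → δ i k * (δ j l * X k l)))
             (cong ((- 1ℤ) *_) (trans (∑-*ˡ n (δ i k) (λ l → δ j l * X k l)) (cong (δ i k *_) (∑-δˡ n (X k) j))))))) ⟩
    ∑ n (λ k → ∑ n (λ l → A i k * A j l * X k l) + (- 1ℤ) * (δ i k * X k j))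
      ≡⟨ ∑-+ n (λ k → ∑ n (λ l → A i k * A j l * X k l)) (λ k → (- 1ℤ) * (δ i k * X k j)) ⟩
    conjugate A X i j + ∑ n (λ k → (- 1ℤ) * (δ i k * X k j))
      ≡⟨ cong (conjugate A X i j +_) (trans (∑-*ˡ n (- 1ℤ) (λ k → δ i k * X k j))
           (trans (cong ((- 1ℤ) *_) (∑-δˡ n (λ k → X k j) i)) (ℤₚ.-1*i≡-i (X i j)))) ⟩
    conjugate A X i j - X i j ∎
    where
    open ≡-Reasoning
    i j : Fin n
    i = proj₁ (remQuot n I)
    j = proj₂ (remQuot {n} n I)
  from : Kernel T ⊎ Coercive T → FixedTensor A ⊎ TensorCoercive A
  from (inj₁ (w , (J , wJ≢0) , Tw≡0)) = inj₁ (W , (proj₁ kl , proj₂ kl , λ e → wJ≢0 (trans (sym (cong w (Finₚ.combine-remQuot {n} n J))) e)) , fixed)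
    where
    kl : Fin n × Fin n
    kl = remQuot n J
    W : Matrix n n
    W k l = w (combine k l)
    fixed : ∀ i j → conjugate A W i j ≡ W i j
    fixed i j = ℤₚ.i-j≡0⇒i≡j (conjugate A W i j) (W i j)
      (trans (cong (λ (ij : Fin n × Fin n) → conjugate A W (proj₁ ij) (proj₂ ij) - W (proj₁ ij) (proj₂ ij)) (sym (Finₚ.remQuot-combine i j)))
        (trans (sym (apply W w (λ k l → refl) (combine i j))) (Tw≡0 (combine i j))))
  from (inj₂ (b , coercive)) = inj₂ (b , λ X r h i j →
    let x = λ J → X (proj₁ (remQuot {n} n J)) (proj₂ (remQuot {n} n J))
        x≡X : ∀ k l → x (combine k l) ≡ X k l
        x≡X k l = cong (λ (kl : Fin n × Fin n) → X (proj₁ kl) (proj₂ kl)) (Finₚ.remQuot-combine k l)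
    in subst (λ v → ∣ v ∣ ≤ b ℕ.* r) (x≡X i j)
      (coercive x r (λ I → subst (λ v → ∣ v ∣ ≤ r) (sym (apply X x x≡X I)) (h (proj₁ (remQuot {n} n I)) (proj₂ (remQuot {n} n I)))) (combine i j)))

-- Contraction by 1/α

module Contraction (O : Order) (α γ : Elem (Order.rank O)) (m : ℕ) .{{_ : NonZero m}}
  (αγ≡m : Order._⊗_ O α γ ≡ Order._·_ O (pos m) (Order.one O)) where
  open Trace O
  open Inverse O α γ m αγ≡m

  private
    n : ℕ
    n = rank
    A : Matrix n n
    A = mulMatrix α

  PowersBounded : ℕ → Set
  PowersBounded C = ∀ k → ‖ γ ^ k ‖ ≤ C ℕ.* m ℕ.^ k

  -- Because ‖γ^k x‖ ≤ κ ‖γ^k‖ ‖x‖, this says that multiplication by α^(-k) at least halves the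
  -- norm.
  Contracting : ℕ → Set
  Contracting k = 2 ℕ.* (κ ℕ.* ‖ γ ^ k ‖) ≤ m ℕ.^ k

  -- m²ᴷ times the sum of the squares β¹ ⊗ β¹, …, βᴷ ⊗ βᴷ in O ⊗ O, where β = γ/m = 1/α.
  squares : ℕ → Matrix n n
  squares zero    i j = 0ℤ
  squares (suc K) i j = pos (m ℕ.* m) * squares K i j + lookup (γ ^ suc K) i * lookup (γ ^ suc K) j

  conjugate-linear : ∀ a X u i j → conjugate A (λ k l → a * X k l + lookup u k * lookup u l) i j
    ≡ a * conjugate A X i j + lookup (α ⊗ u) i * lookup (α ⊗ u) j
  conjugate-linear a X u i j = begin
    ∑ n (λ k → ∑ n (λ l → A i k * A j l * (a * X k l + lookup u k * lookup u l)))
      ≡⟨ ∑-cong n (λ k → trans (∑-cong n (λ l → distr (A i k) (A j l) a (X k l) (lookup u k) (lookup u l)))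
           (∑-+ n (λ l → a * (A i k * A j l * X k l)) (λ l → A i k * lookup u k * (A j l * lookup u l)))) ⟩
    ∑ n (λ k → ∑ n (λ l → a * (A i k * A j l * X k l)) + ∑ n (λ l → A i k * lookup u k * (A j l * lookup u l)))
      ≡⟨ ∑-cong n (λ k → cong₂ _+_ (∑-*ˡ n a (λ l → A i k * A j l * X k l))
           (trans (∑-*ˡ n (A i k * lookup u k) (λ l → A j l * lookup u l)) (cong (A i k * lookup u k *_) (sym (lookup-⊗ α u j))))) ⟩
    ∑ n (λ k → a * ∑ n (λ l → A i k * A j l * X k l) + A i k * lookup u k * lookup (α ⊗ u) j)
      ≡⟨ ∑-+ n (λ k → a * ∑ n (λ l → A i k * A j l * X k l)) (λ k → A i k * lookup u k * lookup (α ⊗ u) j) ⟩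
    ∑ n (λ k → a * ∑ n (λ l → A i k * A j l * X k l)) + ∑ n (λ k → A i k * lookup u k * lookup (α ⊗ u) j)
      ≡⟨ cong₂ _+_ (∑-*ˡ n a (λ k → ∑ n (λ l → A i k * A j l * X k l)))
           (trans (∑-*ʳ n (lookup (α ⊗ u) j) (λ k → A i k * lookup u k)) (cong (_* lookup (α ⊗ u) j) (sym (lookup-⊗ α u i)))) ⟩
    a * conjugate A X i j + lookup (α ⊗ u) i * lookup (α ⊗ u) j ∎
    where
    open ≡-Reasoning
    distr : ∀ p q a x u v → p * q * (a * x + u * v) ≡ a * (p * q * x) + p * u * (q * v)
    distr = solve-∀

  -- With β = 1/α, the map α ⊗ α sends β^k ⊗ β^k to β^(k-1) ⊗ β^(k-1). Hence α ⊗ α - 1 telescopes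
  -- the sum to 1 ⊗ 1 - β^K ⊗ β^K, here multiplied by m^(2K).
  conjugate-squares : ∀ K i j → conjugate A (squares K) i j - squares K i j
    ≡ pos ((m ℕ.* m) ℕ.^ K) * (lookup one i * lookup one j) - lookup (γ ^ K) i * lookup (γ ^ K) j
  conjugate-squares zero i j = begin
    conjugate A (squares 0) i j - 0ℤ
      ≡⟨ cong (_- 0ℤ) (∑-zero n (λ k → ∑-zero n (λ l → ℤₚ.*-zeroʳ (A i k * A j l)))) ⟩
    0ℤ
      ≡⟨ cancel (lookup one i * lookup one j) ⟩
    1ℤ * (lookup one i * lookup one j) - lookup one i * lookup one j ∎
    where
    open ≡-Reasoning
    cancel : ∀ x → 0ℤ ≡ 1ℤ * x - x
    cancel = solve-∀
  conjugate-squares (suc K) i j = begin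
    conjugate A (squares (suc K)) i j - squares (suc K) i j
      ≡⟨ cong (_- squares (suc K) i j) (trans (conjugate-linear M (squares K) (γ ^ suc K) i j)
           (cong (M * conjugate A (squares K) i j +_) (cong₂ _*_ (shift i) (shift j)))) ⟩
    M * conjugate A (squares K) i j + (pos m * g i) * (pos m * g j) - (M * squares K i j + h i * h j)
      ≡⟨ cong (λ v → M * conjugate A (squares K) i j + (pos m * g i) * (pos m * g j) - (v * squares K i j + h i * h j)) (ℤₚ.pos-* m m) ⟩
    M * conjugate A (squares K) i j + (pos m * g i) * (pos m * g j) - (pos m * pos m * squares K i j + h i * h j)
      ≡⟨ cong (λ v → v * conjugate A (squares K) i j + (pos m * g i) * (pos m * g j) - (pos m * pos m * squares K i j + h i * h j)) (ℤₚ.pos-* m m) ⟩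
    pos m * pos m * conjugate A (squares K) i j + (pos m * g i) * (pos m * g j) - (pos m * pos m * squares K i j + h i * h j)
      ≡⟨ regroup (pos m) (conjugate A (squares K) i j) (squares K i j) (g i) (g j) (h i * h j) ⟩
    pos m * pos m * (conjugate A (squares K) i j - squares K i j + g i * g j) - h i * h j
      ≡⟨ cong (λ v → pos m * pos m * (v + g i * g j) - h i * h j) (conjugate-squares K i j) ⟩
    pos m * pos m * (P * o - g i * g j + g i * g j) - h i * h j
      ≡⟨ finish (pos m) P o (g i * g j) (h i * h j) ⟩
    pos m * pos m * P * o - h i * h j
      ≡⟨ cong (λ v → v * o - h i * h j) (sym (trans (ℤₚ.pos-* (m ℕ.* m) ((m ℕ.* m) ℕ.^ K)) (cong (_* P) (ℤₚ.pos-* m m)))) ⟩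
    pos ((m ℕ.* m) ℕ.^ suc K) * o - h i * h j ∎
    where
    open ≡-Reasoning
    M P o : ℤ
    M = pos (m ℕ.* m)
    P = pos ((m ℕ.* m) ℕ.^ K)
    o = lookup one i * lookup one j
    g h : Fin n → ℤ
    g i = lookup (γ ^ K) i
    h i = lookup (γ ^ suc K) i
    shift : ∀ i → lookup (α ⊗ (γ ^ suc K)) i ≡ pos m * g i
    shift i = trans (cong (λ v → lookup v i) (α-cancel (γ ^ K))) (lookup-· (pos m) (γ ^ K) i)
    regroup : ∀ m c s x y h → m * m * c + (m * x) * (m * y) - (m * m * s + h) ≡ m * m * (c - s + x * y) - h
    regroup = solve-∀
    finish : ∀ m p o x h → m * m * (p * o - x + x) - h ≡ m * m * p * o - h
    finish = solve-∀

  -- Diagonal coordinates of the summed tensors are sums of squares and cannot cancel. This is the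
  -- reason for summing β^k ⊗ β^k and not β^k.
  diagonal : ℕ → Fin n → ℕ
  diagonal zero    i = 0
  diagonal (suc K) i = m ℕ.* m ℕ.* diagonal K i ℕ.+ ∣ lookup (γ ^ suc K) i ∣ ℕ.* ∣ lookup (γ ^ suc K) i ∣

  squares-diagonal : ∀ K i → squares K i i ≡ pos (diagonal K i)
  squares-diagonal zero    i = refl
  squares-diagonal (suc K) i = trans
    (cong₂ _+_ (trans (cong (pos (m ℕ.* m) *_) (squares-diagonal K i)) (sym (ℤₚ.pos-* (m ℕ.* m) (diagonal K i))))
      (i*i≡∣i∣*∣i∣ (lookup (γ ^ suc K) i)))
    (sym (ℤₚ.pos-+ (m ℕ.* m ℕ.* diagonal K i) (∣ lookup (γ ^ suc K) i ∣ ℕ.* ∣ lookup (γ ^ suc K) i ∣)))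

  diagonal-upper : ∀ C (coercive : TensorCoercive A) → PowersBounded C → ∀ K i →
    diagonal K i ≤ proj₁ coercive ℕ.* ((‖ one ‖ ℕ.* ‖ one ‖ ℕ.+ C ℕ.* C) ℕ.* (m ℕ.* m) ℕ.^ K)
  diagonal-upper C (b , coercive) bounded K i = subst (λ v → ∣ v ∣ ≤ b ℕ.* (C′ ℕ.* q)) (squares-diagonal K i)
    (coercive (squares K) (C′ ℕ.* q) (λ i j → begin
      ∣ conjugate A (squares K) i j - squares K i j ∣
        ≡⟨ cong ∣_∣ (conjugate-squares K i j) ⟩
      ∣ pos q * (lookup one i * lookup one j) - lookup (γ ^ K) i * lookup (γ ^ K) j ∣
        ≤⟨ ℤₚ.∣i-j∣≤∣i∣+∣j∣ (pos q * (lookup one i * lookup one j)) (lookup (γ ^ K) i * lookup (γ ^ K) j) ⟩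
      ∣ pos q * (lookup one i * lookup one j) ∣ ℕ.+ ∣ lookup (γ ^ K) i * lookup (γ ^ K) j ∣
        ≡⟨ cong₂ ℕ._+_ (trans (ℤₚ.abs-* (pos q) (lookup one i * lookup one j)) (cong (q ℕ.*_) (ℤₚ.abs-* (lookup one i) (lookup one j))))
             (ℤₚ.abs-* (lookup (γ ^ K) i) (lookup (γ ^ K) j)) ⟩
      q ℕ.* (∣ lookup one i ∣ ℕ.* ∣ lookup one j ∣) ℕ.+ ∣ lookup (γ ^ K) i ∣ ℕ.* ∣ lookup (γ ^ K) j ∣
        ≤⟨ ℕₚ.+-mono-≤ (ℕₚ.*-monoʳ-≤ q (ℕₚ.*-mono-≤ (∣lookup∣≤‖‖ one i) (∣lookup∣≤‖‖ one j)))
             (ℕₚ.*-mono-≤ (ℕₚ.≤-trans (∣lookup∣≤‖‖ (γ ^ K) i) (bounded K)) (ℕₚ.≤-trans (∣lookup∣≤‖‖ (γ ^ K) j) (bounded K))) ⟩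
      q ℕ.* (‖ one ‖ ℕ.* ‖ one ‖) ℕ.+ C ℕ.* m ℕ.^ K ℕ.* (C ℕ.* m ℕ.^ K)
        ≡⟨ cong (λ v → v ℕ.* (‖ one ‖ ℕ.* ‖ one ‖) ℕ.+ C ℕ.* m ℕ.^ K ℕ.* (C ℕ.* m ℕ.^ K)) (^-distribʳ-* K m m) ⟩
      m ℕ.^ K ℕ.* m ℕ.^ K ℕ.* (‖ one ‖ ℕ.* ‖ one ‖) ℕ.+ C ℕ.* m ℕ.^ K ℕ.* (C ℕ.* m ℕ.^ K)
        ≡⟨ collect (m ℕ.^ K) (‖ one ‖ ℕ.* ‖ one ‖) C ⟩
      (‖ one ‖ ℕ.* ‖ one ‖ ℕ.+ C ℕ.* C) ℕ.* (m ℕ.^ K ℕ.* m ℕ.^ K)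
        ≡⟨ cong ((‖ one ‖ ℕ.* ‖ one ‖ ℕ.+ C ℕ.* C) ℕ.*_) (sym (^-distribʳ-* K m m)) ⟩
      (‖ one ‖ ℕ.* ‖ one ‖ ℕ.+ C ℕ.* C) ℕ.* q ∎) i i)
    where
    open ℕₚ.≤-Reasoning
    q C′ : ℕ
    q = (m ℕ.* m) ℕ.^ K
    C′ = ‖ one ‖ ℕ.* ‖ one ‖ ℕ.+ C ℕ.* C
    collect : ∀ x o c → x ℕ.* x ℕ.* o ℕ.+ c ℕ.* x ℕ.* (c ℕ.* x) ≡ (o ℕ.+ c ℕ.* c) ℕ.* (x ℕ.* x)
    collect = ℕ-Ring.solve-∀

  ‖‖²≤total : ∀ (x : Elem n) → ‖ x ‖ ℕ.* ‖ x ‖ ≤ total n (λ i → ∣ lookup x i ∣ ℕ.* ∣ lookup x i ∣)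
  ‖‖²≤total x with ‖‖-attained x
  ... | inj₁ e       = subst (λ v → v ℕ.* v ≤ total n (λ i → ∣ lookup x i ∣ ℕ.* ∣ lookup x i ∣)) (sym e) z≤n
  ... | inj₂ (i , e) = subst (λ v → v ℕ.* v ≤ total n (λ i → ∣ lookup x i ∣ ℕ.* ∣ lookup x i ∣)) (sym e)
                         (≤total n (λ i → ∣ lookup x i ∣ ℕ.* ∣ lookup x i ∣) i)

  -- A power of 1/α that fails to contract has norm at least 1/(2κ), so its squared coordinates add
  -- at least 1/(2κ)² to the trace of the sum.
  diagonal-lower : ∀ K → (∀ k → k ℕ.< K → m ℕ.^ suc k ≤ 2 ℕ.* (κ ℕ.* ‖ γ ^ suc k ‖)) →
    K ℕ.* (m ℕ.* m) ℕ.^ K ≤ 2 ℕ.* κ ℕ.* (2 ℕ.* κ) ℕ.* total n (diagonal K)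
  diagonal-lower zero    h = z≤n
  diagonal-lower (suc K) h = begin
    suc K ℕ.* (m ℕ.* m ℕ.* q)
      ≡⟨ peel K (m ℕ.* m) q ⟩
    m ℕ.* m ℕ.* (K ℕ.* q) ℕ.+ m ℕ.* m ℕ.* q
      ≤⟨ ℕₚ.+-mono-≤ (ℕₚ.*-monoʳ-≤ (m ℕ.* m) (diagonal-lower K (λ k k<K → h k (ℕₚ.m≤n⇒m≤1+n k<K)))) new ⟩
    m ℕ.* m ℕ.* (c ℕ.* total n (diagonal K)) ℕ.+ c ℕ.* total n s
      ≡⟨ collect (m ℕ.* m) c (total n (diagonal K)) (total n s) ⟩
    c ℕ.* (m ℕ.* m ℕ.* total n (diagonal K) ℕ.+ total n s)
      ≡⟨ cong (c ℕ.*_) (sym (total-linear n (m ℕ.* m) (diagonal K) s)) ⟩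
    c ℕ.* total n (diagonal (suc K)) ∎
    where
    open ℕₚ.≤-Reasoning
    q c u : ℕ
    q = (m ℕ.* m) ℕ.^ K
    c = 2 ℕ.* κ ℕ.* (2 ℕ.* κ)
    u = ‖ γ ^ suc K ‖
    s : Fin n → ℕ
    s i = ∣ lookup (γ ^ suc K) i ∣ ℕ.* ∣ lookup (γ ^ suc K) i ∣
    peel : ∀ K m q → (1 ℕ.+ K) ℕ.* (m ℕ.* q) ≡ m ℕ.* (K ℕ.* q) ℕ.+ m ℕ.* q
    peel = ℕ-Ring.solve-∀
    collect : ∀ m c t s → m ℕ.* (c ℕ.* t) ℕ.+ c ℕ.* s ≡ c ℕ.* (m ℕ.* t ℕ.+ s)
    collect = ℕ-Ring.solve-∀
    square : ∀ k u → 2 ℕ.* (k ℕ.* u) ℕ.* (2 ℕ.* (k ℕ.* u)) ≡ 2 ℕ.* k ℕ.* (2 ℕ.* k) ℕ.* (u ℕ.* u)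
    square = ℕ-Ring.solve-∀
    new : m ℕ.* m ℕ.* q ≤ c ℕ.* total n s
    new = begin
      (m ℕ.* m) ℕ.^ suc K                              ≡⟨ ^-distribʳ-* (suc K) m m ⟩
      m ℕ.^ suc K ℕ.* m ℕ.^ suc K                      ≤⟨ ℕₚ.*-mono-≤ (h K ℕₚ.≤-refl) (h K ℕₚ.≤-refl) ⟩
      2 ℕ.* (κ ℕ.* u) ℕ.* (2 ℕ.* (κ ℕ.* u))            ≡⟨ square κ u ⟩
      c ℕ.* (u ℕ.* u)                                  ≤⟨ ℕₚ.*-monoʳ-≤ c (‖‖²≤total (γ ^ suc K)) ⟩
      c ℕ.* total n s                                  ∎

  -- Without a contraction among the first K powers the trace of the sum, after division by m^(2K),
  -- grows linearly in K, while coercivity bounds it independently of K; `K₀` is where the two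
  -- collide. K is produced before `PowersBounded` is assumed, so the search range is available even
  -- if finiteness fails.
  contraction : ∀ C → TensorCoercive A → ∃ λ K → PowersBounded C → ∃ λ (k : Fin K) → Contracting (suc (toℕ k))
  contraction C coercive = suc K₀ , search
    where
    b r K₀ : ℕ
    b = proj₁ coercive
    r = ‖ one ‖ ℕ.* ‖ one ‖ ℕ.+ C ℕ.* C
    K₀ = 2 ℕ.* κ ℕ.* (2 ℕ.* κ) ℕ.* (n ℕ.* (b ℕ.* r))
    search : PowersBounded C → ∃ λ (k : Fin (suc K₀)) → Contracting (suc (toℕ k))
    search bounded with Finₚ.any? (λ (k : Fin (suc K₀)) → 2 ℕ.* (κ ℕ.* ‖ γ ^ suc (toℕ k) ‖) ℕₚ.≤? m ℕ.^ suc (toℕ k))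
    ... | yes found = found
    ... | no  none  = ⊥-elim (ℕₚ.<-irrefl refl (ℕₚ.*-cancelʳ-≤ (suc K₀) K₀ q {{ℕₚ.m^n≢0 (m ℕ.* m) (suc K₀) {{ℕₚ.m*n≢0 m m}}}} (begin
        suc K₀ ℕ.* q
          ≤⟨ diagonal-lower (suc K₀) (λ k k<K → ℕₚ.<⇒≤ (ℕₚ.≰⇒> (λ small → none (fromℕ< k<K ,
               subst (λ v → 2 ℕ.* (κ ℕ.* ‖ γ ^ suc v ‖) ≤ m ℕ.^ suc v) (sym (Finₚ.toℕ-fromℕ< k<K)) small)))) ⟩
        2 ℕ.* κ ℕ.* (2 ℕ.* κ) ℕ.* total n (diagonal (suc K₀))
          ≤⟨ ℕₚ.*-monoʳ-≤ (2 ℕ.* κ ℕ.* (2 ℕ.* κ)) (total-bound n (diagonal (suc K₀)) (b ℕ.* (r ℕ.* q)) (diagonal-upper C coercive bounded (suc K₀))) ⟩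
        2 ℕ.* κ ℕ.* (2 ℕ.* κ) ℕ.* (n ℕ.* (b ℕ.* (r ℕ.* q)))
          ≡⟨ reassociate (2 ℕ.* κ ℕ.* (2 ℕ.* κ)) n b r q ⟩
        K₀ ℕ.* q ∎)))
      where
      open ℕₚ.≤-Reasoning
      q : ℕ
      q = (m ℕ.* m) ℕ.^ suc K₀
      reassociate : ∀ c n b r q → c ℕ.* (n ℕ.* (b ℕ.* (r ℕ.* q))) ≡ c ℕ.* (n ℕ.* (b ℕ.* r)) ℕ.* q
      reassociate = ℕ-Ring.solve-∀

  infixr 7 _∗_
  -- The action of a matrix on the second tensor factor. A tensor is viewed as a family of elements
  -- of O, its columns, and ⊗ acts on the first factor; the two actions commute by `⊗-∗`.
  _∗_ : Matrix n n → (Fin n → Elem n) → Fin n → Elem n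
  (M ∗ w) l = tabulate (λ i → ∑ n (λ k → M l k * lookup (w k) i))

  lookup-∗ : ∀ M w l i → lookup ((M ∗ w) l) i ≡ ∑ n (λ k → M l k * lookup (w k) i)
  lookup-∗ M w l i = lookup∘tabulate (λ i → ∑ n (λ k → M l k * lookup (w k) i)) i

  ∗-cong : ∀ {M M′ w w′} → (∀ l k → M l k ≡ M′ l k) → (∀ k → w k ≡ w′ k) → ∀ l → (M ∗ w) l ≡ (M′ ∗ w′) l
  ∗-cong e e′ l = tabulate-cong (λ i → ∑-cong n (λ k → cong₂ _*_ (e l k) (cong (λ v → lookup v i) (e′ k))))

  ∗-assoc : ∀ x y w l → (mulMatrix x ∗ (mulMatrix y ∗ w)) l ≡ (mulMatrix (x ⊗ y) ∗ w) l
  ∗-assoc x y w l = tabulate-cong λ i → begin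
    ∑ n (λ k → mulMatrix x l k * lookup ((mulMatrix y ∗ w) k) i)
      ≡⟨ ∑-cong n (λ k → trans (cong (mulMatrix x l k *_) (lookup-∗ (mulMatrix y) w k i))
           (sym (∑-*ˡ n (mulMatrix x l k) (λ p → mulMatrix y k p * lookup (w p) i)))) ⟩
    ∑ n (λ k → ∑ n (λ p → mulMatrix x l k * (mulMatrix y k p * lookup (w p) i)))
      ≡⟨ ∑-swap n n (λ k p → mulMatrix x l k * (mulMatrix y k p * lookup (w p) i)) ⟩
    ∑ n (λ p → ∑ n (λ k → mulMatrix x l k * (mulMatrix y k p * lookup (w p) i)))
      ≡⟨ ∑-cong n (λ p → trans (∑-cong n (λ k → sym (ℤₚ.*-assoc (mulMatrix x l k) (mulMatrix y k p) (lookup (w p) i))))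
           (trans (∑-*ʳ n (lookup (w p) i) (λ k → mulMatrix x l k * mulMatrix y k p))
             (cong (_* lookup (w p) i) (sym (mulMatrix-⊗ x y l p))))) ⟩
    ∑ n (λ p → mulMatrix (x ⊗ y) l p * lookup (w p) i) ∎
    where open ≡-Reasoning

  ⊗-∗ : ∀ x M w l → x ⊗ (M ∗ w) l ≡ (M ∗ (λ k → x ⊗ w k)) l
  ⊗-∗ x M w l = lookup-ext λ i → begin
    lookup (x ⊗ (M ∗ w) l) i
      ≡⟨ lookup-⊗ x ((M ∗ w) l) i ⟩
    ∑ n (λ p → mulMatrix x i p * lookup ((M ∗ w) l) p)
      ≡⟨ ∑-cong n (λ p → trans (cong (mulMatrix x i p *_) (lookup-∗ M w l p))
           (sym (∑-*ˡ n (mulMatrix x i p) (λ k → M l k * lookup (w k) p)))) ⟩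
    ∑ n (λ p → ∑ n (λ k → mulMatrix x i p * (M l k * lookup (w k) p)))
      ≡⟨ ∑-swap n n (λ p k → mulMatrix x i p * (M l k * lookup (w k) p)) ⟩
    ∑ n (λ k → ∑ n (λ p → mulMatrix x i p * (M l k * lookup (w k) p)))
      ≡⟨ ∑-cong n (λ k → trans (∑-cong n (λ p → swap (mulMatrix x i p) (M l k) (lookup (w k) p)))
           (trans (∑-*ˡ n (M l k) (λ p → mulMatrix x i p * lookup (w k) p)) (cong (M l k *_) (sym (lookup-⊗ x (w k) i))))) ⟩
    ∑ n (λ k → M l k * lookup (x ⊗ w k) i)
      ≡⟨ sym (lookup-∗ M (λ k → x ⊗ w k) l i) ⟩
    lookup ((M ∗ (λ k → x ⊗ w k)) l) i ∎
    where
    open ≡-Reasoning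
    swap : ∀ a b c → a * (b * c) ≡ b * (a * c)
    swap = solve-∀

  ·-∗ : ∀ a M w l → a · (M ∗ w) l ≡ (M ∗ (λ k → a · w k)) l
  ·-∗ a M w l = lookup-ext λ i → begin
    lookup (a · (M ∗ w) l) i
      ≡⟨ trans (lookup-· a ((M ∗ w) l) i) (cong (a *_) (lookup-∗ M w l i)) ⟩
    a * ∑ n (λ k → M l k * lookup (w k) i)
      ≡⟨ sym (∑-*ˡ n a (λ k → M l k * lookup (w k) i)) ⟩
    ∑ n (λ k → a * (M l k * lookup (w k) i))
      ≡⟨ ∑-cong n (λ k → trans (swap a (M l k) (lookup (w k) i)) (cong (M l k *_) (sym (lookup-· a (w k) i)))) ⟩
    ∑ n (λ k → M l k * lookup (a · w k) i)
      ≡⟨ sym (lookup-∗ M (λ k → a · w k) l i) ⟩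
    lookup ((M ∗ (λ k → a · w k)) l) i ∎
    where
    open ≡-Reasoning
    swap : ∀ a b c → a * (b * c) ≡ b * (a * c)
    swap = solve-∀

  mulMatrix-scalar : ∀ a k j → mulMatrix (a · one) k j ≡ a * δ k j
  mulMatrix-scalar a k j = trans (sym (lookup-⊗-basis (a · one) j k)) (trans
    (cong (λ v → lookup v k) (trans (⊗-·ˡ a one (basis j)) (cong (a ·_) (identity (basis j)))))
    (trans (lookup-· a (basis j) k) (cong (a *_) (trans (lookup∘tabulate (δ j) k) (δ-sym j k)))))

  scalar-∗ : ∀ a w l → (mulMatrix (a · one) ∗ w) l ≡ a · w l
  scalar-∗ a w l = lookup-ext λ i → begin
    lookup ((mulMatrix (a · one) ∗ w) l) i
      ≡⟨ lookup-∗ (mulMatrix (a · one)) w l i ⟩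
    ∑ n (λ k → mulMatrix (a · one) l k * lookup (w k) i)
      ≡⟨ ∑-cong n (λ k → trans (cong (_* lookup (w k) i) (mulMatrix-scalar a l k)) (ℤₚ.*-assoc a (δ l k) (lookup (w k) i))) ⟩
    ∑ n (λ k → a * (δ l k * lookup (w k) i))
      ≡⟨ trans (∑-*ˡ n a (λ k → δ l k * lookup (w k) i)) (cong (a *_) (∑-δˡ n (λ k → lookup (w k) i) l)) ⟩
    a * lookup (w l) i
      ≡⟨ sym (lookup-· a (w l) i) ⟩
    lookup (a · w l) i ∎
    where open ≡-Reasoning

  module _ (W : Matrix n n) (fixed : ∀ i j → conjugate A W i j ≡ W i j) where

    column : Fin n → Elem n
    column l = tabulate (λ k → W k l)

    column-fixed : ∀ j → column j ≡ (A ∗ (λ l → α ⊗ column l)) j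
    column-fixed j = lookup-ext λ i → begin
      lookup (column j) i
        ≡⟨ trans (lookup∘tabulate (λ k → W k j) i) (sym (fixed i j)) ⟩
      ∑ n (λ k → ∑ n (λ l → A i k * A j l * W k l))
        ≡⟨ ∑-swap n n (λ k l → A i k * A j l * W k l) ⟩
      ∑ n (λ l → ∑ n (λ k → A i k * A j l * W k l))
        ≡⟨ ∑-cong n (λ l → trans
             (∑-cong n (λ k → trans (rotate (A i k) (A j l) (W k l)) (cong (λ v → A j l * (A i k * v)) (sym (lookup∘tabulate (λ k → W k l) k)))))
             (trans (∑-*ˡ n (A j l) (λ k → A i k * lookup (column l) k)) (cong (A j l *_) (sym (lookup-⊗ α (column l) i))))) ⟩
      ∑ n (λ l → A j l * lookup (α ⊗ column l) i)
        ≡⟨ sym (lookup-∗ A (λ l → α ⊗ column l) j i) ⟩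
      lookup ((A ∗ (λ l → α ⊗ column l)) j) i ∎
      where
      open ≡-Reasoning
      rotate : ∀ a b w → a * b * w ≡ b * (a * w)
      rotate = solve-∀

    -- Applying γ to the second factor of W = (α ⊗ α) W turns α there into m, so m (α ⊗ 1) W = (1 ⊗
    -- γ) W.
    transfer : ∀ l → pos m · (α ⊗ column l) ≡ (mulMatrix γ ∗ column) l
    transfer l = begin
      pos m · (α ⊗ column l)                                         ≡⟨ sym (scalar-∗ (pos m) (λ l → α ⊗ column l) l) ⟩
      (mulMatrix (pos m · one) ∗ (λ l → α ⊗ column l)) l             ≡⟨ cong (λ x → (mulMatrix x ∗ (λ l → α ⊗ column l)) l) (sym (trans (comm γ α) αγ≡m)) ⟩
      (mulMatrix (γ ⊗ α) ∗ (λ l → α ⊗ column l)) l                   ≡⟨ sym (∗-assoc γ α (λ l → α ⊗ column l) l) ⟩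
      (mulMatrix γ ∗ (mulMatrix α ∗ (λ l → α ⊗ column l))) l         ≡⟨ ∗-cong {mulMatrix γ} {mulMatrix γ} (λ _ _ → refl) (λ k → sym (column-fixed k)) l ⟩
      (mulMatrix γ ∗ column) l                                       ∎
      where open ≡-Reasoning

    transfer-power : ∀ k l → pos (m ℕ.^ k) · ((α ^ k) ⊗ column l) ≡ (mulMatrix (γ ^ k) ∗ column) l
    transfer-power zero l = trans (cong (1ℤ ·_) (identity (column l)))
      (trans (sym (scalar-∗ 1ℤ column l)) (cong (λ x → (mulMatrix x ∗ column) l) (·-identity one)))
    transfer-power (suc k) l = begin
      pos (m ℕ.* m ℕ.^ k) · ((α ⊗ (α ^ k)) ⊗ column l)
        ≡⟨ cong₂ _·_ (ℤₚ.pos-* m (m ℕ.^ k)) (assoc α (α ^ k) (column l)) ⟩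
      (pos m * pos (m ℕ.^ k)) · (α ⊗ ((α ^ k) ⊗ column l))
        ≡⟨ sym (·-assoc (pos m) (pos (m ℕ.^ k)) (α ⊗ ((α ^ k) ⊗ column l))) ⟩
      pos m · (pos (m ℕ.^ k) · (α ⊗ ((α ^ k) ⊗ column l)))
        ≡⟨ cong (pos m ·_) (trans (sym (⊗-·ʳ (pos (m ℕ.^ k)) α ((α ^ k) ⊗ column l))) (cong (α ⊗_) (transfer-power k l))) ⟩
      pos m · (α ⊗ (mulMatrix (γ ^ k) ∗ column) l)
        ≡⟨ trans (cong (pos m ·_) (⊗-∗ α (mulMatrix (γ ^ k)) column l)) (·-∗ (pos m) (mulMatrix (γ ^ k)) (λ l → α ⊗ column l) l) ⟩
      (mulMatrix (γ ^ k) ∗ (λ l → pos m · (α ⊗ column l))) l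
        ≡⟨ ∗-cong {mulMatrix (γ ^ k)} {mulMatrix (γ ^ k)} (λ _ _ → refl) transfer l ⟩
      (mulMatrix (γ ^ k) ∗ (mulMatrix γ ∗ column)) l
        ≡⟨ trans (∗-assoc (γ ^ k) γ column l) (cong (λ x → (mulMatrix x ∗ column) l) (comm (γ ^ k) γ)) ⟩
      (mulMatrix (γ ^ suc k) ∗ column) l ∎
      where open ≡-Reasoning

    ‖∗‖ : ∀ x l → ‖ (mulMatrix x ∗ column) l ‖ ≤ n ℕ.* (κ ℕ.* ‖ x ‖ ℕ.* proj₁ (bounded n (λ l → ‖ column l ‖)))
    ‖∗‖ x l = ‖‖-least ((mulMatrix x ∗ column) l) (n ℕ.* B) λ i → subst (λ v → ∣ v ∣ ≤ n ℕ.* B) (sym (lookup-∗ (mulMatrix x) column l i))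
      (∑-bound n (λ k → mulMatrix x l k * lookup (column k) i) B λ k → begin
        ∣ mulMatrix x l k * lookup (column k) i ∣
          ≡⟨ ℤₚ.abs-* (mulMatrix x l k) (lookup (column k) i) ⟩
        ∣ mulMatrix x l k ∣ ℕ.* ∣ lookup (column k) i ∣
          ≤⟨ ℕₚ.*-mono-≤
               (subst (λ v → ∣ v ∣ ≤ κ ℕ.* ‖ x ‖) (lookup-⊗-basis x k l) (ℕₚ.≤-trans (∣lookup∣≤‖‖ (x ⊗ basis k) l) (‖⊗basis‖ x k)))
               (ℕₚ.≤-trans (∣lookup∣≤‖‖ (column k) i) (proj₂ (bounded n (λ l → ‖ column l ‖)) k)) ⟩
        B ∎)
      where
      open ℕₚ.≤-Reasoning
      B : ℕ
      B = κ ℕ.* ‖ x ‖ ℕ.* proj₁ (bounded n (λ l → ‖ column l ‖))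

    orbit-bounded : ∀ C → PowersBounded C → ∀ l k →
      ‖ (α ^ k) ⊗ column l ‖ ≤ n ℕ.* (κ ℕ.* C ℕ.* proj₁ (bounded n (λ l → ‖ column l ‖)))
    orbit-bounded C powers l k = ℕₚ.*-cancelˡ-≤ (m ℕ.^ k) {{ℕₚ.m^n≢0 m k}} (begin
      m ℕ.^ k ℕ.* ‖ (α ^ k) ⊗ column l ‖            ≡⟨ sym (‖·‖ (pos (m ℕ.^ k)) ((α ^ k) ⊗ column l)) ⟩
      ‖ pos (m ℕ.^ k) · ((α ^ k) ⊗ column l) ‖      ≡⟨ cong ‖_‖ (transfer-power k l) ⟩
      ‖ (mulMatrix (γ ^ k) ∗ column) l ‖            ≤⟨ ‖∗‖ (γ ^ k) l ⟩
      n ℕ.* (κ ℕ.* ‖ γ ^ k ‖ ℕ.* B)                 ≤⟨ ℕₚ.*-monoʳ-≤ n (ℕₚ.*-monoˡ-≤ B (ℕₚ.*-monoʳ-≤ κ (powers k))) ⟩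
      n ℕ.* (κ ℕ.* (C ℕ.* m ℕ.^ k) ℕ.* B)           ≡⟨ rotate n κ C (m ℕ.^ k) B ⟩
      m ℕ.^ k ℕ.* (n ℕ.* (κ ℕ.* C ℕ.* B))           ∎)
      where
      open ℕₚ.≤-Reasoning
      B : ℕ
      B = proj₁ (bounded n (λ l → ‖ column l ‖))
      rotate : ∀ n k c m b → n ℕ.* (k ℕ.* (c ℕ.* m) ℕ.* b) ≡ m ℕ.* (n ℕ.* (k ℕ.* c ℕ.* b))
      rotate = ℕ-Ring.solve-∀

  α^-injective : ∀ k x y → (α ^ k) ⊗ x ≡ (α ^ k) ⊗ y → x ≡ y
  α^-injective zero    x y e = trans (sym (identity x)) (trans e (identity y))
  α^-injective (suc k) x y e = α^-injective k x y
    (α-injective ((α ^ k) ⊗ x) ((α ^ k) ⊗ y) (trans (sym (assoc α (α ^ k) x)) (trans e (assoc α (α ^ k) y))))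

  -- The orbit of a column under α is integral, and bounded because it is also the orbit under 1/α of the other
  -- tensor factor.
  fixed-tensor⇒periodic : ∀ C → PowersBounded C → FixedTensor A → ∃₂ λ w j → w ≢ zeroE × w ≡ (α ^ suc j) ⊗ w
  fixed-tensor⇒periodic C powers (W , (k , l , Wkl≢0) , fixed) =
    from-repetition (bounded⇒repetition (λ k → (α ^ k) ⊗ w) (n ℕ.* (κ ℕ.* C ℕ.* proj₁ (bounded n (λ l → ‖ column W fixed l ‖))))
      (orbit-bounded W fixed C powers l))
    where
    w : Elem n
    w = column W fixed l
    w≢0 : w ≢ zeroE
    w≢0 e = Wkl≢0 (trans (sym (lookup∘tabulate (λ k → W k l) k)) (trans (cong (λ v → lookup v k) e) (lookup-zeroE k)))
    from-repetition : ∀ {B} → (∃₂ λ a b → a ℕ.< b × b ≤ B × (α ^ a) ⊗ w ≡ (α ^ b) ⊗ w) → ∃₂ λ w j → w ≢ zeroE × w ≡ (α ^ suc j) ⊗ w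
    from-repetition (a , b , a<b , _ , e) = w , j , w≢0 , α^-injective a w ((α ^ suc j) ⊗ w) (begin
      (α ^ a) ⊗ w                        ≡⟨ e ⟩
      (α ^ b) ⊗ w                        ≡⟨ cong (λ v → (α ^ v) ⊗ w) (sym (trans (ℕₚ.+-suc a j) (ℕₚ.m+[n∸m]≡n a<b))) ⟩
      (α ^ (a ℕ.+ suc j)) ⊗ w            ≡⟨ cong (_⊗ w) (^-+ α a (suc j)) ⟩
      ((α ^ a) ⊗ (α ^ suc j)) ⊗ w        ≡⟨ assoc (α ^ a) (α ^ suc j) w ⟩
      (α ^ a) ⊗ ((α ^ suc j) ⊗ w)        ∎)
      where
      open ≡-Reasoning
      j : ℕ
      j = b ℕ.∸ suc a

-- Complete residue systems and orbits

maxAbs : List ℤ → ℕ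
maxAbs []      = 0
maxAbs (d ∷ D) = ∣ d ∣ ℕ.⊔ maxAbs D

∈⇒∣d∣≤maxAbs : ∀ {D d} → d ∈ D → ∣ d ∣ ≤ maxAbs D
∈⇒∣d∣≤maxAbs {_ ∷ D} (here refl) = ℕₚ.m≤m⊔n _ (maxAbs D)
∈⇒∣d∣≤maxAbs {d ∷ D} (there d∈)  = ℕₚ.≤-trans (∈⇒∣d∣≤maxAbs d∈) (ℕₚ.m≤n⊔m ∣ d ∣ (maxAbs D))

_≟ᴱ_ : ∀ {n} (x y : Elem n) → Dec (x ≡ y)
_≟ᴱ_ = ≡-dec ℤₚ._≟_

-- The integer B + 1 exceeds every digit, so subtracting its lowest digit leaves one of 1, ..., 2B +
-- 1. Indexing by `Fin` makes this value searchable and visibly nonzero.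
above-bound : ∀ B d → ∣ d ∣ ≤ B → ∃ λ (i : Fin (suc (B ℕ.+ B))) → pos (suc B) - d ≡ pos (suc (toℕ i))
above-bound B (pos n) n≤B = fromℕ< below , (begin
  pos (suc B) - pos n            ≡⟨ ℤₚ.m-n≡m⊖n (suc B) n ⟩
  suc B ℤ.⊖ n                    ≡⟨ ℤₚ.⊖-≥ (ℕₚ.m≤n⇒m≤1+n n≤B) ⟩
  pos (suc B ℕ.∸ n)              ≡⟨ cong pos (ℕₚ.+-∸-assoc 1 n≤B) ⟩
  pos (suc (B ℕ.∸ n))            ≡⟨ cong (pos ∘ suc) (sym (Finₚ.toℕ-fromℕ< below)) ⟩
  pos (suc (toℕ (fromℕ< below))) ∎)
  where

  open ≡-Reasoning
  below : B ℕ.∸ n ℕ.< suc (B ℕ.+ B)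
  below = s≤s (ℕₚ.≤-trans (ℕₚ.m∸n≤m B n) (ℕₚ.m≤m+n B B))
above-bound B -[1+ n ] n<B = fromℕ< below ,
  cong (pos ∘ suc) (trans (ℕₚ.+-comm B (suc n)) (trans (ℕₚ.+-comm (suc n) B) (sym (Finₚ.toℕ-fromℕ< below))))
  where
  below : B ℕ.+ suc n ℕ.< suc (B ℕ.+ B)
  below = s≤s (ℕₚ.+-monoʳ-≤ B n<B)

module _ (O : Order) where

  -- Congruence modulo 0 is equality, and a finite list misses the integer just above its largest
  -- absolute value.
  complete-residue-system⇒≢0 : ∀ {m D} → CompleteResidueSystem O m D → m ≢ 0ℤ
  complete-residue-system⇒≢0 {D = D} (hits , _) refl = contradiction (hits (pos (suc (maxAbs D))))
    where
    contradiction : (Σ ℤ λ d → d ∈ D × 0ℤ ∣ (pos (suc (maxAbs D)) - d)) → ⊥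
    contradiction (d , d∈D , 0∣) with above-bound (maxAbs D) d (∈⇒∣d∣≤maxAbs d∈D)
    ... | i , e = ℕₚ.1+n≢0 (trans (cong ∣_∣ (sym e)) (ℕ∣.0∣⇒≡0 0∣))

  complete-residue-system? : ∀ m D → Dec (CompleteResidueSystem O m D)
  complete-residue-system? m D with m ℤₚ.≟ 0ℤ
  ... | yes m≡0 = no λ crs → complete-residue-system⇒≢0 crs m≡0
  ... | no  m≢0 = hits? ×-dec separated?
    where
    instance
      ∣m∣≢0 : NonZero ∣ m ∣
      ∣m∣≢0 = ℕ.≢-nonZero (m≢0 ∘ ℤₚ.∣i∣≡0⇒i≡0)
    shift : ∀ z d q k → z ≡ q + k → z - d ≡ q - d + k
    shift z d q k refl = assoc q k d
      where
      assoc : ∀ q k d → q + k - d ≡ q - d + k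
      assoc = solve-∀
    -- Testing the remainders 0, ..., |m| - 1 suffices, since z and its remainder differ by a
    -- multiple of m.
    from-remainders : (∀ (i : Fin ∣ m ∣) → Any (λ d → m ∣ (pos (toℕ i) - d)) D) → ∀ z → Σ ℤ λ d → d ∈ D × m ∣ (z - d)
    from-remainders h z with find (h (fromℕ< (n%ℕd<d z ∣ m ∣)))
    ... | d , d∈D , m∣ = d , d∈D , Signed.∣⇒∣ᵤ {pos ∣ m ∣} (subst (pos ∣ m ∣ Signed.∣_)
          (sym (shift z d (pos (z %ℕ ∣ m ∣)) ((z /ℕ ∣ m ∣) * pos ∣ m ∣) (a≡a%ℕn+[a/ℕn]*n z ∣ m ∣)))
          (Signed.∣m∣n⇒∣m+n (subst (λ v → pos ∣ m ∣ Signed.∣ pos v - d) (Finₚ.toℕ-fromℕ< (n%ℕd<d z ∣ m ∣)) (Signed.∣ᵤ⇒∣ {pos ∣ m ∣} m∣))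
            (Signed.divides (z /ℕ ∣ m ∣) refl)))
    hits? : Dec (∀ z → Σ ℤ λ d → d ∈ D × m ∣ (z - d))
    hits? = map′ from-remainders
      (λ h i → let d , d∈D , m∣ = h (pos (toℕ i)) in lose d∈D m∣)
      (Finₚ.all? (λ i → Any.any? (λ d → ∣ m ∣ ℕ∣.∣? ∣ pos (toℕ i) - d ∣) D))
    separated? : Dec (∀ d d′ → d ∈ D → d′ ∈ D → m ∣ (d - d′) → d ≡ d′)
    separated? = map′ (λ h d d′ d∈D d′∈D → All.lookup (All.lookup h d∈D) d′∈D)
      (λ h → All.tabulate (λ d∈D → All.tabulate (λ d′∈D → h _ _ d∈D d′∈D)))
      (All.all? (λ d → All.all? (λ d′ → (∣ m ∣ ℕ∣.∣? ∣ d - d′ ∣) →-dec (d ℤₚ.≟ d′)) D) D)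

iter : ∀ {A : Set} → (A → A) → ℕ → A → A
iter f zero    x = x
iter f (suc k) x = f (iter f k x)

iter-+ : ∀ {A : Set} (f : A → A) a b x → iter f (a ℕ.+ b) x ≡ iter f a (iter f b x)
iter-+ f zero    b x = refl
iter-+ f (suc a) b x = cong f (iter-+ f a b x)

iter-* : ∀ {A : Set} (f : A → A) k j x → iter (iter f k) j x ≡ iter f (j ℕ.* k) x
iter-* f k zero    x = refl
iter-* f k (suc j) x = trans (cong (iter f k) (iter-* f k j x)) (sym (iter-+ f k (j ℕ.* k) x))

iter-shift : ∀ {A : Set} (f : A → A) k x → iter f (suc k) x ≡ iter f k (f x)
iter-shift f k x = trans (cong (λ v → iter f v x) (ℕₚ.+-comm 1 k)) (iter-+ f k 1 x)

module _ {n : ℕ} (U : Elem n → Elem n) (ρ : ℕ) (halves : ∀ x → 2 ℕ.* ‖ U x ‖ ≤ ‖ x ‖ ℕ.+ ρ) where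

  iterates-bounded : ∀ x j → ‖ iter U j x ‖ ≤ ‖ x ‖ ℕ.⊔ ρ
  iterates-bounded x zero    = ℕₚ.m≤m⊔n ‖ x ‖ ρ
  iterates-bounded x (suc j) = ℕₚ.*-cancelˡ-≤ 2 (begin
    2 ℕ.* ‖ U (iter U j x) ‖                 ≤⟨ halves (iter U j x) ⟩
    ‖ iter U j x ‖ ℕ.+ ρ                     ≤⟨ ℕₚ.+-mono-≤ (iterates-bounded x j) (ℕₚ.m≤n⊔m ‖ x ‖ ρ) ⟩
    R ℕ.+ R                                  ≡⟨ cong (R ℕ.+_) (sym (ℕₚ.+-identityʳ R)) ⟩
    2 ℕ.* R                                  ∎)
    where
    open ℕₚ.≤-Reasoning
    R : ℕ
    R = ‖ x ‖ ℕ.⊔ ρ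

  halves⇒< : ∀ x → ρ ℕ.< ‖ x ‖ → ‖ U x ‖ ℕ.< ‖ x ‖
  halves⇒< x ρ<x = ℕₚ.*-cancelˡ-< 2 ‖ U x ‖ ‖ x ‖ (begin-strict
    2 ℕ.* ‖ U x ‖        ≤⟨ halves x ⟩
    ‖ x ‖ ℕ.+ ρ          <⟨ ℕₚ.+-monoʳ-< ‖ x ‖ ρ<x ⟩
    ‖ x ‖ ℕ.+ ‖ x ‖      ≡⟨ cong (‖ x ‖ ℕ.+_) (sym (ℕₚ.+-identityʳ ‖ x ‖)) ⟩
    2 ℕ.* ‖ x ‖          ∎)
    where open ℕₚ.≤-Reasoning

  -- The orbit of x is finite, so beyond the first repetition nothing new appears.
  reaches? : ∀ y x → Dec (∃ λ j → iter U j x ≡ y)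
  reaches? y x = from (bounded⇒repetition (λ j → iter U j x) (‖ x ‖ ℕ.⊔ ρ) (iterates-bounded x))
    where
    B : ℕ
    B = length (box n (‖ x ‖ ℕ.⊔ ρ))
    from : (∃₂ λ a b → a ℕ.< b × b ≤ B × iter U a x ≡ iter U b x) → Dec (∃ λ j → iter U j x ≡ y)
    from (a , b , a<b , b≤B , e) = map′ (λ (i , p) → toℕ i , p) (λ (j , p) → restrict j p)
        (Finₚ.any? (λ (i : Fin (suc B)) → iter U (toℕ i) x ≟ᴱ y))
      where
      restrict : ∀ j → iter U j x ≡ y → ∃ λ (i : Fin (suc B)) → iter U (toℕ i) x ≡ y
      restrict = <-rec _ step
        where
        step : ∀ j → (∀ {i} → i ℕ.< j → iter U i x ≡ y → ∃ λ (i : Fin (suc B)) → iter U (toℕ i) x ≡ y) →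
          iter U j x ≡ y → ∃ λ (i : Fin (suc B)) → iter U (toℕ i) x ≡ y
        step j rec p = by (j ℕₚ.<? suc B)
          where
          by : Dec (j ℕ.< suc B) → ∃ λ (i : Fin (suc B)) → iter U (toℕ i) x ≡ y
          by (yes j≤B) = fromℕ< j≤B , trans (cong (λ v → iter U v x) (Finₚ.toℕ-fromℕ< j≤B)) p
          -- One period b - a is removed from the index.
          by (no  j≰B) = rec (subst (j ℕ.∸ b ℕ.+ a ℕ.<_) j≡ (ℕₚ.+-monoʳ-< (j ℕ.∸ b) a<b)) (begin
            iter U (j ℕ.∸ b ℕ.+ a) x              ≡⟨ iter-+ U (j ℕ.∸ b) a x ⟩
            iter U (j ℕ.∸ b) (iter U a x)         ≡⟨ cong (iter U (j ℕ.∸ b)) e ⟩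
            iter U (j ℕ.∸ b) (iter U b x)         ≡⟨ sym (iter-+ U (j ℕ.∸ b) b x) ⟩
            iter U (j ℕ.∸ b ℕ.+ b) x              ≡⟨ cong (λ v → iter U v x) j≡ ⟩
            iter U j x                            ≡⟨ p ⟩
            y                                     ∎)
            where
            open ≡-Reasoning
            j≡ : j ℕ.∸ b ℕ.+ b ≡ j
            j≡ = ℕₚ.m∸n+n≡m (ℕₚ.≤-trans (ℕₚ.m≤n⇒m≤1+n b≤B) (ℕₚ.≮⇒≥ j≰B))

-- Deciding the finiteness property

module Expand (O : Order) (α γ : Elem (Order.rank O)) (m : ℕ) .{{_ : NonZero m}}
  (αγ≡m : Order._⊗_ O α γ ≡ Order._·_ O (pos m) (Order.one O)) (D : List ℤ) (0∈D : 0ℤ ∈ D) where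
  open Trace O
  open Inverse O α γ m αγ≡m
  open Contraction O α γ m αγ≡m

  HasDigit : Elem rank → Set
  HasDigit x = Any (λ d → ∃ λ y → x ≡ (d · one) ⊕ (α ⊗ y)) D

  expansion⇒digit : ∀ {x} → Expansion O α D x → HasDigit x
  expansion⇒digit expansion = let d , ds , d∈D , _ , e = leading-digit O α 0∈D expansion in lose d∈D (eval O α ds , e)

  -- Since αγ = m is not a zero divisor, v lies in αO exactly when γv lies in mO, a condition on
  -- coordinates.
  multiple? : ∀ v → Dec (∃ λ y → v ≡ α ⊗ y)
  multiple? v = map′ from to (Finₚ.all? (λ i → pos m Signed.∣? lookup (γ ⊗ v) i))
    where
    from : (∀ i → pos m Signed.∣ lookup (γ ⊗ v) i) → ∃ λ y → v ≡ α ⊗ y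
    from h = y , ·-cancel (pos m) v (α ⊗ y) m≢0 (trans (sym (α-cancel v)) (trans (cong (α ⊗_) γv≡my) (⊗-·ʳ (pos m) α y)))
      where
      y : Elem rank
      y = tabulate (λ i → Signed.quotient (h i))
      γv≡my : γ ⊗ v ≡ pos m · y
      γv≡my = lookup-ext λ i → trans (Signed._∣_.equality (h i)) (trans (ℤₚ.*-comm (Signed.quotient (h i)) (pos m))
        (sym (trans (lookup-· (pos m) y i) (cong (pos m *_) (lookup∘tabulate (λ i → Signed.quotient (h i)) i)))))
    to : (∃ λ y → v ≡ α ⊗ y) → ∀ i → pos m Signed.∣ lookup (γ ⊗ v) i
    to (y , e) i = Signed.divides (lookup y i) (trans (cong (λ w → lookup w i) (trans (cong (γ ⊗_) e) (γ-cancel y)))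
      (trans (lookup-· (pos m) y i) (ℤₚ.*-comm (pos m) (lookup y i))))

  digit? : ∀ x → Dec (HasDigit x)
  digit? x = Any.any? (λ d → map′ (λ (y , e) → y , add d (α ⊗ y) e) (λ (y , e) → y , remove d (α ⊗ y) e)
      (multiple? (((- d) · one) ⊕ x))) D
    where
    cancel : ∀ d w → (d · one) ⊕ (((- d) · one) ⊕ w) ≡ w
    cancel d w = trans (sym (⊕-assoc (d · one) ((- d) · one) w)) (trans
      (cong (_⊕ w) (trans (sym (·-distribʳ d (- d) one)) (trans (cong (_· one) (ℤₚ.+-inverseʳ d)) (·-zeroˡ one))))
      (⊕-identityˡ w))
    add : ∀ d w → ((- d) · one) ⊕ x ≡ w → x ≡ (d · one) ⊕ w
    add d w e = trans (sym (cancel d x)) (cong ((d · one) ⊕_) e)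
    remove : ∀ d w → x ≡ (d · one) ⊕ w → ((- d) · one) ⊕ x ≡ w
    remove d w e = trans (cong (((- d) · one) ⊕_) e) (trans (⊕-swap ((- d) · one) (d · one) w) (cancel d w))

  -- Since αγ = m, only the residue class of x modulo m matters.
  digits? : Dec (∀ x → HasDigit x)
  digits? = map′ from-box (λ h → All.tabulate (λ {x} _ → h x)) (All.all? digit? (box rank m))
    where
    from-box : All HasDigit (box rank m) → ∀ x → HasDigit x
    from-box h x = Any.map (λ {d} → transport d) (All.lookup h (∈-box m r (‖‖-least r m (λ i →
        subst (λ v → ∣ v ∣ ≤ m) (sym (lookup∘tabulate (λ i → pos (lookup x i %ℕ m)) i)) (ℕₚ.<⇒≤ (n%ℕd<d (lookup x i) m))))))
      where
      r q : Elem rank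
      r = tabulate (λ i → pos (lookup x i %ℕ m))
      q = tabulate (λ i → lookup x i /ℕ m)
      x≡ : x ≡ r ⊕ (pos m · q)
      x≡ = lookup-ext λ i → trans (a≡a%ℕn+[a/ℕn]*n (lookup x i) m) (sym (trans (lookup-⊕ r (pos m · q) i)
        (cong₂ _+_ (lookup∘tabulate (λ i → pos (lookup x i %ℕ m)) i)
          (trans (lookup-· (pos m) q i) (trans (cong (pos m *_) (lookup∘tabulate (λ i → lookup x i /ℕ m) i)) (ℤₚ.*-comm (pos m) (lookup x i /ℕ m)))))))
      transport : ∀ d → (∃ λ y → r ≡ (d · one) ⊕ (α ⊗ y)) → ∃ λ y → x ≡ (d · one) ⊕ (α ⊗ y)
      transport d (y , e) = y ⊕ (γ ⊗ q) , (begin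
        x                                                ≡⟨ x≡ ⟩
        r ⊕ (pos m · q)                                  ≡⟨ cong₂ _⊕_ e (sym (α-cancel q)) ⟩
        ((d · one) ⊕ (α ⊗ y)) ⊕ (α ⊗ (γ ⊗ q))            ≡⟨ ⊕-assoc (d · one) (α ⊗ y) (α ⊗ (γ ⊗ q)) ⟩
        (d · one) ⊕ ((α ⊗ y) ⊕ (α ⊗ (γ ⊗ q)))            ≡⟨ cong ((d · one) ⊕_) (sym (⊗-distribˡ α y (γ ⊗ q))) ⟩
        (d · one) ⊕ (α ⊗ (y ⊕ (γ ⊗ q)))                  ∎)
        where open ≡-Reasoning

  module Division (crs : CompleteResidueSystem O (N O α) D) (digits : ∀ x → HasDigit x) where

    digit : Elem rank → ℤ
    digit x = proj₁ (find (digits x))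

    digit∈D : ∀ x → digit x ∈ D
    digit∈D x = proj₁ (proj₂ (find (digits x)))

    T : Elem rank → Elem rank
    T x = proj₁ (proj₂ (proj₂ (find (digits x))))

    division : ∀ x → x ≡ (digit x · one) ⊕ (α ⊗ T x)
    division x = proj₂ (proj₂ (proj₂ (find (digits x))))

    open Multilinear O using (module Cyclic)

    -- The difference d - d′ is an integer in αO. As every element has a digit, `Cyclic` applies and
    -- makes N(α) divide it, whence d = d′ by the residue system; then α is cancelled.
    digit-unique : ∀ {d d′} x y → d ∈ D → d′ ∈ D → (d · one) ⊕ (α ⊗ x) ≡ (d′ · one) ⊕ (α ⊗ y) → d ≡ d′ × x ≡ y
    digit-unique {d} {d′} x y d∈D d′∈D e = d≡d′ ,
      α-injective x y (⊕-cancelˡ (d · one) (α ⊗ x) (α ⊗ y) (trans e (cong (λ v → (v · one) ⊕ (α ⊗ y)) (sym d≡d′))))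
      where
      difference : α ⊗ (y ⊕ ((- 1ℤ) · x)) ≡ (d - d′) · one
      difference = lookup-ext λ i → let a = lookup (α ⊗ x) i ; b = lookup (α ⊗ y) i ; o = lookup one i in begin
        lookup (α ⊗ (y ⊕ ((- 1ℤ) · x))) i
          ≡⟨ cong (λ v → lookup v i) (trans (⊗-distribˡ α y ((- 1ℤ) · x)) (cong ((α ⊗ y) ⊕_) (⊗-·ʳ (- 1ℤ) α x))) ⟩
        lookup ((α ⊗ y) ⊕ ((- 1ℤ) · (α ⊗ x))) i
          ≡⟨ trans (lookup-⊕ (α ⊗ y) ((- 1ℤ) · (α ⊗ x)) i) (cong (b +_) (lookup-· (- 1ℤ) (α ⊗ x) i)) ⟩
        b + (- 1ℤ) * a
          ≡⟨ before d′ o a b ⟩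
        (d′ * o + b) - d′ * o - a
          ≡⟨ cong (λ v → v - d′ * o - a) (trans (sym (coordinate d′ y i)) (trans (cong (λ v → lookup v i) (sym e)) (coordinate d x i))) ⟩
        (d * o + a) - d′ * o - a
          ≡⟨ after d d′ o a ⟩
        (d - d′) * o
          ≡⟨ sym (lookup-· (d - d′) one i) ⟩
        lookup ((d - d′) · one) i ∎
        where
        open ≡-Reasoning
        coordinate : ∀ d x i → lookup ((d · one) ⊕ (α ⊗ x)) i ≡ d * lookup one i + lookup (α ⊗ x) i
        coordinate d x i = trans (lookup-⊕ (d · one) (α ⊗ x) i) (cong (_+ lookup (α ⊗ x) i) (lookup-· d one i))
        before : ∀ d o a b → b + (- 1ℤ) * a ≡ (d * o + b) - d * o - a
        before = solve-∀
        after : ∀ d d′ o a → (d * o + a) - d′ * o - a ≡ (d - d′) * o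
        after = solve-∀
      d≡d′ : d ≡ d′
      d≡d′ = proj₂ crs d d′ d∈D d′∈D (Signed.∣⇒∣ᵤ {N O α} (Cyclic.N∣integer-multiple α
        (λ w → digit w , T w , division w) (d - d′) (y ⊕ ((- 1ℤ) · x)) difference))

    T-unique : ∀ {d} x y → d ∈ D → x ≡ (d · one) ⊕ (α ⊗ y) → T x ≡ y
    T-unique x y d∈D e = proj₂ (digit-unique (T x) y (digit∈D x) d∈D (trans (sym (division x)) e))

    zero-digit : ∀ x → α ⊗ x ≡ (0ℤ · one) ⊕ (α ⊗ x)
    zero-digit x = sym (trans (cong (_⊕ (α ⊗ x)) (·-zeroˡ one)) (⊕-identityˡ (α ⊗ x)))

    T-zero : ∀ k → iter T k zeroE ≡ zeroE
    T-zero zero    = refl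
    T-zero (suc k) = trans (cong T (T-zero k)) (T-unique zeroE zeroE 0∈D (trans (sym (⊗-zeroʳ α)) (zero-digit zeroE)))

    -- Uniqueness of digits forces `T` to strip exactly the given word. The surplus i, harmless
    -- because `T` fixes zero, lets the number of steps be rounded up to a multiple of the step
    -- length of `U`.
    eval⇒T : ∀ ds → All (_∈ D) ds → ∀ i → iter T (i ℕ.+ length ds) (eval O α ds) ≡ zeroE
    eval⇒T []       []           i = T-zero (i ℕ.+ 0)
    eval⇒T (d ∷ ds) (d∈D ∷ ds∈D) i = begin
      iter T (i ℕ.+ suc (length ds)) (eval O α (d ∷ ds))     ≡⟨ cong (λ v → iter T v (eval O α (d ∷ ds))) (ℕₚ.+-suc i (length ds)) ⟩
      iter T (suc (i ℕ.+ length ds)) (eval O α (d ∷ ds))     ≡⟨ iter-shift T (i ℕ.+ length ds) (eval O α (d ∷ ds)) ⟩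
      iter T (i ℕ.+ length ds) (T (eval O α (d ∷ ds)))       ≡⟨ cong (iter T (i ℕ.+ length ds)) (T-unique (eval O α (d ∷ ds)) (eval O α ds) d∈D refl) ⟩
      iter T (i ℕ.+ length ds) (eval O α ds)                 ≡⟨ eval⇒T ds ds∈D i ⟩
      zeroE                                                  ∎
      where open ≡-Reasoning

    T⇒expansion : ∀ k x → Expansion O α D (iter T k x) → Expansion O α D x
    T⇒expansion zero    x expansion       = expansion
    T⇒expansion (suc k) x (ds , ds∈D , e) = T⇒expansion k x (digit y ∷ ds , digit∈D y ∷ ds∈D ,
        trans (cong (λ v → (digit y · one) ⊕ (α ⊗ v)) e) (sym (division y)))
      where
      y : Elem rank
      y = iter T k x

    -- Shifting the digits of w = α^(j+1) w would give a second expansion of w.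
    no-periodic : ∀ {w j} → w ≡ (α ^ suc j) ⊗ w → Expansion O α D w → w ≡ zeroE
    no-periodic {w} {j} periodic (ds , ds∈D , e) = vanish ds ds∈D 0 (trans e (sym (identity w)))
      where
      vanish : ∀ ds → All (_∈ D) ds → ∀ i → eval O α ds ≡ (α ^ i) ⊗ w → w ≡ zeroE
      next : ∀ {d} ds → d ∈ D → All (_∈ D) ds → ∀ i → (d · one) ⊕ (α ⊗ eval O α ds) ≡ (α ^ suc i) ⊗ w → w ≡ zeroE
      next ds d∈D ds∈D i e = vanish ds ds∈D i (proj₂ (digit-unique (eval O α ds) ((α ^ i) ⊗ w) d∈D 0∈D
        (trans e (trans (assoc α (α ^ i) w) (zero-digit ((α ^ i) ⊗ w))))))
      vanish []       []           i       e = α^-injective i w zeroE (trans (sym e) (sym (⊗-zeroʳ (α ^ i))))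
      vanish (d ∷ ds) (d∈D ∷ ds∈D) zero    e = next ds d∈D ds∈D j (trans e (trans (identity w) periodic))
      vanish (d ∷ ds) (d∈D ∷ ds∈D) (suc i) e = next ds d∈D ds∈D i e

    -- Bounds the error in replacing γ^k x by m^k T^k x. Each step multiplies the old error by γ and
    -- adds m^k d γ for the digit d just removed.
    drift : ℕ → ℕ
    drift zero    = 0
    drift (suc k) = m ℕ.^ k ℕ.* (maxAbs D ℕ.* ‖ γ ‖) ℕ.+ κ ℕ.* (‖ γ ‖ ℕ.* drift k)

    T-drift : ∀ k x → ∃ λ s → ‖ s ‖ ≤ drift k × (γ ^ k) ⊗ x ≡ (pos (m ℕ.^ k) · iter T k x) ⊕ s
    T-drift zero x = zeroE , ℕₚ.≤-reflexive ‖zero‖ ,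
      trans (identity x) (sym (trans (⊕-identityʳ (1ℤ · x)) (·-identity x)))
    T-drift (suc k) x = let s , s≤ , e = T-drift k x in
        (μ · (d · γ)) ⊕ (γ ⊗ s) , bound s s≤ , (begin
      (γ ⊗ (γ ^ k)) ⊗ x
        ≡⟨ trans (assoc γ (γ ^ k) x) (cong (γ ⊗_) e) ⟩
      γ ⊗ ((μ · y) ⊕ s)
        ≡⟨ trans (⊗-distribˡ γ (μ · y) s) (cong (_⊕ (γ ⊗ s)) (⊗-·ʳ μ γ y)) ⟩
      (μ · (γ ⊗ y)) ⊕ (γ ⊗ s)
        ≡⟨ cong (λ v → (μ · v) ⊕ (γ ⊗ s)) γy ⟩
      (μ · ((pos m · T y) ⊕ (d · γ))) ⊕ (γ ⊗ s)
        ≡⟨ cong (_⊕ (γ ⊗ s)) (trans (·-distribˡ μ (pos m · T y) (d · γ))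
             (cong (_⊕ (μ · (d · γ))) (trans (·-comm μ (pos m) (T y)) (trans (·-assoc (pos m) μ (T y)) (cong (_· T y) (sym (ℤₚ.pos-* m (m ℕ.^ k)))))))) ⟩
      ((pos (m ℕ.* m ℕ.^ k) · T y) ⊕ (μ · (d · γ))) ⊕ (γ ⊗ s)
        ≡⟨ ⊕-assoc (pos (m ℕ.* m ℕ.^ k) · T y) (μ · (d · γ)) (γ ⊗ s) ⟩
      (pos (m ℕ.* m ℕ.^ k) · T y) ⊕ ((μ · (d · γ)) ⊕ (γ ⊗ s)) ∎)
      where
      open ≡-Reasoning
      μ d : ℤ
      y : Elem rank
      μ = pos (m ℕ.^ k)
      y = iter T k x
      d = digit y
      γy : γ ⊗ y ≡ (pos m · T y) ⊕ (d · γ)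
      γy = trans (cong (γ ⊗_) (division y)) (trans (⊗-distribˡ γ (d · one) (α ⊗ T y))
        (trans (cong₂ _⊕_ (trans (⊗-·ʳ d γ one) (cong (d ·_) (⊗-identityʳ γ))) (γ-cancel (T y))) (⊕-comm (d · γ) (pos m · T y))))
      bound : ∀ s → ‖ s ‖ ≤ drift k → ‖ (μ · (d · γ)) ⊕ (γ ⊗ s) ‖ ≤ drift (suc k)
      bound s s≤ = ℕₚ.≤-trans (‖⊕‖ (μ · (d · γ)) (γ ⊗ s)) (ℕₚ.+-mono-≤
        (ℕₚ.≤-trans (ℕₚ.≤-reflexive (trans (‖·‖ μ (d · γ)) (cong (m ℕ.^ k ℕ.*_) (‖·‖ d γ))))
          (ℕₚ.*-monoʳ-≤ (m ℕ.^ k) (ℕₚ.*-monoˡ-≤ ‖ γ ‖ (∈⇒∣d∣≤maxAbs (digit∈D y)))))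
        (ℕₚ.≤-trans (‖⊗‖ γ s) (ℕₚ.*-monoʳ-≤ κ (ℕₚ.*-monoʳ-≤ ‖ γ ‖ s≤))))

    module _ (k : ℕ) (contracting : Contracting (suc k)) where

      private
        U : Elem rank → Elem rank
        U = iter T (suc k)
        ρ μ : ℕ
        ρ = 2 ℕ.* drift (suc k)
        μ = m ℕ.^ suc k

      halves : ∀ x → 2 ℕ.* ‖ U x ‖ ≤ ‖ x ‖ ℕ.+ ρ
      halves x = from (T-drift (suc k) x)
        where
        from : (∃ λ s → ‖ s ‖ ≤ drift (suc k) × (γ ^ suc k) ⊗ x ≡ (pos μ · U x) ⊕ s) → 2 ℕ.* ‖ U x ‖ ≤ ‖ x ‖ ℕ.+ ρ
        from (s , s≤ , e) = ℕₚ.*-cancelˡ-≤ μ {{ℕₚ.m^n≢0 m (suc k)}} (begin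
          μ ℕ.* (2 ℕ.* ‖ U x ‖)
            ≡⟨ shuffle μ 2 ‖ U x ‖ ⟩
          2 ℕ.* (μ ℕ.* ‖ U x ‖)
            ≡⟨ cong (2 ℕ.*_) (sym (‖·‖ (pos μ) (U x))) ⟩
          2 ℕ.* ‖ pos μ · U x ‖
            ≡⟨ cong (λ v → 2 ℕ.* ‖ v ‖) μUx ⟩
          2 ℕ.* ‖ ((γ ^ suc k) ⊗ x) ⊕ ((- 1ℤ) · s) ‖
            ≤⟨ ℕₚ.*-monoʳ-≤ 2 (ℕₚ.≤-trans (‖⊕‖ ((γ ^ suc k) ⊗ x) ((- 1ℤ) · s)) (ℕₚ.+-mono-≤ (‖⊗‖ (γ ^ suc k) x)
                 (ℕₚ.≤-trans (ℕₚ.≤-reflexive (trans (‖·‖ (- 1ℤ) s) (ℕₚ.*-identityˡ ‖ s ‖))) s≤))) ⟩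
          2 ℕ.* (κ ℕ.* (‖ γ ^ suc k ‖ ℕ.* ‖ x ‖) ℕ.+ drift (suc k))
            ≡⟨ split κ ‖ γ ^ suc k ‖ ‖ x ‖ (drift (suc k)) ⟩
          2 ℕ.* (κ ℕ.* ‖ γ ^ suc k ‖) ℕ.* ‖ x ‖ ℕ.+ ρ
            ≤⟨ ℕₚ.+-mono-≤ (ℕₚ.*-monoˡ-≤ ‖ x ‖ contracting) (ℕₚ.m≤n*m ρ μ {{ℕₚ.m^n≢0 m (suc k)}}) ⟩
          μ ℕ.* ‖ x ‖ ℕ.+ μ ℕ.* ρ
            ≡⟨ sym (ℕₚ.*-distribˡ-+ μ ‖ x ‖ ρ) ⟩
          μ ℕ.* (‖ x ‖ ℕ.+ ρ) ∎)
          where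
          open ℕₚ.≤-Reasoning
          shuffle : ∀ a b c → a ℕ.* (b ℕ.* c) ≡ b ℕ.* (a ℕ.* c)
          shuffle = ℕ-Ring.solve-∀
          split : ∀ k g x d → 2 ℕ.* (k ℕ.* (g ℕ.* x) ℕ.+ d) ≡ 2 ℕ.* (k ℕ.* g) ℕ.* x ℕ.+ 2 ℕ.* d
          split = ℕ-Ring.solve-∀
          μUx : pos μ · U x ≡ ((γ ^ suc k) ⊗ x) ⊕ ((- 1ℤ) · s)
          μUx = sym (trans (cong (_⊕ ((- 1ℤ) · s)) e) (trans (⊕-assoc (pos μ · U x) s ((- 1ℤ) · s))
            (trans (cong ((pos μ · U x) ⊕_) (⊕-inverse s)) (⊕-identityʳ (pos μ · U x)))))

      ReachesZero : Elem rank → Set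
      ReachesZero x = ∃ λ j → iter U j x ≡ zeroE

      -- Digits being unique, x has an expansion exactly when its orbit reaches zero. Outside the
      -- box of radius ρ the map `U` lowers the norm, so every orbit enters the box and only its
      -- elements have to be tested.
      finite? : Dec (HasFiniteness O α D)
      finite? = map′ all-expand (λ finite → All.tabulate (λ {x} _ → reaches-zero (finite x)))
          (All.all? (reaches? U ρ halves zeroE) (box rank ρ))
        where
        reaches-zero : ∀ {x} → Expansion O α D x → ReachesZero x
        reaches-zero (ds , ds∈D , refl) = length ds , (begin
          iter U (length ds) (eval O α ds)                           ≡⟨ iter-* T (suc k) (length ds) (eval O α ds) ⟩
          iter T (length ds ℕ.* suc k) (eval O α ds)                 ≡⟨ cong (λ v → iter T v (eval O α ds)) (peel (length ds) k) ⟩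
          iter T (length ds ℕ.* k ℕ.+ length ds) (eval O α ds)       ≡⟨ eval⇒T ds ds∈D (length ds ℕ.* k) ⟩
          zeroE                                                      ∎)
          where
          open ≡-Reasoning
          peel : ∀ l k → l ℕ.* (1 ℕ.+ k) ≡ l ℕ.* k ℕ.+ l
          peel = ℕ-Ring.solve-∀
        reaches⇒expansion : ∀ {x} → ReachesZero x → Expansion O α D x
        reaches⇒expansion {x} (j , e) = T⇒expansion (j ℕ.* suc k) x ([] , [] , sym (trans (sym (iter-* T (suc k) j x)) e))
        all-expand : All ReachesZero (box rank ρ) → HasFiniteness O α D
        all-expand h x = by-norm ‖ x ‖ x refl
          where
          by-norm : ∀ r x → ‖ x ‖ ≡ r → Expansion O α D x
          by-norm = <-rec (λ r → ∀ x → ‖ x ‖ ≡ r → Expansion O α D x) step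
            where
            step : ∀ r → (∀ {r′} → r′ ℕ.< r → ∀ x → ‖ x ‖ ≡ r′ → Expansion O α D x) → ∀ x → ‖ x ‖ ≡ r → Expansion O α D x
            step r rec x refl = by (‖ x ‖ ℕₚ.≤? ρ)
              where
              by : Dec (‖ x ‖ ≤ ρ) → Expansion O α D x
              by (yes x≤ρ) = reaches⇒expansion (All.lookup h (∈-box ρ x x≤ρ))
              by (no  x≰ρ) = T⇒expansion (suc k) x (rec (halves⇒< U ρ halves x (ℕₚ.≰⇒> x≰ρ)) (U x) refl)

  powers-bound : ℕ
  powers-bound = 2 ℕ.* suc (proj₁ square-bound)

  finite⇒powers-bounded : HasFiniteness O α D → PowersBounded powers-bound
  finite⇒powers-bounded = powers-bounded (suc (maxAbs D)) 0∈D (λ d∈D → ℕₚ.m≤n⇒m≤1+n (∈⇒∣d∣≤maxAbs d∈D))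

  -- An element without a digit, a fixed tensor, or a fruitless search for a contraction each refute
  -- finiteness. The bound on the powers of γ holds only under finiteness, so it is invoked only
  -- within the refutations; if all three tests pass, `finite?` decides without it.
  finiteness? : CompleteResidueSystem O (N O α) D → Dec (HasFiniteness O α D)
  finiteness? crs = by-digits digits?
    where
    by-digits : Dec (∀ x → HasDigit x) → Dec (HasFiniteness O α D)
    by-digits (no  ¬digits) = no λ finite → ¬digits (λ x → expansion⇒digit (finite x))
    by-digits (yes digits)  = by-tensor (fixed-or-coercive (mulMatrix α))
      where
      open Division crs digits
      by-tensor : FixedTensor (mulMatrix α) ⊎ TensorCoercive (mulMatrix α) → Dec (HasFiniteness O α D)
      by-tensor (inj₁ fixed) = no λ finite →
        let w , j , w≢0 , periodic = fixed-tensor⇒periodic powers-bound (finite⇒powers-bounded finite) fixed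
        in w≢0 (no-periodic {w} {j} periodic (finite w))
      by-tensor (inj₂ coercive) = by-contraction (Finₚ.any? (λ (k : Fin (proj₁ bound)) → contracting? (suc (toℕ k))))
        where
        bound : ∃ λ K → PowersBounded powers-bound → ∃ λ (k : Fin K) → Contracting (suc (toℕ k))
        bound = contraction powers-bound coercive
        contracting? : ∀ k → Dec (Contracting k)
        contracting? k = 2 ℕ.* (κ ℕ.* ‖ γ ^ k ‖) ℕₚ.≤? m ℕ.^ k
        by-contraction : Dec (∃ λ (k : Fin (proj₁ bound)) → Contracting (suc (toℕ k))) → Dec (HasFiniteness O α D)
        by-contraction (no  none)              = no λ finite → none (proj₂ bound (finite⇒powers-bounded finite))
        by-contraction (yes (k , contracting)) = finite? (toℕ k) contracting

-- The finite search for all α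

module Search (O : Order) (D : List ℤ) (0∈D : 0ℤ ∈ D) where
  open Trace O

  private
    B R : ℕ
    B = maxAbs D
    -- The bound on ‖γ^k‖ at k = 1, with the largest possible value 2B + 1 of m.
    R = 2 ℕ.* suc (proj₁ square-bound) ℕ.* suc (B ℕ.+ B)

  Good : Elem rank → Set
  Good α = IsNumberSystem O α D × HasFiniteness O α D

  Inverts : Elem rank → Elem rank → Set
  Inverts α γ = ∃ λ (i : Fin (suc (B ℕ.+ B))) → α ⊗ γ ≡ pos (suc (toℕ i)) · one

  finite⇒inverse : ∀ α → HasFiniteness O α D → ∃ λ γ → ‖ γ ‖ ≤ R × Inverts α γ
  finite⇒inverse α finite = from (leading-digit O α 0∈D (finite (pos (suc B) · one)))
    where
    from : (∃₂ λ d ds → d ∈ D × All (_∈ D) ds × pos (suc B) · one ≡ (d · one) ⊕ (α ⊗ eval O α ds)) → ∃ λ γ → ‖ γ ‖ ≤ R × Inverts α γ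
    from (d , ds , d∈D , ds∈D , e) = γ , bound , i , αγ≡m
      where
      γ : Elem rank
      γ = eval O α ds
      i : Fin (suc (B ℕ.+ B))
      i = proj₁ (above-bound B d (∈⇒∣d∣≤maxAbs d∈D))
      αγ≡m : α ⊗ γ ≡ pos (suc (toℕ i)) · one
      αγ≡m = trans (sym (subtract-digit O (pos (suc B)) d (α ⊗ γ) e)) (cong (_· one) (proj₂ (above-bound B d (∈⇒∣d∣≤maxAbs d∈D))))
      bound : ‖ γ ‖ ≤ R
      bound = begin
        ‖ γ ‖                                                            ≡⟨ cong ‖_‖ (sym (⊗-identityʳ γ)) ⟩
        ‖ γ ^ 1 ‖                                                        ≤⟨ Expand.finite⇒powers-bounded O α γ (suc (toℕ i)) αγ≡m D 0∈D finite 1 ⟩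
        2 ℕ.* suc (proj₁ square-bound) ℕ.* suc (toℕ i) ℕ.^ 1              ≡⟨ cong (2 ℕ.* suc (proj₁ square-bound) ℕ.*_) (ℕₚ.*-identityʳ (suc (toℕ i))) ⟩
        2 ℕ.* suc (proj₁ square-bound) ℕ.* suc (toℕ i)                    ≤⟨ ℕₚ.*-monoʳ-≤ (2 ℕ.* suc (proj₁ square-bound)) (Finₚ.toℕ<n i) ⟩
        R                                                                ∎
        where open ℕₚ.≤-Reasoning

  -- The search for γ in a box settles two things: failure refutes finiteness, and success already
  -- shows that α is not a zero divisor.
  good? : ∀ α → Dec (Good α)
  good? α = by-crs (complete-residue-system? O (N O α) D)
    where
    by-inverse : CompleteResidueSystem O (N O α) D → Dec (Any (Inverts α) (box rank R)) → Dec (Good α)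
    by-inverse crs (no  ¬inverse) = no λ (_ , finite) →
      let γ , γ≤R , inverts = finite⇒inverse α finite in ¬inverse (lose (∈-box R γ γ≤R) inverts)
    by-inverse crs (yes inverse)  = let γ , i , αγ≡m = Any.satisfied inverse in
      map′ (λ finite → (Inverse.notZeroDivisor O α γ (suc (toℕ i)) αγ≡m , crs) , finite) proj₂
        (Expand.finiteness? O α γ (suc (toℕ i)) αγ≡m D 0∈D crs)
    by-crs : Dec (CompleteResidueSystem O (N O α) D) → Dec (Good α)
    by-crs (no  ¬crs) = no λ ((_ , crs) , _) → ¬crs crs
    by-crs (yes crs)  = by-inverse crs
      (Any.any? (λ γ → Finₚ.any? (λ (i : Fin (suc (B ℕ.+ B))) → (α ⊗ γ) ≟ᴱ (pos (suc (toℕ i)) · one))) (box rank R))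

  -- From γα = m with m ≤ 2B + 1, coercivity of multiplication by γ bounds α. If γ has a kernel, no
  -- α satisfies this equation, so the empty list loses nothing.
  inverses : Elem rank → List (Elem rank)
  inverses γ = from (kernel-or-coercive rank (mulMatrix γ))
    where
    from : Kernel (mulMatrix γ) ⊎ Coercive (mulMatrix γ) → List (Elem rank)
    from (inj₁ _)       = []
    from (inj₂ (b , _)) = box rank (b ℕ.* (suc (B ℕ.+ B) ℕ.* ‖ one ‖))

  ∈-inverses : ∀ α γ → Inverts α γ → α ∈ inverses γ
  ∈-inverses α γ (i , αγ≡m) with kernel-or-coercive rank (mulMatrix γ)
  ... | inj₁ (w , (j , wj≢0) , γw≡0) = ⊥-elim (wj≢0 (trans (sym (lookup∘tabulate w j))
          (trans (cong (λ v → lookup v j) (·≡0⇒≡0 (pos (suc (toℕ i))) (tabulate w) (λ ())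
            (trans (sym (Inverse.α-cancel O α γ (suc (toℕ i)) αγ≡m (tabulate w))) (trans (cong (α ⊗_) γw) (⊗-zeroʳ α)))))
            (lookup-zeroE j))))
    where
    γw : γ ⊗ tabulate w ≡ zeroE
    γw = lookup-ext λ k → trans (lookup-⊗ γ (tabulate w) k)
      (trans (∑-cong rank (λ j → cong (mulMatrix γ k j *_) (lookup∘tabulate w j))) (trans (γw≡0 k) (sym (lookup-zeroE k))))
  ... | inj₂ (b , coercive) = ∈-box (b ℕ.* r) α (‖‖-least α (b ℕ.* r) (coercive (lookup α) r λ k →
          subst (λ v → ∣ v ∣ ≤ r) (lookup-⊗ γ α k) (ℕₚ.≤-trans (∣lookup∣≤‖‖ (γ ⊗ α) k) norm)))
    where
    r : ℕ
    r = suc (B ℕ.+ B) ℕ.* ‖ one ‖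
    norm : ‖ γ ⊗ α ‖ ≤ r
    norm = ℕₚ.≤-trans (ℕₚ.≤-reflexive (trans (cong ‖_‖ (trans (comm γ α) αγ≡m)) (‖·‖ (pos (suc (toℕ i))) one)))
      (ℕₚ.*-monoˡ-≤ ‖ one ‖ (Finₚ.toℕ<n i))

  good : List (Elem rank)
  good = filter good? (concatMap inverses (box rank R))

  good-complete : ∀ α → Good α → α ∈ good
  good-complete α α-good@(_ , finite) = let γ , γ≤R , inverts = finite⇒inverse α finite in
    ∈-filter⁺ good? (∈-concatMap⁺ inverses (lose (∈-box R γ γ≤R) (∈-inverses α γ inverts))) α-good

theorem6p4 : (O : Order) (D : List ℤ) → 0ℤ ∈ D →
    Σ (List (Elem (Order.rank O))) λ L →
    ∀ α → (IsNumberSystem O α D × HasFiniteness O α D) ⇔ (α ∈ L)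
theorem6p4 O D 0∈D = good , λ α →
    mk⇔ (good-complete α) (λ α∈ → proj₂ (∈-filter⁻ good? {xs = concatMap inverses (box rank _)} α∈))
  where
  open Search O D 0∈D
  open Order O using (rank)
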